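{- Let $X$ be an affine normal variety over $\mathbb{F}_q$ with function field $K=\mathbb{F}_q(X)$, and let $x_0\in X(\mathbb{F}_q)$. Let $f_1,\dots,f_m\in K[t]$ be monic separable polynomials whose coefficients are regular at $x_0$, and let $L_i$ be the splitting field of $f_i$ over $K$ (inside a fixed algebraic closure of $K$), $G_i=\mathrm{Gal}(L_i/K)$, and $L=L_1\cdots L_m$. Assume that $L_1,\dots,L_m$ are mutually linearly disjoint over $K$, and that each specialized polynomial $f_i(x_0)\in\mathbb{F}_q[t]$ has distinct roots in $\overline{\mathbb{F}_q}$. Let $R_i\subset L_i$ be the set of roots of $f_i$ and let $\bar R_{i,x_0}\subset\overline{\mathbb{F}_q}$ be the set of roots of $f_i(x_0)$. Then the action of $\sigma_q(\alpha)=\alpha^q$ (componentwise) on $\bar R_{1,x_0}\times\cdots\times\bar R_{m,x_0}$ is isomorphic to the action of $\mathrm{Frob}_{x_0}\in\mathrm{Gal}(L/K)$ on $R_1\times\cdots\times R_m$; that is, there is a bijection $R_1\times\cdots\times R_m\to\bar R_{1,x_0}\times\cdots\times\bar R_{m,x_0}$ intertwining the two actions. Explicitly, under the isomorphism $\mathrm{Gal}(L/K)\cong G_1\times\cdots\times G_m$, $\sigma\mapsto(\sigma|_{L_1},\dots,\sigma|_{L_m})$, one has $$\mathrm{Frob}_{x_0}=(\mathrm{Frob}_{x_0,1},\dots,\mathrm{Frob}_{x_0,m})\in G_1\times\cdots\times G_m,$$ and this element determines the simultaneous splitting type of $(f_1(x_0),\dots,f_m(x_0))$ over $\mathbb{F}_q$: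 for each $i$, the splitting type of $f_i(x_0)$ is the cycle type of $\mathrm{Frob}_{x_0,i}$ acting on $R_i$.
   Context: All varieties over $\mathbb{F}_q$ are assumed geometrically integral. For $f\in K[t]$ with coefficients regular at $x_0$, $f(x_0)\in\mathbb{F}_q[t]$ is obtained by evaluating the coefficients at $x_0$. A polynomial in $\mathbb{F}_q[t]$ has splitting type $(d_1,\dots,d_r)$ if it is a product of $r$ irreducible polynomials over $\mathbb{F}_q$ of degrees $d_1,\dots,d_r$. The fields $L_1,\dots,L_m$ are mutually linearly disjoint over $K$ if the natural map $L_1\otimes_K\cdots\otimes_K L_m\to L_1\cdots L_m$, $x_1\otimes\cdots\otimes x_m\mapsto x_1\cdots x_m$, is an isomorphism. Frobenius: let $\mathcal{O}$ be the integral closure in $L$ of the local ring $\mathcal{O}_{X,x_0}$, and let $\mathfrak{M}\subset\mathcal{O}$ be a maximal ideal lying over the maximal ideal of $\mathcal{O}_{X,x_0}$. Under the distinct-roots hypothesis the inertia group at $\mathfrak{M}$ is trivial, and there is a unique $\sigma\in\mathrm{Gal}(L/K)$ with $\sigma(a)\equiv a^q\pmod{\mathfrak{M}}$ for all $a\in\mathcal{O}$; $\mathrm{Frob}_{x_0}$ denotes this element (well defined up to conjugation as $\mathfrak{M}$ varies). $\mathrm{Frob}_{x_0,i}\in G_i$ is the analogous element for $L_i$, taken with respect to the maximal ideal $\mathfrak{M}\cap L_i$ of the integral closure of $\mathcal{O}_{X,x_0}$ in $L_i$. An element $(\sigma_1,\dots,\sigma_m)\in G_1\times\cdots\times G_m$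 acts on $R_1\times\cdots\times R_m$ componentwise. -}

module Defs where

open import Level using (Level; _⊔_) renaming (suc to lsuc)
open import Algebra.Bundles using (CommutativeRing)
open import Algebra.Bundles.Raw using (RawRing; RawSemiring; RawGroup)
open import Algebra.Definitions.RawSemiring using (Irreducible; _^_; product)
open import Algebra.Morphism.Bundles using (RingHomomorphism)
open import Algebra.Morphism.Structures using (IsRingHomomorphism; IsRingIsomorphism)
open import Algebra.Morphism.Construct.Composition using (isRingHomomorphism)
import Algebra.Morphism.Construct.Identity as Identity
open import Data.Fin.Base using (Fin; toℕ; zero; suc)
open import Data.List.Base using (List; []; _∷_; _++_; map; foldr; length; lookup; cartesianProductWith)
open import Data.List.Relation.Binary.Pointwise.Base using (Pointwise)
open import Data.List.Relation.Unary.All using (All; reduce)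
import Data.List.Relation.Unary.Unique.Setoid as Unique
open import Data.Nat.Base as ℕ using (ℕ; zero; suc)
open import Data.Nat.GeneralisedArithmetic using (iterate)
open import Data.Product.Base using (Σ-syntax; ∃; ∃-syntax; _×_; _,_; proj₁; proj₂)
open import Data.Sum.Base using (_⊎_)
open import Function.Base using (_on_)
open import Function.Bundles using (Inverse; _⇔_)
open import Function.Definitions using (Bijective)
open import Relation.Binary.Bundles using (Setoid)
open import Relation.Binary.PropositionalEquality using (_≡_; _≢_)
import Relation.Binary.PropositionalEquality as ≡
import Relation.Binary.Construct.On as On
open import Relation.Nullary.Negation using (¬_)
open import Relation.Unary using (Pred; _∈_; _⊆_; U)

private
  variable
    ℓ : Level

Πₛ : {m : ℕ} → (Fin m → Setoid ℓ ℓ) → Setoid ℓ ℓ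
Πₛ S = record
  { Carrier       = ∀ i → Setoid.Carrier (S i)
  ; _≈_           = λ x y → ∀ i → Setoid._≈_ (S i) (x i) (y i)
  ; isEquivalence = record
    { refl  = λ i → Setoid.refl (S i)
    ; sym   = λ x≈y i → Setoid.sym (S i) (x≈y i)
    ; trans = λ x≈y y≈z i → Setoid.trans (S i) (x≈y i) (y≈z i)
    }
  }

-- The j-th cycle is (s , π s , … , π^(dⱼ-1) s) with s = start j; the cycles
-- are disjoint and cover S.
record HasCycleType (S : Setoid ℓ ℓ) (π : Setoid.Carrier S → Setoid.Carrier S)
                    (ds : List ℕ) : Set ℓ where
  open Setoid S
  field
    positive  : All (0 ℕ.<_) ds
    start     : Fin (length ds) → Carrier
    closes    : ∀ j → iterate π (start j) (lookup ds j) ≈ start j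
    partition : Bijective {A = Σ[ j ∈ Fin (length ds) ] Fin (lookup ds j)} _≡_ _≈_
                  (λ (j , e) → iterate π (start j) (toℕ e))

record IsField (R : CommutativeRing ℓ ℓ) : Set ℓ where
  open CommutativeRing R
  field
    1≉0     : ¬ (1# ≈ 0#)
    inverse : ∀ x → ¬ (x ≈ 0#) → ∃[ y ] x * y ≈ 1#

IsDomain : RawRing ℓ ℓ → Set ℓ
IsDomain R = ¬ (1# ≈ 0#) × (∀ x y → x * y ≈ 0# → x ≈ 0# ⊎ y ≈ 0#)
  where open RawRing R

module Polynomial (R : RawRing ℓ ℓ) where
  open RawRing R

  -- Coefficients in order of increasing degree; trailing zeros are
  -- allowed, so equality compares coefficients, not lists.
  Poly : Set ℓ
  Poly = List Carrier

  coeff : Poly → ℕ → Carrier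
  coeff []      _       = 0#
  coeff (a ∷ p) zero    = a
  coeff (a ∷ p) (suc n) = coeff p n

  _≈ₚ_ : Poly → Poly → Set ℓ
  p ≈ₚ q = ∀ n → coeff p n ≈ coeff q n

  _+ₚ_ : Poly → Poly → Poly
  []      +ₚ q       = q
  (a ∷ p) +ₚ []      = a ∷ p
  (a ∷ p) +ₚ (b ∷ q) = (a + b) ∷ (p +ₚ q)

  _*ₚ_ : Poly → Poly → Poly
  []      *ₚ q = []
  (a ∷ p) *ₚ q = map (a *_) q +ₚ (0# ∷ (p *ₚ q))

  rawSemiring[t] : RawSemiring ℓ ℓ
  rawSemiring[t] = record
    { Carrier = Poly ; _≈_ = _≈ₚ_ ; _+_ = _+ₚ_ ; _*_ = _*ₚ_ ; 0# = [] ; 1# = 1# ∷ [] }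

  ∏ₚ : List Poly → Poly
  ∏ₚ = foldr _*ₚ_ (1# ∷ [])

  eval : Poly → Carrier → Carrier
  eval []      x = 0#
  eval (a ∷ p) x = a + x * eval p x

  HasDegree : Poly → ℕ → Set ℓ
  HasDegree p n = ¬ (coeff p n ≈ 0#) × (∀ m → n ℕ.< m → coeff p m ≈ 0#)

  Monic : Poly → Set ℓ
  Monic p = ∃[ n ] coeff p n ≈ 1# × (∀ m → n ℕ.< m → coeff p m ≈ 0#)

  t-_ : Carrier → Poly
  t- r = (- r) ∷ 1# ∷ []

  HasSplittingType : Poly → List ℕ → Set ℓ
  HasSplittingType p ds = ∃[ gs ] p ≈ₚ ∏ₚ gs ×
    Pointwise (λ g d → Irreducible rawSemiring[t] g × HasDegree g d) gs ds

module _ (A : CommutativeRing ℓ ℓ) where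
  open CommutativeRing A
  open Polynomial rawRing public using (Poly; Monic; HasDegree; HasSplittingType)

module _ (A B : CommutativeRing ℓ ℓ)
         (φ : RingHomomorphism (CommutativeRing.rawRing A) (CommutativeRing.rawRing B)) where
  private
    module A = CommutativeRing A
    module B = CommutativeRing B
    module PA = Polynomial A.rawRing
    module PB = Polynomial B.rawRing
  open RingHomomorphism φ

  evalAt : PA.Poly → B.Carrier → B.Carrier
  evalAt p = PB.eval (map ⟦_⟧ p)

  IsRoot : PA.Poly → Pred B.Carrier ℓ
  IsRoot p z = evalAt p z B.≈ B.0#

  Roots : PA.Poly → Setoid ℓ ℓ
  Roots p = record
    { Carrier       = ∃ (IsRoot p)
    ; _≈_           = B._≈_ on proj₁
    ; isEquivalence = On.isEquivalence proj₁ B.isEquivalence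
    }

  -- Intended for monic p and algebraically closed B: the linear factors of p
  -- over B, listed with multiplicity, are pairwise distinct.
  HasDistinctRoots : PA.Poly → Set ℓ
  HasDistinctRoots p = ∃[ rs ] Unique.Unique B.setoid rs ×
    map ⟦_⟧ p PB.≈ₚ PB.∏ₚ (map PB.t-_ rs)

  IntegralOver : ∀ {ℓ′} → Pred A.Carrier ℓ′ → Pred B.Carrier (ℓ ⊔ ℓ′)
  IntegralOver P z = ∃[ p ] PA.Monic p × All P p × IsRoot p z

  data Subalgebra (S : Pred B.Carrier ℓ) : Pred B.Carrier ℓ where
    resp  : ∀ {x y} → x B.≈ y → Subalgebra S x → Subalgebra S y
    const : ∀ a → Subalgebra S ⟦ a ⟧
    gen   : ∀ {x} → x ∈ S → Subalgebra S x
    add   : ∀ {x y} → Subalgebra S x → Subalgebra S y → Subalgebra S (x B.+ y)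
    mul   : ∀ {x y} → Subalgebra S x → Subalgebra S y → Subalgebra S (x B.* y)

record AlgebraicClosure (k : CommutativeRing ℓ ℓ) : Set (lsuc ℓ) where
  field
    ring    : CommutativeRing ℓ ℓ
    isField : IsField ring
    embed   : RingHomomorphism (CommutativeRing.rawRing k) (CommutativeRing.rawRing ring)
  open CommutativeRing ring public hiding (ring)
  private
    module kt = Polynomial (CommutativeRing.rawRing k)
    module Et = Polynomial rawRing
  field
    algebraic : ∀ z → ∃[ p ] ¬ (p kt.≈ₚ []) × IsRoot k ring embed p z
    closed    : ∀ p n → Et.HasDegree p (suc n) → ∃[ z ] Et.eval p z ≈ 0#

record FiniteField (ℓ : Level) : Set (lsuc ℓ) where
  field
    ring        : CommutativeRing ℓ ℓ
    isField     : IsField ring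
    q           : ℕ
    enumeration : Inverse (≡.setoid (Fin q)) (CommutativeRing.setoid ring)
  open CommutativeRing ring public hiding (ring)

-- Laws are omitted: every instance below is a commutative k-algebra.
record RawAlgebra (k : CommutativeRing ℓ ℓ) : Set (lsuc ℓ) where
  field
    rawRing : RawRing ℓ ℓ
    scalar  : CommutativeRing.Carrier k → RawRing.Carrier rawRing
  open RawRing rawRing public

asAlgebra : (k B : CommutativeRing ℓ ℓ) →
            RingHomomorphism (CommutativeRing.rawRing k) (CommutativeRing.rawRing B) →
            RawAlgebra k
asAlgebra k B φ = record
  { rawRing = CommutativeRing.rawRing B ; scalar = RingHomomorphism.⟦_⟧ φ }

-- B₀ ⊗ ⋯ ⊗ Bₘ₋₁ over k: formal sums of c · (x₀ ⊗ ⋯ ⊗ xₘ₋₁), modulo the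
-- multilinear relations.  The coefficient c is what makes m = 0 give k.
module Tensor (k : CommutativeRing ℓ ℓ) {m : ℕ} (B : Fin m → RawAlgebra k) where
  private
    module k = CommutativeRing k
    module B i = RawAlgebra (B i)

  Pure : Set ℓ
  Pure = ∀ i → B.Carrier i

  Formal : Set ℓ
  Formal = List (k.Carrier × Pure)

  AgreeOff : Fin m → Pure → Pure → Set ℓ
  AgreeOff i x y = ∀ j → j ≢ i → B._≈_ j (x j) (y j)

  infix 4 _≈⊗_
  data _≈⊗_ : Formal → Formal → Set ℓ where
    refl  : ∀ {s} → s ≈⊗ s
    sym   : ∀ {s t} → s ≈⊗ t → t ≈⊗ s
    trans : ∀ {s t u} → s ≈⊗ t → t ≈⊗ u → s ≈⊗ u
    prep  : ∀ e {s t} → s ≈⊗ t → e ∷ s ≈⊗ e ∷ t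
    swap  : ∀ e e′ s → e ∷ e′ ∷ s ≈⊗ e′ ∷ e ∷ s
    cong  : ∀ {c d x y s} → c k.≈ d → (∀ i → B._≈_ i (x i) (y i)) →
            (c , x) ∷ s ≈⊗ (d , y) ∷ s
    coeff-+ : ∀ c d x s → (c k.+ d , x) ∷ s ≈⊗ (c , x) ∷ (d , x) ∷ s
    coeff-0 : ∀ x s → (k.0# , x) ∷ s ≈⊗ s
    additive : ∀ i {c x y z s} → AgreeOff i x y → AgreeOff i x z →
               B._≈_ i (x i) (B._+_ i (y i) (z i)) →
               (c , x) ∷ s ≈⊗ (c , y) ∷ (c , z) ∷ s
    homogeneous : ∀ i {c a x y s} → AgreeOff i x y →
                  B._≈_ i (x i) (B._*_ i (B.scalar i a) (y i)) →
                  (c , x) ∷ s ≈⊗ (c k.* a , y) ∷ s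

  rawRing : RawRing ℓ ℓ
  rawRing = record
    { Carrier = Formal
    ; _≈_     = _≈⊗_
    ; _+_     = _++_
    ; _*_     = cartesianProductWith
                  (λ (c , x) (d , y) → c k.* d , λ i → B._*_ i (x i) (y i))
    ; -_      = map (λ (c , x) → k.- c , x)
    ; 0#      = []
    ; 1#      = (k.1# , B.1#) ∷ []
    }

  multiply : (C : RawAlgebra k) → (∀ i → B.Carrier i → RawAlgebra.Carrier C) →
             Formal → RawAlgebra.Carrier C
  multiply C ψ = foldr (λ (c , x) s → scalar c * product rawSemiring (λ i → ψ i (x i)) + s) 0#
    where
    open RawAlgebra C using (scalar; _*_; _+_; 0#) renaming (rawRing to rawC)
    open RawRing rawC using (rawSemiring)

_⊗_ : {k : CommutativeRing ℓ ℓ} → RawAlgebra k → RawAlgebra k → RawRing ℓ ℓ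
_⊗_ {k = k} A B = Tensor.rawRing k {m = 2} λ { zero → A ; (suc _) → B }

record AffineNormalVariety (𝔽q : FiniteField ℓ)
                           (𝔽̄q : AlgebraicClosure (FiniteField.ring 𝔽q)) : Set (lsuc ℓ) where
  private
    module 𝔽q = FiniteField 𝔽q
    module 𝔽̄q = AlgebraicClosure 𝔽̄q
  field
    A         : CommutativeRing ℓ ℓ
    structure : RingHomomorphism 𝔽q.rawRing (CommutativeRing.rawRing A)
  private module A = CommutativeRing A
  field
    finitelyGenerated    : ∃[ n ] Σ[ g ∈ (Fin n → A.Carrier) ]
                           ∀ a → Subalgebra 𝔽q.ring A structure (λ x → ∃[ i ] g i A.≈ x) a
    geometricallyIntegral : IsDomain (asAlgebra 𝔽q.ring A structure ⊗ asAlgebra 𝔽q.ring 𝔽̄q.ring 𝔽̄q.embed)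
    K        : CommutativeRing ℓ ℓ
    K-field  : IsField K
  private module K = CommutativeRing K
  field
    toK      : RingHomomorphism A.rawRing K.rawRing
  open RingHomomorphism toK using () renaming (⟦_⟧ to ι)
  field
    toK-injective : ∀ a b → ι a K.≈ ι b → a A.≈ b
    fraction      : ∀ x → ∃[ a ] ∃[ b ] ¬ (b A.≈ A.0#) × x K.* ι b K.≈ ι a
    normal        : ∀ x → IntegralOver A K toK U x → ∃[ a ] ι a K.≈ x

record Setting (ℓ : Level) : Set (lsuc ℓ) where
  field
    𝔽q  : FiniteField ℓ
    𝔽̄q  : AlgebraicClosure (FiniteField.ring 𝔽q)
    X   : AffineNormalVariety 𝔽q 𝔽̄q
    Ω   : AlgebraicClosure (AffineNormalVariety.K X)
  open AffineNormalVariety X public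
  private
    module 𝔽q = FiniteField 𝔽q
    module A = CommutativeRing A
  field
    x₀     : RingHomomorphism A.rawRing 𝔽q.rawRing
    x₀-𝔽q  : ∀ c → RingHomomorphism.⟦_⟧ x₀ (RingHomomorphism.⟦_⟧ structure c) 𝔽q.≈ c

module Over (𝒮 : Setting ℓ) where
  open Setting 𝒮 public
  module 𝔽q = FiniteField 𝔽q
  module 𝔽̄q = AlgebraicClosure 𝔽̄q
  module A = CommutativeRing A
  module K = CommutativeRing K
  module Ω = AlgebraicClosure Ω
  open FiniteField 𝔽q public using (q)

  private
    module toK = RingHomomorphism toK
    module ev = RingHomomorphism x₀
    module ι = RingHomomorphism Ω.embed

  infixr 8 _^Ω_ _^𝔽̄q_
  _^Ω_ : Ω.Carrier → ℕ → Ω.Carrier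
  _^Ω_ = _^_ (RawRing.rawSemiring Ω.rawRing)

  _^𝔽̄q_ : 𝔽̄q.Carrier → ℕ → 𝔽̄q.Carrier
  _^𝔽̄q_ = _^_ (RawRing.rawSemiring 𝔽̄q.rawRing)

  -- The local ring of X at x₀, as a subset of K
  Regular : Pred K.Carrier ℓ
  Regular x = ∃[ a ] ∃[ b ] ¬ (ev.⟦ b ⟧ 𝔽q.≈ 𝔽q.0#) × x K.* toK.⟦ b ⟧ K.≈ toK.⟦ a ⟧

  value : ∀ {x} → Regular x → 𝔽q.Carrier
  value (a , b , b≉0 , _) = ev.⟦ a ⟧ 𝔽q.* proj₁ (IsField.inverse 𝔽q.isField ev.⟦ b ⟧ b≉0)

  specialize : {f : Poly K} → All Regular f → Poly 𝔽q.ring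
  specialize = reduce value

  data K⟮_⟯ (S : Pred Ω.Carrier ℓ) : Pred Ω.Carrier ℓ where
    resp : ∀ {x y} → x Ω.≈ y → K⟮ S ⟯ x → K⟮ S ⟯ y
    base : ∀ c → K⟮ S ⟯ ι.⟦ c ⟧
    gen  : ∀ {x} → x ∈ S → K⟮ S ⟯ x
    add  : ∀ {x y} → K⟮ S ⟯ x → K⟮ S ⟯ y → K⟮ S ⟯ (x Ω.+ y)
    mul  : ∀ {x y} → K⟮ S ⟯ x → K⟮ S ⟯ y → K⟮ S ⟯ (x Ω.* y)
    neg  : ∀ {x} → K⟮ S ⟯ x → K⟮ S ⟯ (Ω.- x)
    inv  : ∀ {x y} → K⟮ S ⟯ x → x Ω.* y Ω.≈ Ω.1# → K⟮ S ⟯ y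

  -- Only the raw operations: the ring laws are those of Ω.
  subfield : Pred Ω.Carrier ℓ → RawAlgebra K
  subfield S = record
    { rawRing = record
      { Carrier = ∃ K⟮ S ⟯
      ; _≈_     = Ω._≈_ on proj₁
      ; _+_     = λ (x , x∈) (y , y∈) → x Ω.+ y , add x∈ y∈
      ; _*_     = λ (x , x∈) (y , y∈) → x Ω.* y , mul x∈ y∈
      ; -_      = λ (x , x∈) → Ω.- x , neg x∈
      ; 0#      = Ω.0# , resp ι.0#-homo (base K.0#)
      ; 1#      = Ω.1# , resp ι.1#-homo (base K.1#)
      }
    ; scalar  = λ c → ι.⟦ c ⟧ , base c
    }

  record Gal (S : Pred Ω.Carrier ℓ) : Set ℓ where
    private
      module F = RawAlgebra (subfield S)
    field
      to       : F.Carrier → F.Carrier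
      from     : F.Carrier → F.Carrier
      to-hom   : IsRingHomomorphism F.rawRing F.rawRing to
      from-hom : IsRingHomomorphism F.rawRing F.rawRing from
      to-from  : ∀ z → to (from z) F.≈ z
      from-to  : ∀ z → from (to z) F.≈ z
      fixes    : ∀ c → to (F.scalar c) F.≈ F.scalar c
    module to   = IsRingHomomorphism to-hom
    module from = IsRingHomomorphism from-hom

  galoisGroup : Pred Ω.Carrier ℓ → RawGroup ℓ ℓ
  galoisGroup S = record
    { Carrier = Gal S
    ; _≈_     = λ σ τ → ∀ z → Gal.to σ z F.≈ Gal.to τ z
    ; _∙_     = compose
    ; ε       = record
      { to = λ z → z ; from = λ z → z
      ; to-hom = idHom ; from-hom = idHom
      ; to-from = λ _ → Ω.refl ; from-to = λ _ → Ω.refl ; fixes = λ _ → Ω.refl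
      }
    ; _⁻¹     = λ σ → let module σ = Gal σ in record
      { to = σ.from ; from = σ.to ; to-hom = σ.from-hom ; from-hom = σ.to-hom
      ; to-from = σ.from-to ; from-to = σ.to-from
      ; fixes = λ c → Ω.trans (σ.from.⟦⟧-cong {F.scalar c} {σ.to (F.scalar c)} (Ω.sym (σ.fixes c)))
                              (σ.from-to (F.scalar c))
      }
    }
    where
    module F = RawAlgebra (subfield S)

    idHom : IsRingHomomorphism F.rawRing F.rawRing (λ z → z)
    idHom = Identity.isRingHomomorphism F.rawRing Ω.refl

    compose : Gal S → Gal S → Gal S
    compose σ τ = record
      { to = λ z → σ.to (τ.to z) ; from = λ z → τ.from (σ.from z)
      ; to-hom   = isRingHomomorphism Ω.trans τ.to-hom σ.to-hom
      ; from-hom = isRingHomomorphism Ω.trans σ.from-hom τ.from-hom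
      ; to-from  = λ z → Ω.trans (σ.to.⟦⟧-cong {τ.to (τ.from (σ.from z))} {σ.from z} (τ.to-from (σ.from z)))
                                 (σ.to-from z)
      ; from-to  = λ z → Ω.trans (τ.from.⟦⟧-cong {σ.from (σ.to (τ.to z))} {τ.to z} (σ.from-to (τ.to z)))
                                 (τ.from-to z)
      ; fixes    = λ c → Ω.trans (σ.to.⟦⟧-cong {τ.to (F.scalar c)} {F.scalar c} (τ.fixes c)) (σ.fixes c)
      }
      where
      module σ = Gal σ
      module τ = Gal τ

  Πᵍ : {m : ℕ} → (Fin m → RawGroup ℓ ℓ) → RawGroup ℓ ℓ
  Πᵍ G = record
    { Carrier = ∀ i → RawGroup.Carrier (G i)
    ; _≈_     = λ σ τ → ∀ i → RawGroup._≈_ (G i) (σ i) (τ i)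
    ; _∙_     = λ σ τ i → RawGroup._∙_ (G i) (σ i) (τ i)
    ; ε       = λ i → RawGroup.ε (G i)
    ; _⁻¹     = λ σ i → RawGroup._⁻¹ (G i) (σ i)
    }

  RootOf : Poly K → Pred Ω.Carrier ℓ
  RootOf = IsRoot K Ω.ring Ω.embed

  RootsΩ : Poly K → Setoid ℓ ℓ
  RootsΩ = Roots K Ω.ring Ω.embed

  Roots𝔽̄q : Poly 𝔽q.ring → Setoid ℓ ℓ
  Roots𝔽̄q = Roots 𝔽q.ring 𝔽̄q.ring 𝔽̄q.embed

  Separable : Poly K → Set ℓ
  Separable = HasDistinctRoots K Ω.ring Ω.embed

  DistinctRoots𝔽̄q : Poly 𝔽q.ring → Set ℓ
  DistinctRoots𝔽̄q = HasDistinctRoots 𝔽q.ring 𝔽̄q.ring 𝔽̄q.embed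

  module _ {S : Pred Ω.Carrier ℓ} (σ : Gal S) where
    private
      module F = RawAlgebra (subfield S)
      module σ = Gal σ

      ⟪_⟫ : Poly K → Ω.Carrier → Ω.Carrier
      ⟪ f ⟫ = evalAt K Ω.ring Ω.embed f

      eval∈ : ∀ f (z : F.Carrier) → K⟮ S ⟯ (⟪ f ⟫ (proj₁ z))
      eval∈ []      z = proj₂ F.0#
      eval∈ (a ∷ f) z = add (base a) (mul (proj₂ z) (eval∈ f z))

      σ-eval : ∀ f z → proj₁ (σ.to (⟪ f ⟫ (proj₁ z) , eval∈ f z)) Ω.≈ ⟪ f ⟫ (proj₁ (σ.to z))
      σ-eval []      z = σ.to.0#-homo
      σ-eval (a ∷ f) z = Ω.trans
        (σ.to.+-homo (F.scalar a) (z F.* (⟪ f ⟫ (proj₁ z) , eval∈ f z)))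
        (Ω.+-cong (σ.fixes a)
          (Ω.trans (σ.to.*-homo z (⟪ f ⟫ (proj₁ z) , eval∈ f z)) (Ω.*-cong Ω.refl (σ-eval f z))))

    act : (f : Poly K) → RootOf f ⊆ K⟮ S ⟯ →
          Setoid.Carrier (RootsΩ f) → Setoid.Carrier (RootsΩ f)
    act f R⊆ (r , fr≈0) = proj₁ (σ.to z) ,
      Ω.trans (Ω.sym (σ-eval f z))
        (Ω.trans (σ.to.⟦⟧-cong {⟪ f ⟫ r , eval∈ f z} {F.0#} fr≈0) σ.to.0#-homo)
      where
      z : F.Carrier
      z = r , R⊆ fr≈0

  -- The integral closure of the local ring at x₀ in K⟮ S ⟯
  𝒪 : Pred Ω.Carrier ℓ → Pred Ω.Carrier ℓ
  𝒪 S z = z ∈ K⟮ S ⟯ × IntegralOver K Ω.ring Ω.embed Regular z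

  record IsIdeal (R J : Pred Ω.Carrier ℓ) : Set ℓ where
    field
      ≈∈     : ∀ {x y} → x Ω.≈ y → x ∈ J → y ∈ J
      subset : J ⊆ R
      0∈     : Ω.0# ∈ J
      +∈     : ∀ {x y} → x ∈ J → y ∈ J → x Ω.+ y ∈ J
      *∈     : ∀ {r x} → r ∈ R → x ∈ J → r Ω.* x ∈ J

  record IsMaximalIdeal (R M : Pred Ω.Carrier ℓ) : Set (lsuc ℓ) where
    field
      isIdeal : IsIdeal R M
      proper  : ¬ (Ω.1# ∈ M)
      maximal : ∀ J → IsIdeal R J → ¬ (Ω.1# ∈ J) → M ⊆ J → J ⊆ M

  LiesOver-x₀ : Pred Ω.Carrier ℓ → Set ℓ
  LiesOver-x₀ M = ∀ x (r : Regular x) → ι.⟦ x ⟧ ∈ M ⇔ value r 𝔽q.≈ 𝔽q.0#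

  -- M is a maximal ideal of 𝒪 S; uniqueness of σ is not part of the definition.
  IsFrobenius : {S : Pred Ω.Carrier ℓ} → Pred Ω.Carrier ℓ → Gal S → Set ℓ
  IsFrobenius {S} M σ = ∀ a (a∈ : a ∈ 𝒪 S) →
    (proj₁ (Gal.to σ (a , proj₁ a∈)) Ω.- (a ^Ω q)) ∈ M

  module _ {m : ℕ} (f : Fin m → Poly K) where

    -- Generators of L₁ ⋯ Lₘ
    ⋃L : Pred Ω.Carrier ℓ
    ⋃L z = ∃[ i ] z ∈ K⟮ RootOf (f i) ⟯

    Lᵢ⊆L : ∀ i → RawAlgebra.Carrier (subfield (RootOf (f i))) → RawAlgebra.Carrier (subfield ⋃L)
    Lᵢ⊆L i (z , z∈) = z , gen (i , z∈)

    LinearlyDisjoint : Set ℓ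
    LinearlyDisjoint = IsRingIsomorphism L⊗.rawRing (RawAlgebra.rawRing (subfield ⋃L))
                         (L⊗.multiply (subfield ⋃L) Lᵢ⊆L)
      where module L⊗ = Tensor K (λ i → subfield (RootOf (f i)))

{-# OPTIONS --safe #-}
module Submission where

-- The residue ring E of the integral closure at M is a domain containing 𝔽q, in which the
-- specialized polynomial p splits into the reductions of the roots of f.  Let an irreducible
-- factor g of p, of degree d, have a root β in a domain over 𝔽q.  If β is fixed by the n-th
-- iterate of Frobenius, so are the q^d distinct values at β of the polynomials of degree less
-- than d, all roots of t^(q^n) - t; hence d ≤ n.  So the roots of g are exactly β, β^q, …,
-- β^(q^(d-1)), and the splitting type of p is the cycle type of Frobenius on its roots, both
-- in E and in the algebraic closure of 𝔽q.  Since p has distinct roots in the latter, its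
-- irreducible factors do not divide one another, whence it has distinct roots in E too, and
-- reduction maps the roots of f bijectively to those of p, turning Frob into x ↦ x^q.  Equality
-- of cycle types then replaces a choice of embedding of E into the algebraic closure of 𝔽q.
-- That E is a domain needs sums and products of integral elements to be integral, which is
-- proved by a division-free elimination.  The isomorphism of Galois groups comes from letting
-- a family of automorphisms act factorwise on the tensor product of the fields.

open import Defs hiding (Poly; Monic; HasDegree; HasSplittingType; _⊗_)
open import Algebra.Bundles using (CommutativeRing)
open import Algebra.Bundles.Raw using (RawRing; RawGroup)
import Algebra.Definitions.RawMagma as RawMagma
import Algebra.Definitions.RawSemiring as RawSemiring
open import Algebra.Definitions.RawSemiring using (product)
open import Algebra.Morphism.Bundles using (RingHomomorphism)
open import Algebra.Morphism.Construct.Composition using (isRingHomomorphism)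
import Algebra.Morphism.RingMonomorphism
open import Algebra.Morphism.Structures using (IsRingHomomorphism; IsRingIsomorphism; IsGroupIsomorphism)
import Algebra.Properties.CommutativeMonoid.Sum
import Algebra.Properties.CommutativeSemigroup
import Algebra.Properties.CommutativeSemiring.Exp
import Algebra.Properties.Ring
import Algebra.Properties.Semiring.Mult.TCOptimised
import Algebra.Properties.Semiring.Sum
import Algebra.Solver.Ring
open import Algebra.Solver.Ring.AlmostCommutativeRing using (_-Raw-AlmostCommutative⟶_; fromCommutativeRing)
open import Axiom.ExcludedMiddle using (ExcludedMiddle)
open import Data.Empty using (⊥-elim)
open import Data.Fin.Base as Fin using (Fin; zero; suc; toℕ; fromℕ<; punchIn; finToFun; funToFin; combine; remQuot)
open import Data.Fin.Permutation using (Permutation; permutation; _⟨$⟩ʳ_)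
import Data.Fin.Properties as Fin
open import Data.Integer.Base as ℤ using (ℤ; +_; -[1+_])
import Data.Integer.Properties as ℤ
open import Data.List.Base using (List; []; _∷_; _++_; map; length; lookup; tabulate)
open import Data.List.Membership.Propositional using () renaming (_∈_ to _∈ₗ_)
open import Data.List.Membership.Propositional.Properties using (∈-lookup)
open import Data.List.Properties using (map-cong; map-∘; map-id; map-++)
open import Data.List.Relation.Binary.Pointwise using (Pointwise; []; _∷_; ++⁺)
open import Data.List.Relation.Unary.All as All using (All; []; _∷_)
import Data.List.Relation.Unary.All.Properties as Allₚ
open import Data.List.Relation.Unary.AllPairs as AllPairs using (AllPairs; []; _∷_)
import Data.List.Relation.Unary.AllPairs.Properties as AllPairsₚ
open import Data.List.Relation.Unary.Any as Any using (Any; here; there)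
import Data.List.Relation.Unary.Any.Properties as Anyₚ
import Data.List.Relation.Unary.Unique.Setoid as Unique
open import Data.Maybe.Base using (Maybe; just; nothing)
open import Data.Nat.Base as ℕ using (ℕ; zero; suc; _≤_; _<_; _∸_; z≤n; s≤s)
open import Data.Nat.GeneralisedArithmetic using (iterate)
open import Data.Nat.Induction using (<-rec)
import Data.Nat.Properties as ℕ
open import Data.Product.Base using (_×_; _,_; proj₁; proj₂; ∃; ∃-syntax; Σ-syntax)
open import Data.Sum.Base using (_⊎_; inj₁; inj₂)
open import Data.Vec.Functional using (removeAt; replicate)
open import Function.Base using (_on_)
open import Function.Bundles using (Bijection; Equivalence; Inverse; _⇔_; mk⇔)
import Function.Construct.Composition as Composition
import Function.Construct.Identity as Identity
open import Level using (Level)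
open import Relation.Binary.Bundles using (Setoid)
open import Relation.Binary.Definitions using (Symmetric; tri<; tri≈; tri>)
open import Relation.Binary.PropositionalEquality using (_≡_; _≢_)
import Relation.Binary.PropositionalEquality as ≡
import Relation.Binary.Reasoning.Setoid
open import Relation.Binary.Structures using (IsEquivalence)
open import Relation.Nullary.Decidable using (Dec; yes; no)
open import Relation.Nullary.Negation using (¬_)
open import Relation.Unary using (Pred; _∈_; _⊆_; _∩_)

-- What passes from the closure of `𝔽q` to the residue ring is a statement about 𝔽q[t] alone: no
-- factor of `p` divides a later one. In a domain over which `p` splits, this amounts to
-- distinctness of the roots. A common root of two irreducible factors forces divisibility, and an
-- irreducible factor has no double root, since the whole Frobenius orbit of such a root would
-- consist of roots of the cofactor, whose degree is too small. Thus no derivative, discriminant or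
-- perfectness of finite fields is involved. The residue ring is used only as a domain, never
-- through inverses. Counting roots in a domain carries the argument, down to the additivity of x ↦
-- x^q, which is obtained without the characteristic or binomial coefficients. Injectivity of
-- reduction on the roots also yields uniqueness of the Frobenius elements: two automorphisms that
-- act as the q-th power modulo `M` send a root to congruent roots, hence to the same root, and the
-- roots generate the fields. This takes the place of the triviality of the inertia group.

private
  variable
    ℓ : Level

-- A ring solver with integer coefficients

module IntegerSolver (R : CommutativeRing ℓ ℓ) where
  open CommutativeRing R
  open Algebra.Properties.Ring ring
  open Algebra.Properties.Semiring.Mult.TCOptimised semiring using (1+×; ×-homo-+; ×1-homo-*) renaming (_×_ to _×ᵣ_)
  open import Relation.Binary.Reasoning.Setoid setoid

  private
    ⟦_⟧ℤ : ℤ → Carrier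
    ⟦ + n ⟧ℤ      = n ×ᵣ 1#
    ⟦ -[1+ n ] ⟧ℤ = - (suc n ×ᵣ 1#)

    x-0 : ∀ x → x - 0# ≈ x
    x-0 x = trans (+-congˡ -0#≈0#) (+-identityʳ x)

    cancel : ∀ x a b → (x + a) - (x + b) ≈ a - b
    cancel x a b = begin
      (x + a) - (x + b)        ≈⟨ +-cong (+-comm x a) (sym (-‿+-comm x b)) ⟩
      (a + x) + (- x + - b)    ≈⟨ +-assoc a x _ ⟩
      a + (x + (- x + - b))    ≈⟨ +-congˡ (+-assoc x (- x) (- b)) ⟨
      a + ((x + - x) + - b)    ≈⟨ +-congˡ (+-congʳ (-‿inverseʳ x)) ⟩
      a + (0# + - b)           ≈⟨ +-congˡ (+-identityˡ _) ⟩
      a - b                    ∎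

    ⊖-homo : ∀ m n → ⟦ m ℤ.⊖ n ⟧ℤ ≈ m ×ᵣ 1# - n ×ᵣ 1#
    ⊖-homo m       zero    = sym (x-0 _)
    ⊖-homo zero    (suc n) = sym (+-identityˡ _)
    ⊖-homo (suc m) (suc n) rewrite ℤ.[1+m]⊖[1+n]≡m⊖n m n = begin
      ⟦ m ℤ.⊖ n ⟧ℤ                         ≈⟨ ⊖-homo m n ⟩
      m ×ᵣ 1# - n ×ᵣ 1#                      ≈⟨ cancel 1# (m ×ᵣ 1#) (n ×ᵣ 1#) ⟨
      (1# + m ×ᵣ 1#) - (1# + n ×ᵣ 1#)        ≈⟨ +-cong (1+× m 1#) (-‿cong (1+× n 1#)) ⟨
      suc m ×ᵣ 1# - suc n ×ᵣ 1#              ∎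

    +-homo : ∀ i j → ⟦ i ℤ.+ j ⟧ℤ ≈ ⟦ i ⟧ℤ + ⟦ j ⟧ℤ
    +-homo (+ m)      (+ n)      = ×-homo-+ 1# m n
    +-homo (+ m)      (-[1+ n ]) = ⊖-homo m (suc n)
    +-homo (-[1+ m ]) (+ n)      = trans (⊖-homo n (suc m)) (+-comm _ _)
    +-homo (-[1+ m ]) (-[1+ n ]) = begin
      - (suc (suc (m ℕ.+ n)) ×ᵣ 1#)        ≡⟨ ≡.cong (λ k → - (k ×ᵣ 1#)) (ℕ.+-suc (suc m) n) ⟨
      - ((suc m ℕ.+ suc n) ×ᵣ 1#)          ≈⟨ -‿cong (×-homo-+ 1# (suc m) (suc n)) ⟩
      - (suc m ×ᵣ 1# + suc n ×ᵣ 1#)         ≈⟨ -‿+-comm _ _ ⟨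
      - (suc m ×ᵣ 1#) + - (suc n ×ᵣ 1#)     ∎

    -‿homo : ∀ i → ⟦ ℤ.- i ⟧ℤ ≈ - ⟦ i ⟧ℤ
    -‿homo (+ zero)   = sym -0#≈0#
    -‿homo (+ suc n)  = refl
    -‿homo (-[1+ n ]) = sym (-‿involutive _)

    *-homo⁺ : ∀ m j → ⟦ + m ℤ.* j ⟧ℤ ≈ m ×ᵣ 1# * ⟦ j ⟧ℤ
    *-homo⁺ m (+ n)      rewrite ≡.sym (ℤ.pos-* m n) = ×1-homo-* m n
    *-homo⁺ m (-[1+ n ]) = begin
      ⟦ + m ℤ.* -[1+ n ] ⟧ℤ        ≡⟨ ≡.cong ⟦_⟧ℤ (ℤ.neg-distribʳ-* (+ m) (+ suc n)) ⟨
      ⟦ ℤ.- (+ m ℤ.* + suc n) ⟧ℤ   ≈⟨ -‿homo (+ m ℤ.* + suc n) ⟩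
      - ⟦ + m ℤ.* + suc n ⟧ℤ       ≈⟨ -‿cong (*-homo⁺ m (+ suc n)) ⟩
      - (m ×ᵣ 1# * (suc n ×ᵣ 1#))    ≈⟨ -‿distribʳ-* _ _ ⟩
      m ×ᵣ 1# * - (suc n ×ᵣ 1#)      ∎

    *-homo : ∀ i j → ⟦ i ℤ.* j ⟧ℤ ≈ ⟦ i ⟧ℤ * ⟦ j ⟧ℤ
    *-homo (+ m)      j = *-homo⁺ m j
    *-homo (-[1+ m ]) j = begin
      ⟦ -[1+ m ] ℤ.* j ⟧ℤ        ≡⟨ ≡.cong ⟦_⟧ℤ (ℤ.neg-distribˡ-* (+ suc m) j) ⟨
      ⟦ ℤ.- (+ suc m ℤ.* j) ⟧ℤ   ≈⟨ -‿homo (+ suc m ℤ.* j) ⟩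
      - ⟦ + suc m ℤ.* j ⟧ℤ       ≈⟨ -‿cong (*-homo⁺ (suc m) j) ⟩
      - (suc m ×ᵣ 1# * ⟦ j ⟧ℤ)    ≈⟨ -‿distribˡ-* _ _ ⟩
      - (suc m ×ᵣ 1#) * ⟦ j ⟧ℤ    ∎

    homomorphism : ℤ.+-*-rawRing -Raw-AlmostCommutative⟶ fromCommutativeRing R
    homomorphism = record
      { ⟦_⟧ = ⟦_⟧ℤ ; +-homo = +-homo ; *-homo = *-homo ; -‿homo = -‿homo
      ; 0-homo = refl ; 1-homo = refl }

    _≟′_ : ∀ i j → Maybe (⟦ i ⟧ℤ ≈ ⟦ j ⟧ℤ)
    i ≟′ j with i ℤ.≟ j
    ... | yes i≡j = just (reflexive (≡.cong ⟦_⟧ℤ i≡j))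
    ... | no  _   = nothing

  open Algebra.Solver.Ring ℤ.+-*-rawRing (fromCommutativeRing R) homomorphism _≟′_ public
    using (solve; _:=_; _:+_; _:*_; _:-_; :-_; con)

-- Solved over a variable ring, whose operations do not compute.
module RingIdentities (R : CommutativeRing ℓ ℓ) where
  open CommutativeRing R
  open IntegerSolver R

  shift-sum : ∀ x y z → x + y ≈ (z + x) + (y - z)
  shift-sum = solve 3 (λ x y z → x :+ y := (z :+ x) :+ (y :- z)) refl

  sub-sub : ∀ x y z → (x - y) - z ≈ x - (y + z)
  sub-sub = solve 3 (λ x y z → (x :- y) :- z := x :- (y :+ z)) refl

  cross-multiply : ∀ p r u s t → p * s + (- r) * t ≈ p * (r * u + s) + (- r) * (p * u + t)
  cross-multiply = solve 5 (λ p r u s t →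
    p :* s :+ (:- r) :* t := p :* (r :* u :+ s) :+ (:- r) :* (p :* u :+ t)) refl

  expand-minor : ∀ m p r s u → (m * p - r * s) * u ≈ p * (m * u) + (- r) * (s * u)
  expand-minor = solve 5 (λ m p r s u →
    (m :* p :- r :* s) :* u := p :* (m :* u) :+ (:- r) :* (s :* u)) refl

  expand-entry : ∀ a z d e → (- a + z * (d + z * 0#)) * e ≈ z * (d * e) + (- 1#) * (a * e)
  expand-entry = solve 4 (λ a z d e →
    (:- a :+ z :* (d :+ z :* con (+ 0))) :* e := z :* (d :* e) :+ (:- con (+ 1)) :* (a :* e)) refl

  minus-self : ∀ x → x + (- 1#) * x ≈ 0#
  minus-self = solve 1 (λ x → x :+ (:- con (+ 1)) :* x := con (+ 0)) refl

  sum-fraction : ∀ x y b d → (x + y) * (b * d) ≈ (x * b) * d + (y * d) * b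
  sum-fraction = solve 4 (λ x y b d → (x :+ y) :* (b :* d) := (x :* b) :* d :+ (y :* d) :* b) refl

  product-fraction : ∀ x y b d → (x * y) * (b * d) ≈ (x * b) * (y * d)
  product-fraction = solve 4 (λ x y b d → (x :* y) :* (b :* d) := (x :* b) :* (y :* d)) refl

  vanishing-numerator : ∀ u v w → (u - (u * w) * v) * w ≈ u * w - (u * w) * (v * w)
  vanishing-numerator = solve 3 (λ u v w → (u :- (u :* w) :* v) :* w := u :* w :- (u :* w) :* (v :* w)) refl

  difference-* : ∀ x c b → (x - c) * b ≈ x * b - c * b
  difference-* = solve 3 (λ x c b → (x :- c) :* b := x :* b :- c :* b) refl

  combine-sum : ∀ m r n s x → (m + r * x) + (n + s * x) ≈ (m + n) + (r + s) * x
  combine-sum = solve 5 (λ m r n s x →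
    (m :+ r :* x) :+ (n :+ s :* x) := (m :+ n) :+ (r :+ s) :* x) refl

  combine-product : ∀ t m r x → t * (m + r * x) ≈ t * m + (t * r) * x
  combine-product = solve 4 (λ t m r x → t :* (m :+ r :* x) := t :* m :+ (t :* r) :* x) refl

  distribute-unit : ∀ m r x y → (m + r * x) * y ≈ y * m + r * (x * y)
  distribute-unit = solve 4 (λ m r x y → (m :+ r :* x) :* y := y :* m :+ r :* (x :* y)) refl

-- Polynomials over a commutative ring

module PolynomialRing (R : CommutativeRing ℓ ℓ) where
  open CommutativeRing R hiding (zero)
  open IntegerSolver R
  open Polynomial rawRing public
    renaming (t-_ to infix 9 t-_; _+ₚ_ to infixl 6 _+ₚ_; _*ₚ_ to infixl 7 _*ₚ_)
  open Relation.Binary.Reasoning.Setoid setoid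

  infix 4 _≋_
  infixl 7 _·_
  infixr 8 _^_ _^ₚ_

  _^_ : Carrier → ℕ → Carrier
  _^_ = RawSemiring._^_ (RawRing.rawSemiring rawRing)

  _^ₚ_ : Poly → ℕ → Poly
  _^ₚ_ = RawSemiring._^_ rawSemiring[t]

  -- A record, so that p and q can be inferred from a proof of p ≋ q.
  record _≋_ (p q : Poly) : Set ℓ where
    constructor coeffwise
    field
      at : p ≈ₚ q
  open _≋_ public

  -ₚ_ : Poly → Poly
  -ₚ_ = map (-_)

  _·_ : Carrier → Poly → Poly
  a · p = map (a *_) p

  1ₚ : Poly
  1ₚ = 1# ∷ []

  ≋-refl : ∀ {p} → p ≋ p
  ≋-refl = coeffwise λ _ → refl

  ≋-sym : ∀ {p q} → p ≋ q → q ≋ p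
  ≋-sym p≋q = coeffwise λ n → sym (at p≋q n)

  ≋-trans : ∀ {p q r} → p ≋ q → q ≋ r → p ≋ r
  ≋-trans p≋q q≋r = coeffwise λ n → trans (at p≋q n) (at q≋r n)

  infixr 5 _∷-cong_
  _∷-cong_ : ∀ {a b p q} → a ≈ b → p ≋ q → a ∷ p ≋ b ∷ q
  a≈b ∷-cong p≋q = coeffwise λ { zero → a≈b ; (suc n) → at p≋q n }

  tail-≋ : ∀ {a b p q} → a ∷ p ≋ b ∷ q → p ≋ q
  tail-≋ eq = coeffwise λ n → at eq (suc n)

  tail-≋[] : ∀ {a p} → a ∷ p ≋ [] → p ≋ []
  tail-≋[] eq = coeffwise λ n → at eq (suc n)

  0∷[] : ∀ {p} → p ≋ [] → 0# ∷ p ≋ []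
  0∷[] p≋[] = coeffwise λ { zero → refl ; (suc n) → at p≋[] n }

  coeff-+ : ∀ p q n → coeff (p +ₚ q) n ≈ coeff p n + coeff q n
  coeff-+ []      q       n       = sym (+-identityˡ _)
  coeff-+ (a ∷ p) []      n       = sym (+-identityʳ _)
  coeff-+ (a ∷ p) (b ∷ q) zero    = refl
  coeff-+ (a ∷ p) (b ∷ q) (suc n) = coeff-+ p q n

  coeff-· : ∀ a p n → coeff (a · p) n ≈ a * coeff p n
  coeff-· a []      n       = sym (zeroʳ a)
  coeff-· a (b ∷ p) zero    = refl
  coeff-· a (b ∷ p) (suc n) = coeff-· a p n

  coeff-neg : ∀ p n → coeff (-ₚ p) n ≈ - coeff p n
  coeff-neg []      n       = solve 0 (con (+ 0) := :- con (+ 0)) refl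
  coeff-neg (a ∷ p) zero    = refl
  coeff-neg (a ∷ p) (suc n) = coeff-neg p n

  +ₚ-cong : ∀ {p p′ q q′} → p ≋ p′ → q ≋ q′ → p +ₚ q ≋ p′ +ₚ q′
  +ₚ-cong {p} {p′} {q} {q′} p≋p′ q≋q′ = coeffwise λ n → begin
    coeff (p +ₚ q) n         ≈⟨ coeff-+ p q n ⟩
    coeff p n + coeff q n    ≈⟨ +-cong (at p≋p′ n) (at q≋q′ n) ⟩
    coeff p′ n + coeff q′ n  ≈⟨ coeff-+ p′ q′ n ⟨
    coeff (p′ +ₚ q′) n       ∎

  +ₚ-assoc : ∀ p q r → (p +ₚ q) +ₚ r ≋ p +ₚ (q +ₚ r)
  +ₚ-assoc p q r = coeffwise λ n → begin
    coeff ((p +ₚ q) +ₚ r) n                ≈⟨ coeff-+ (p +ₚ q) r n ⟩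
    coeff (p +ₚ q) n + coeff r n           ≈⟨ +-congʳ (coeff-+ p q n) ⟩
    coeff p n + coeff q n + coeff r n      ≈⟨ +-assoc _ _ _ ⟩
    coeff p n + (coeff q n + coeff r n)    ≈⟨ +-congˡ (coeff-+ q r n) ⟨
    coeff p n + coeff (q +ₚ r) n           ≈⟨ coeff-+ p (q +ₚ r) n ⟨
    coeff (p +ₚ (q +ₚ r)) n                ∎

  +ₚ-comm : ∀ p q → p +ₚ q ≋ q +ₚ p
  +ₚ-comm p q = coeffwise λ n →
    trans (coeff-+ p q n) (trans (+-comm _ _) (sym (coeff-+ q p n)))

  +ₚ-identityʳ : ∀ p → p +ₚ [] ≋ p
  +ₚ-identityʳ []      = ≋-refl
  +ₚ-identityʳ (a ∷ p) = ≋-refl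

  -ₚ-cong : ∀ {p q} → p ≋ q → -ₚ p ≋ -ₚ q
  -ₚ-cong {p} {q} p≋q = coeffwise λ n →
    trans (coeff-neg p n) (trans (-‿cong (at p≋q n)) (sym (coeff-neg q n)))

  -ₚ-inverseˡ : ∀ p → -ₚ p +ₚ p ≋ []
  -ₚ-inverseˡ p = coeffwise λ n →
    trans (coeff-+ (-ₚ p) p n) (trans (+-congʳ (coeff-neg p n)) (-‿inverseˡ _))

  ·-cong : ∀ {a b p q} → a ≈ b → p ≋ q → a · p ≋ b · q
  ·-cong {a} {b} {p} {q} a≈b p≋q = coeffwise λ n →
    trans (coeff-· a p n) (trans (*-cong a≈b (at p≋q n)) (sym (coeff-· b q n)))

  ·-zeroˡ : ∀ {a} → a ≈ 0# → ∀ p → a · p ≋ []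
  ·-zeroˡ {a} a≈0 p = coeffwise λ n → trans (coeff-· a p n) (trans (*-congʳ a≈0) (zeroˡ _))

  ·-distribˡ : ∀ a p q → a · (p +ₚ q) ≋ a · p +ₚ a · q
  ·-distribˡ a p q = coeffwise λ n → begin
    coeff (a · (p +ₚ q)) n              ≈⟨ coeff-· a (p +ₚ q) n ⟩
    a * coeff (p +ₚ q) n                ≈⟨ *-congˡ (coeff-+ p q n) ⟩
    a * (coeff p n + coeff q n)         ≈⟨ distribˡ _ _ _ ⟩
    a * coeff p n + a * coeff q n       ≈⟨ +-cong (coeff-· a p n) (coeff-· a q n) ⟨
    coeff (a · p) n + coeff (a · q) n   ≈⟨ coeff-+ (a · p) (a · q) n ⟨
    coeff (a · p +ₚ a · q) n            ∎

  ·-distribʳ : ∀ a b p → (a + b) · p ≋ a · p +ₚ b · p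
  ·-distribʳ a b p = coeffwise λ n → begin
    coeff ((a + b) · p) n               ≈⟨ coeff-· (a + b) p n ⟩
    (a + b) * coeff p n                 ≈⟨ distribʳ _ _ _ ⟩
    a * coeff p n + b * coeff p n       ≈⟨ +-cong (coeff-· a p n) (coeff-· b p n) ⟨
    coeff (a · p) n + coeff (b · p) n   ≈⟨ coeff-+ (a · p) (b · p) n ⟨
    coeff (a · p +ₚ b · p) n            ∎

  ·-assoc : ∀ a b p → (a * b) · p ≋ a · (b · p)
  ·-assoc a b p = coeffwise λ n → begin
    coeff ((a * b) · p) n  ≈⟨ coeff-· (a * b) p n ⟩
    a * b * coeff p n      ≈⟨ *-assoc _ _ _ ⟩
    a * (b * coeff p n)    ≈⟨ *-congˡ (coeff-· b p n) ⟨
    a * coeff (b · p) n    ≈⟨ coeff-· a (b · p) n ⟨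
    coeff (a · (b · p)) n  ∎

  ·-identity : ∀ p → 1# · p ≋ p
  ·-identity p = coeffwise λ n → trans (coeff-· 1# p n) (*-identityˡ _)

  +ₚ-exchange : ∀ p q r s → (p +ₚ q) +ₚ (r +ₚ s) ≋ (p +ₚ r) +ₚ (q +ₚ s)
  +ₚ-exchange p q r s = coeffwise λ n → begin
    coeff ((p +ₚ q) +ₚ (r +ₚ s)) n                          ≈⟨ expand p q r s n ⟩
    (coeff p n + coeff q n) + (coeff r n + coeff s n)       ≈⟨ solve 4 (λ a b c d →
      (a :+ b) :+ (c :+ d) := (a :+ c) :+ (b :+ d)) refl _ _ _ _ ⟩
    (coeff p n + coeff r n) + (coeff q n + coeff s n)       ≈⟨ expand p r q s n ⟨
    coeff ((p +ₚ r) +ₚ (q +ₚ s)) n                          ∎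
    where
    expand : ∀ p q r s n → coeff ((p +ₚ q) +ₚ (r +ₚ s)) n ≈
                           (coeff p n + coeff q n) + (coeff r n + coeff s n)
    expand p q r s n =
      trans (coeff-+ (p +ₚ q) (r +ₚ s) n) (+-cong (coeff-+ p q n) (coeff-+ r s n))

  0∷-+ : ∀ p q → 0# ∷ (p +ₚ q) ≋ (0# ∷ p) +ₚ (0# ∷ q)
  0∷-+ p q = sym (+-identityˡ 0#) ∷-cong ≋-refl

  *ₚ-zeroʳ : ∀ p → p *ₚ [] ≋ []
  *ₚ-zeroʳ []      = ≋-refl
  *ₚ-zeroʳ (a ∷ p) = 0∷[] (*ₚ-zeroʳ p)

  *ₚ-zeroˡ : ∀ p q → p ≋ [] → p *ₚ q ≋ []
  *ₚ-zeroˡ []      q _    = ≋-refl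
  *ₚ-zeroˡ (a ∷ p) q p≋[] =
    ≋-trans (+ₚ-cong (·-zeroˡ (at p≋[] 0) q) (0∷[] (*ₚ-zeroˡ p q (tail-≋[] p≋[])))) ≋-refl

  *ₚ-congˡ : ∀ p {q q′} → q ≋ q′ → p *ₚ q ≋ p *ₚ q′
  *ₚ-congˡ []      q≋q′ = ≋-refl
  *ₚ-congˡ (a ∷ p) q≋q′ = +ₚ-cong (·-cong refl q≋q′) (refl ∷-cong *ₚ-congˡ p q≋q′)

  *ₚ-congʳ : ∀ p p′ q → p ≋ p′ → p *ₚ q ≋ p′ *ₚ q
  *ₚ-congʳ []      p′       q eq = ≋-sym (*ₚ-zeroˡ p′ q (≋-sym eq))
  *ₚ-congʳ (a ∷ p) []       q eq = *ₚ-zeroˡ (a ∷ p) q eq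
  *ₚ-congʳ (a ∷ p) (b ∷ p′) q eq =
    +ₚ-cong (·-cong (at eq 0) ≋-refl) (refl ∷-cong *ₚ-congʳ p p′ q (tail-≋ eq))

  *ₚ-cong : ∀ {p p′ q q′} → p ≋ p′ → q ≋ q′ → p *ₚ q ≋ p′ *ₚ q′
  *ₚ-cong {p} {p′} {q} p≋p′ q≋q′ = ≋-trans (*ₚ-congʳ p p′ q p≋p′) (*ₚ-congˡ p′ q≋q′)

  *ₚ-distribʳ : ∀ r p q → (p +ₚ q) *ₚ r ≋ p *ₚ r +ₚ q *ₚ r
  *ₚ-distribʳ r []      q       = ≋-refl
  *ₚ-distribʳ r (a ∷ p) []      = ≋-sym (+ₚ-identityʳ _)
  *ₚ-distribʳ r (a ∷ p) (b ∷ q) = ≋-trans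
    (+ₚ-cong (·-distribʳ a b r)
      (≋-trans (refl ∷-cong *ₚ-distribʳ r p q) (0∷-+ (p *ₚ r) (q *ₚ r))))
    (+ₚ-exchange (a · r) (b · r) (0# ∷ p *ₚ r) (0# ∷ q *ₚ r))

  *ₚ-distribˡ : ∀ p q r → p *ₚ (q +ₚ r) ≋ p *ₚ q +ₚ p *ₚ r
  *ₚ-distribˡ []      q r = ≋-refl
  *ₚ-distribˡ (a ∷ p) q r = ≋-trans
    (+ₚ-cong (·-distribˡ a q r)
      (≋-trans (refl ∷-cong *ₚ-distribˡ p q r) (0∷-+ (p *ₚ q) (p *ₚ r))))
    (+ₚ-exchange (a · q) (a · r) (0# ∷ p *ₚ q) (0# ∷ p *ₚ r))

  *ₚ-∷ : ∀ p b q → p *ₚ (b ∷ q) ≋ b · p +ₚ (0# ∷ p *ₚ q)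
  *ₚ-∷ []      b q = ≋-sym (0∷[] ≋-refl)
  *ₚ-∷ (a ∷ p) b q = +-congʳ (*-comm a b) ∷-cong ≋-trans
    (+ₚ-cong {a · q} ≋-refl (*ₚ-∷ p b q))
    (≋-trans (≋-sym (+ₚ-assoc (a · q) (b · p) _))
      (≋-trans (+ₚ-cong (+ₚ-comm (a · q) (b · p)) ≋-refl) (+ₚ-assoc (b · p) (a · q) _)))

  *ₚ-comm : ∀ p q → p *ₚ q ≋ q *ₚ p
  *ₚ-comm []      q = ≋-sym (*ₚ-zeroʳ q)
  *ₚ-comm (a ∷ p) q =
    ≋-trans (+ₚ-cong {a · q} ≋-refl (refl ∷-cong *ₚ-comm p q)) (≋-sym (*ₚ-∷ q a p))

  ·-*ₚ : ∀ a q r → (a · q) *ₚ r ≋ a · (q *ₚ r)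
  ·-*ₚ a []      r = ≋-refl
  ·-*ₚ a (b ∷ q) r = ≋-trans
    (+ₚ-cong (·-assoc a b r) (sym (zeroʳ a) ∷-cong ·-*ₚ a q r))
    (≋-sym (·-distribˡ a (b · r) (0# ∷ q *ₚ r)))

  0∷-*ₚ : ∀ q r → (0# ∷ q) *ₚ r ≋ 0# ∷ q *ₚ r
  0∷-*ₚ q r = +ₚ-cong (·-zeroˡ refl r) ≋-refl

  *ₚ-assoc : ∀ p q r → (p *ₚ q) *ₚ r ≋ p *ₚ (q *ₚ r)
  *ₚ-assoc []      q r = ≋-refl
  *ₚ-assoc (a ∷ p) q r = ≋-trans (*ₚ-distribʳ r (a · q) (0# ∷ p *ₚ q))
    (+ₚ-cong (·-*ₚ a q r) (≋-trans (0∷-*ₚ (p *ₚ q) r) (refl ∷-cong *ₚ-assoc p q r)))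

  *ₚ-identityˡ : ∀ p → 1ₚ *ₚ p ≋ p
  *ₚ-identityˡ p =
    ≋-trans (+ₚ-cong (·-identity p) (0∷[] ≋-refl)) (+ₚ-identityʳ p)

  polynomialRing : CommutativeRing ℓ ℓ
  polynomialRing = record
    { Carrier = Poly ; _≈_ = _≋_ ; _+_ = _+ₚ_ ; _*_ = _*ₚ_ ; -_ = -ₚ_ ; 0# = [] ; 1# = 1ₚ
    ; isCommutativeRing = record
      { isRing = record
        { +-isAbelianGroup = record
          { isGroup = record
            { isMonoid = record
              { isSemigroup = record
                { isMagma = record
                  { isEquivalence = record { refl = ≋-refl ; sym = ≋-sym ; trans = ≋-trans }
                  ; ∙-cong = +ₚ-cong
                  }
                ; assoc = +ₚ-assoc
                }
              ; identity = (λ _ → ≋-refl) , +ₚ-identityʳ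
              }
            ; inverse = -ₚ-inverseˡ , λ p → ≋-trans (+ₚ-comm p (-ₚ p)) (-ₚ-inverseˡ p)
            ; ⁻¹-cong = -ₚ-cong
            }
          ; comm = +ₚ-comm
          }
        ; *-cong = *ₚ-cong
        ; *-assoc = *ₚ-assoc
        ; *-identity = *ₚ-identityˡ , λ p → ≋-trans (*ₚ-comm p 1ₚ) (*ₚ-identityˡ p)
        ; distrib = *ₚ-distribˡ , *ₚ-distribʳ
        }
      ; *-comm = *ₚ-comm
      }
    }

  *ₚ-exchange : ∀ p q r → p *ₚ (q *ₚ r) ≋ q *ₚ (p *ₚ r)
  *ₚ-exchange = x∙yz≈y∙xz
    where open Algebra.Properties.CommutativeSemigroup
            (CommutativeRing.*-commutativeSemigroup polynomialRing) using (x∙yz≈y∙xz)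

  eval-≋[] : ∀ p x → p ≋ [] → eval p x ≈ 0#
  eval-≋[] []      x eq = refl
  eval-≋[] (a ∷ p) x eq = begin
    a + x * eval p x  ≈⟨ +-cong (at eq 0) (*-congˡ (eval-≋[] p x (tail-≋[] eq))) ⟩
    0# + x * 0#       ≈⟨ solve 1 (λ x → con (+ 0) :+ x :* con (+ 0) := con (+ 0)) refl x ⟩
    0#                ∎

  eval-cong : ∀ p q {x y} → p ≋ q → x ≈ y → eval p x ≈ eval q y
  eval-cong []      q       eq x≈y = sym (eval-≋[] q _ (≋-sym eq))
  eval-cong (a ∷ p) []      eq x≈y = eval-≋[] (a ∷ p) _ eq
  eval-cong (a ∷ p) (b ∷ q) eq x≈y =
    +-cong (at eq 0) (*-cong x≈y (eval-cong p q (tail-≋ eq) x≈y))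

  eval-+ : ∀ p q x → eval (p +ₚ q) x ≈ eval p x + eval q x
  eval-+ []      q       x = sym (+-identityˡ _)
  eval-+ (a ∷ p) []      x = sym (+-identityʳ _)
  eval-+ (a ∷ p) (b ∷ q) x = trans (+-congˡ (*-congˡ (eval-+ p q x)))
    (solve 5 (λ a b x u v → (a :+ b) :+ x :* (u :+ v) := (a :+ x :* u) :+ (b :+ x :* v))
      refl a b x _ _)

  eval-· : ∀ a p x → eval (a · p) x ≈ a * eval p x
  eval-· a []      x = sym (zeroʳ a)
  eval-· a (b ∷ p) x = trans (+-congˡ (*-congˡ (eval-· a p x)))
    (solve 4 (λ a b x u → a :* b :+ x :* (a :* u) := a :* (b :+ x :* u)) refl a b x _)

  eval-neg : ∀ p x → eval (-ₚ p) x ≈ - eval p x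
  eval-neg []      x = solve 0 (con (+ 0) := :- con (+ 0)) refl
  eval-neg (a ∷ p) x = trans (+-congˡ (*-congˡ (eval-neg p x)))
    (solve 3 (λ a x u → :- a :+ x :* (:- u) := :- (a :+ x :* u)) refl a x _)

  eval-* : ∀ p q x → eval (p *ₚ q) x ≈ eval p x * eval q x
  eval-* []      q x = sym (zeroˡ _)
  eval-* (a ∷ p) q x = begin
    eval (a · q +ₚ (0# ∷ p *ₚ q)) x             ≈⟨ eval-+ (a · q) (0# ∷ p *ₚ q) x ⟩
    eval (a · q) x + (0# + x * eval (p *ₚ q) x) ≈⟨ +-cong (eval-· a q x) (+-congˡ (*-congˡ (eval-* p q x))) ⟩
    a * eval q x + (0# + x * (eval p x * eval q x)) ≈⟨ solve 4 (λ a x u v →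
      a :* v :+ (con (+ 0) :+ x :* (u :* v)) := (a :+ x :* u) :* v) refl a x _ _ ⟩
    (a + x * eval p x) * eval q x               ∎

  eval-const : ∀ c x → eval (c ∷ []) x ≈ c
  eval-const c x = trans (+-congˡ (zeroʳ x)) (+-identityʳ c)

  eval-t- : ∀ r x → eval (t- r) x ≈ x - r
  eval-t- r x = trans (+-congˡ (*-congˡ (eval-const 1# x)))
    (solve 2 (λ r x → :- r :+ x :* con (+ 1) := x :- r) refl r x)

  -- Opaque, so that products with a linear factor do not unfold.
  opaque
    linear : Carrier → Poly
    linear r = t- r

    linear≡t- : ∀ r → linear r ≡ t- r
    linear≡t- r = ≡.refl

    eval-linear : ∀ r x → eval (linear r) x ≈ x - r
    eval-linear = eval-t-

    linear≋̸[] : ¬ (1# ≈ 0#) → ∀ r → ¬ (linear r ≋ [])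
    linear≋̸[] 1≉0 r eq = 1≉0 (at eq 1)

  -- A strict bound on the degree that also covers the zero polynomial, which has no `Degree`.
  Below : Poly → ℕ → Set ℓ
  Below p n = ∀ k → n ≤ k → coeff p k ≈ 0#

  Below-resp : ∀ {p q n} → p ≋ q → Below p n → Below q n
  Below-resp p≋q p<n k n≤k = trans (sym (at p≋q k)) (p<n k n≤k)

  Below-+ : ∀ {n} p q → Below p n → Below q n → Below (p +ₚ q) n
  Below-+ p q p<n q<n k n≤k =
    trans (coeff-+ p q k) (trans (+-cong (p<n k n≤k) (q<n k n≤k)) (+-identityˡ 0#))

  Below-neg : ∀ {n} p → Below p n → Below (-ₚ p) n
  Below-neg p p<n k n≤k = trans (coeff-neg p k)
    (trans (-‿cong (p<n k n≤k)) (solve 0 (:- con (+ 0) := con (+ 0)) refl))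

  Below-· : ∀ {n} a p → Below p n → Below (a · p) n
  Below-· a p p<n k n≤k = trans (coeff-· a p k) (trans (*-congˡ (p<n k n≤k)) (zeroʳ a))

  Below-∷ : ∀ {n a p} → Below p n → Below (a ∷ p) (suc n)
  Below-∷ p<n (suc k) (s≤s n≤k) = p<n k n≤k

  Below-tail : ∀ {n a p} → Below (a ∷ p) (suc n) → Below p n
  Below-tail p<n k n≤k = p<n (suc k) (s≤s n≤k)

  Below-0 : ∀ {p} → Below p 0 → p ≋ []
  Below-0 p<0 = coeffwise λ n → p<0 n z≤n

  Below-weaken : ∀ {p m n} → m ≤ n → Below p m → Below p n
  Below-weaken m≤n p<m k n≤k = p<m k (ℕ.≤-trans m≤n n≤k)

  -- The asymmetric form (degree at most m times degree less than n) serves two purposes: with a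
  -- successor for n it bounds a product of polynomials with known leading terms, and as it stands
  -- it shows that one factor of small degree keeps a product below the sum of the degrees.
  Below-* : ∀ p q m n → Below p (suc m) → Below q n → Below (p *ₚ q) (m ℕ.+ n)
  Below-* []      q m       n p< q< k _  = refl
  Below-* (a ∷ p) q zero    n p< q< = Below-resp
    (≋-sym (≋-trans (+ₚ-cong {a · q} ≋-refl
      (0∷[] (*ₚ-zeroˡ p q (Below-0 (Below-tail {a = a} p<))))) (+ₚ-identityʳ _)))
    (Below-· a q q<)
  Below-* (a ∷ p) q (suc m) n p< q< = Below-+ (a · q) (0# ∷ p *ₚ q)
    (Below-· a q (Below-weaken {q} (ℕ.m≤n+m n (suc m)) q<))
    (Below-∷ {a = 0#} {p *ₚ q} (Below-* p q m n (Below-tail {a = a} p<) q<))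

  coeff-*-top : ∀ p q m n → Below p (suc m) → Below q (suc n) →
                coeff (p *ₚ q) (m ℕ.+ n) ≈ coeff p m * coeff q n
  coeff-*-top []      q m       n p< q< = sym (zeroˡ _)
  coeff-*-top (a ∷ p) q zero    n p< q< = begin
    coeff (a · q +ₚ (0# ∷ p *ₚ q)) n  ≈⟨ at (≋-trans (+ₚ-cong {a · q} ≋-refl
      (0∷[] (*ₚ-zeroˡ p q (Below-0 (Below-tail {a = a} p<))))) (+ₚ-identityʳ _)) n ⟩
    coeff (a · q) n                   ≈⟨ coeff-· a q n ⟩
    a * coeff q n                     ∎
  coeff-*-top (a ∷ p) q (suc m) n p< q< = begin
    coeff (a · q +ₚ (0# ∷ p *ₚ q)) (suc (m ℕ.+ n))           ≈⟨ coeff-+ (a · q) (0# ∷ p *ₚ q) (suc (m ℕ.+ n)) ⟩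
    coeff (a · q) (suc (m ℕ.+ n)) + coeff (p *ₚ q) (m ℕ.+ n) ≈⟨ +-cong
      (Below-· a q q< (suc (m ℕ.+ n)) (s≤s (ℕ.m≤n+m n m)))
      (coeff-*-top p q m n (Below-tail {a = a} p<) q<) ⟩
    0# + coeff p m * coeff q n                               ≈⟨ +-identityˡ _ ⟩
    coeff p m * coeff q n                                    ∎

  record Degree (p : Poly) (n : ℕ) : Set ℓ where
    constructor degree
    field
      top   : ¬ (coeff p n ≈ 0#)
      below : Below p (suc n)

  degree-resp : ∀ {p q n} → p ≋ q → Degree p n → Degree q n
  degree-resp {p} p≋q (degree top below) =
    degree (λ eq → top (trans (at p≋q _) eq)) (Below-resp {p} p≋q below)

  degree-unique : ∀ {p m n} → Degree p m → Degree p n → m ≡ n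
  degree-unique (degree topₘ belowₘ) (degree topₙ belowₙ) = ℕ.≤-antisym
    (ℕ.≮⇒≥ λ n<m → topₘ (belowₙ _ n<m)) (ℕ.≮⇒≥ λ m<n → topₙ (belowₘ _ m<n))

  -- Synthetic division: the intermediate values of Horner's scheme are the coefficients of the
  -- quotient by t - x.
  quotient : Carrier → Poly → Poly
  quotient x []      = []
  quotient x (a ∷ p) = eval p x ∷ quotient x p

  -- From p = p(x) + (t - x) Q one gets a + t p = (a + x p(x)) + (t - x) (p(x) + t Q).
  opaque
    unfolding linear
    eval-quotient : ∀ x p → p ≋ (eval p x ∷ []) +ₚ linear x *ₚ quotient x p
    eval-quotient x []      = coeffwise λ
      { zero          → solve 0 (con (+ 0) := con (+ 0) :+ con (+ 0)) refl
      ; (suc zero)    → refl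
      ; (suc (suc n)) → refl
      }
    eval-quotient x (a ∷ p) = ≋-trans
      (solve 3 (λ a x e → a := (a :+ x :* e) :+ (e :* (:- x) :+ con (+ 0))) refl a x (eval p x)
        ∷-cong ≋-trans (eval-quotient x p)
          (+ₚ-cong {eval p x ∷ []} {eval p x * 1# ∷ []} {t- x *ₚ quotient x p}
            (sym (*-identityʳ _) ∷-cong ≋-refl) ≋-refl))
      (+ₚ-cong {eval (a ∷ p) x ∷ []} ≋-refl (≋-sym (*ₚ-∷ (t- x) (eval p x) (quotient x p))))

  record Root (p : Poly) (x : Carrier) : Set ℓ where
    constructor root
    field
      vanishes : eval p x ≈ 0#
  open Root public

  root-resp : ∀ {p q x} → p ≋ q → Root p x → Root q x
  root-resp {p} {q} p≋q (root eq) = root (trans (eval-cong q p (≋-sym p≋q) refl) eq)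

  root-≈ : ∀ {p x y} → x ≈ y → Root p x → Root p y
  root-≈ {p} x≈y (root eq) = root (trans (eval-cong p p ≋-refl (sym x≈y)) eq)

  root⇒linear-∣ : ∀ {p x} → Root p x → p ≋ linear x *ₚ quotient x p
  root⇒linear-∣ {p} {x} (root px≈0) = ≋-trans (eval-quotient x p)
    (+ₚ-cong {eval p x ∷ []} {[]} {linear x *ₚ quotient x p}
      (coeffwise λ { zero → px≈0 ; (suc n) → refl }) ≋-refl)

  eval-^ : ∀ p n x → eval (p ^ₚ n) x ≈ eval p x ^ n
  eval-^ p zero    x = eval-const 1# x
  eval-^ p (suc n) x = trans (eval-* p (p ^ₚ n) x) (*-congˡ (eval-^ p n x))

  HasLeading : Poly → ℕ → Carrier → Set ℓ
  HasLeading p n c = coeff p n ≈ c × Below p (suc n)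

  opaque
    unfolding linear

    leading-linear : ∀ r → HasLeading (linear r) 1 1#
    leading-linear r = refl , λ { (suc (suc k)) _ → refl ; (suc zero) (s≤s ()) }

  leading-* : ∀ p q m n → HasLeading p m 1# → HasLeading q n 1# → HasLeading (p *ₚ q) (m ℕ.+ n) 1#
  leading-* p q m n (p≈1 , p<) (q≈1 , q<) =
    trans (coeff-*-top p q m n p< q<) (trans (*-cong p≈1 q≈1) (*-identityˡ 1#)) ,
    ≡.subst (Below (p *ₚ q)) (ℕ.+-suc m n) (Below-* p q m (suc n) p< q<)

  leading-1 : HasLeading 1ₚ 0 1#
  leading-1 = refl , λ { (suc k) _ → refl }

  leading-linear-^ : ∀ r n → HasLeading (linear r ^ₚ n) n 1#
  leading-linear-^ r zero    = leading-1
  leading-linear-^ r (suc n) =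
    leading-* (linear r) (linear r ^ₚ n) 1 n (leading-linear r) (leading-linear-^ r n)

  ∏linear : List Carrier → Poly
  ∏linear rs = ∏ₚ (map linear rs)

  ∏linear≡∏t- : ∀ rs → ∏linear rs ≡ ∏ₚ (map t-_ rs)
  ∏linear≡∏t- rs = ≡.cong ∏ₚ (map-cong linear≡t- rs)

  leading-∏linear : ∀ rs → HasLeading (∏linear rs) (length rs) 1#
  leading-∏linear []       = leading-1
  leading-∏linear (r ∷ rs) =
    leading-* (linear r) (∏linear rs) 1 (length rs) (leading-linear r) (leading-∏linear rs)

  leading-Below : ∀ p q n → HasLeading p n 1# → Below q n → HasLeading (p +ₚ -ₚ q) n 1#
  leading-Below p q n (p≈1 , p<) q< =
    trans (coeff-+ p (-ₚ q) n)
      (trans (+-cong p≈1 (Below-neg q q< n ℕ.≤-refl)) (+-identityʳ 1#)) ,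
    Below-+ p (-ₚ q) p< (Below-neg q (Below-weaken {q} (ℕ.n≤1+n n) q<))

  ≋[]-difference : ∀ p q → p +ₚ -ₚ q ≋ [] → ∀ n → coeff p n ≈ coeff q n
  ≋[]-difference p q eq n = x∙y⁻¹≈ε⇒x≈y _ _
    (trans (+-congˡ (sym (coeff-neg q n))) (trans (sym (coeff-+ p (-ₚ q) n)) (at eq n)))
    where open Algebra.Properties.Ring ring using (x∙y⁻¹≈ε⇒x≈y)

  leading-difference : ∀ p q n → HasLeading p n 1# → HasLeading q n 1# → Below (p +ₚ -ₚ q) n
  leading-difference p q n (p≈1 , p<) (q≈1 , q<) k n≤k with ℕ.m≤n⇒m<n∨m≡n n≤k
  ... | inj₁ n<k    = Below-+ p (-ₚ q) p< (Below-neg q q<) k n<k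
  ... | inj₂ ≡.refl = begin
    coeff (p +ₚ -ₚ q) n      ≈⟨ coeff-+ p (-ₚ q) n ⟩
    coeff p n + coeff (-ₚ q) n ≈⟨ +-cong p≈1 (trans (coeff-neg q n) (-‿cong q≈1)) ⟩
    1# - 1#                  ≈⟨ -‿inverseʳ 1# ⟩
    0#                       ∎

-- Polynomials over a domain: degrees, roots and double roots

module DomainPolynomials (em : ExcludedMiddle ℓ) (R : CommutativeRing ℓ ℓ)
                         (domain : IsDomain (CommutativeRing.rawRing R)) where
  open CommutativeRing R hiding (zero)
  open PolynomialRing R public
  module R[t] = CommutativeRing polynomialRing
  open Algebra.Properties.Ring ring using (x∙y⁻¹≈ε⇒x≈y; x≈y⇒x∙y⁻¹≈ε)
  private
    module R[t]-ring = Algebra.Properties.Ring R[t].ring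
  open Relation.Binary.Reasoning.Setoid setoid

  1≉0 : ¬ (1# ≈ 0#)
  1≉0 = proj₁ domain

  zero-product : ∀ {x y} → x * y ≈ 0# → x ≈ 0# ⊎ y ≈ 0#
  zero-product = proj₂ domain _ _

  x-y≈0⇒x≈y : ∀ {x y} → x - y ≈ 0# → x ≈ y
  x-y≈0⇒x≈y = x∙y⁻¹≈ε⇒x≈y _ _

  x≈y⇒x-y≈0 : ∀ {x y} → x ≈ y → x - y ≈ 0#
  x≈y⇒x-y≈0 = x≈y⇒x∙y⁻¹≈ε

  x^n≈0⇒x≈0 : ∀ {x} n → x ^ n ≈ 0# → x ≈ 0#
  x^n≈0⇒x≈0 zero    eq = ⊥-elim (1≉0 eq)
  x^n≈0⇒x≈0 (suc n) eq with zero-product eq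
  ... | inj₁ x≈0  = x≈0
  ... | inj₂ eq′ = x^n≈0⇒x≈0 n eq′

  degree-* : ∀ {p q m n} → Degree p m → Degree q n → Degree (p *ₚ q) (m ℕ.+ n)
  degree-* {p} {q} {m} {n} (degree p≉0 p<) (degree q≉0 q<) = degree
    (λ eq → nonzero (zero-product (trans (sym (coeff-*-top p q m n p< q<)) eq)))
    (≡.subst (Below (p *ₚ q)) (ℕ.+-suc m n) (Below-* p q m (suc n) p< q<))
    where
    nonzero : ¬ (coeff p m ≈ 0# ⊎ coeff q n ≈ 0#)
    nonzero (inj₁ eq) = p≉0 eq
    nonzero (inj₂ eq) = q≉0 eq

  degree? : ∀ p → p ≋ [] ⊎ ∃ (Degree p)
  degree? []      = inj₁ ≋-refl
  degree? (a ∷ p) with degree? p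
  ... | inj₂ (n , degree p≉0 p<) = inj₂ (suc n , degree p≉0 (Below-∷ {a = a} {p} p<))
  ... | inj₁ p≋[] with em {P = a ≈ 0#}
  ...   | yes a≈0 = inj₁ (≋-trans (a≈0 ∷-cong p≋[]) (0∷[] ≋-refl))
  ...   | no  a≉0 = inj₂ (0 , degree a≉0 λ { (suc k) _ → at p≋[] k })

  degree⇒≋̸[] : ∀ {p n} → Degree p n → ¬ (p ≋ [])
  degree⇒≋̸[] (degree p≉0 _) p≋[] = p≉0 (at p≋[] _)

  leading⇒degree : ∀ {p n} → HasLeading p n 1# → Degree p n
  leading⇒degree (p≈1 , p<) = degree (λ eq → 1≉0 (trans (sym p≈1) eq)) p<

  degree-1 : Degree 1ₚ 0
  degree-1 = leading⇒degree leading-1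

  degree-linear : ∀ x → Degree (linear x) 1
  degree-linear x = leading⇒degree (leading-linear x)

  linear≢0 : ∀ x → ¬ (linear x ≋ [])
  linear≢0 = linear≋̸[] 1≉0

  degree-factors : ∀ {p q n} → Degree (p *ₚ q) n →
                   ∃[ k ] ∃[ l ] Degree p k × Degree q l × k ℕ.+ l ≡ n
  degree-factors {p} {q} pq° with degree? p | degree? q
  ... | inj₁ p≋[] | _ = ⊥-elim (degree⇒≋̸[] pq° (*ₚ-zeroˡ p q p≋[]))
  ... | inj₂ _ | inj₁ q≋[] = ⊥-elim (degree⇒≋̸[] pq° (≋-trans (*ₚ-comm p q) (*ₚ-zeroˡ q p q≋[])))
  ... | inj₂ (k , p°) | inj₂ (l , q°) = k , l , p° , q° , degree-unique (degree-* p° q°) pq°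

  degree-linear-cofactor : ∀ {x q n} → Degree (linear x *ₚ q) n → ∃[ l ] Degree q l × suc l ≡ n
  degree-linear-cofactor {x} {q} xq° with degree-factors {linear x} {q} xq°
  ... | k , l , x° , q° , k+l≡n with ≡.refl ← degree-unique x° (degree-linear x) = l , q° , k+l≡n

  isDomain[t] : IsDomain R[t].rawRing
  isDomain[t] = (λ eq → 1≉0 (at eq 0)) , zero-productₚ
    where
    zero-productₚ : ∀ p q → p *ₚ q ≋ [] → p ≋ [] ⊎ q ≋ []
    zero-productₚ p q pq≋[] with degree? p | degree? q
    ... | inj₁ p≋[] | _ = inj₁ p≋[]
    ... | inj₂ _ | inj₁ q≋[] = inj₂ q≋[]
    ... | inj₂ (_ , p°) | inj₂ (_ , q°) = ⊥-elim (degree⇒≋̸[] (degree-* p° q°) pq≋[])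

  *ₚ-cancelˡ : ∀ p {q r} → ¬ (p ≋ []) → p *ₚ q ≋ p *ₚ r → q ≋ r
  *ₚ-cancelˡ p {q} {r} p≋̸[] eq = cancel (proj₂ isDomain[t] p (q +ₚ -ₚ r)
    (≋-trans (R[t]-ring.x[y-z]≈xy-xz p q r) (R[t]-ring.x≈y⇒x∙y⁻¹≈ε eq)))
    where
    cancel : p ≋ [] ⊎ q +ₚ -ₚ r ≋ [] → q ≋ r
    cancel (inj₁ p≋[])   = ⊥-elim (p≋̸[] p≋[])
    cancel (inj₂ q-r≋[]) = R[t]-ring.x∙y⁻¹≈ε⇒x≈y q r q-r≋[]

  *ₚ-cancel-linear : ∀ x {q r} → linear x *ₚ q ≋ linear x *ₚ r → q ≋ r
  *ₚ-cancel-linear x = *ₚ-cancelˡ (linear x) (linear≢0 x)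

  root-*ˡ : ∀ p {q x} → Root q x → Root (p *ₚ q) x
  root-*ˡ p {q} {x} (root qx≈0) = root (trans (eval-* p q x) (trans (*-congˡ qx≈0) (zeroʳ _)))

  root-*ʳ : ∀ {p} q {x} → Root p x → Root (p *ₚ q) x
  root-*ʳ {p} q {x} (root px≈0) = root (trans (eval-* p q x) (trans (*-congʳ px≈0) (zeroˡ _)))

  root-* : ∀ p q {x} → Root (p *ₚ q) x → Root p x ⊎ Root q x
  root-* p q {x} (root eq) with zero-product (trans (sym (eval-* p q x)) eq)
  ... | inj₁ px≈0 = inj₁ (root px≈0)
  ... | inj₂ qx≈0 = inj₂ (root qx≈0)

  root-linear⁻ : ∀ {r x} → Root (linear r) x → x ≈ r
  root-linear⁻ {r} {x} (root eq) = x-y≈0⇒x≈y (trans (sym (eval-linear r x)) eq)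

  root-linear : ∀ {r x} → x ≈ r → Root (linear r) x
  root-linear {r} {x} x≈r = root (trans (eval-linear r x) (x≈y⇒x-y≈0 x≈r))

  ¬root-1 : ∀ {x} → ¬ Root 1ₚ x
  ¬root-1 {x} (root eq) = 1≉0 (trans (sym (eval-const 1# x)) eq)

  -- Divide by the linear factor of the first root. In a domain every other root, being different
  -- from it, must be a root of the quotient.
  roots≤degree : ∀ {k n p} → Degree p n → (ρ : Fin k → Carrier) →
                 (∀ {i j} → ρ i ≈ ρ j → i ≡ j) → (∀ i → Root p (ρ i)) → k ≤ n
  roots≤degree {zero}  p° ρ inj roots = z≤n
  roots≤degree {suc k} {n} {p} p° ρ inj roots
    with degree-linear-cofactor {ρ zero} {quotient (ρ zero) p}
           (degree-resp (root⇒linear-∣ (roots zero)) p°)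
  ... | l , q° , ≡.refl =
    s≤s (roots≤degree q° (λ i → ρ (suc i)) (λ eq → Fin.suc-injective (inj eq)) quotient-root)
    where
    quotient-root : ∀ i → Root (quotient (ρ zero) p) (ρ (suc i))
    quotient-root i with root-* (linear (ρ zero)) (quotient (ρ zero) p)
                           (root-resp (root⇒linear-∣ (roots zero)) (roots (suc i)))
    ... | inj₂ q-root = q-root
    ... | inj₁ l-root with () ← inj (root-linear⁻ l-root)

  roots-Below⇒≋[] : ∀ {k p} → Below p k → (ρ : Fin k → Carrier) →
                    (∀ {i j} → ρ i ≈ ρ j → i ≡ j) → (∀ i → Root p (ρ i)) → p ≋ []
  roots-Below⇒≋[] {p = p} p<k ρ inj roots with degree? p
  ... | inj₁ p≋[] = p≋[]
  ... | inj₂ (n , p°@(degree p≉0 _)) = ⊥-elim (p≉0 (p<k n (roots≤degree p° ρ inj roots)))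

  ∏-root : ∀ ps {x} → Any (λ p → Root p x) ps → Root (∏ₚ ps) x
  ∏-root (p ∷ ps) (here px≈0) = root-*ʳ {p} (∏ₚ ps) px≈0
  ∏-root (p ∷ ps) (there any) = root-*ˡ p (∏-root ps any)

  root-∏ : ∀ ps {x} → Root (∏ₚ ps) x → Any (λ p → Root p x) ps
  root-∏ []       eq = ⊥-elim (¬root-1 eq)
  root-∏ (p ∷ ps) eq with root-* p (∏ₚ ps) eq
  ... | inj₁ px≈0 = here px≈0
  ... | inj₂ eq′  = there (root-∏ ps eq′)

  root-∏linear : ∀ rs {x} → Root (∏linear rs) x → Any (x ≈_) rs
  root-∏linear rs eq = Any.map root-linear⁻ (Anyₚ.map⁻ (root-∏ (map linear rs) eq))

  ∏linear-root : ∀ rs {x} → Any (x ≈_) rs → Root (∏linear rs) x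
  ∏linear-root rs x∈rs = ∏-root (map linear rs) (Anyₚ.map⁺ (Any.map root-linear x∈rs))

  -- Each `r` of the list is a root of `g` or of `h`. In the second case t - r is cancelled from `h`
  -- and the list shortens. It cannot run out, because a factor of 1 has degree 0.
  ∏linear-factor-root : ∀ rs g h {d} → Degree g (suc d) → ∏linear rs ≋ g *ₚ h → ∃ (Root g)
  ∏linear-factor-root [] g h g° eq with degree-factors {g} {h} (degree-resp eq degree-1)
  ... | k , l , g°′ , _ , k+l≡0 with ≡.refl ← degree-unique g° g°′ with () ← k+l≡0
  ∏linear-factor-root (r ∷ rs) g h g° eq
    with root-* g h (root-resp eq (∏linear-root (r ∷ rs) (here refl)))
  ... | inj₁ gr≈0 = r , gr≈0
  ... | inj₂ hr≈0 = ∏linear-factor-root rs g (quotient r h) g°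
    (*ₚ-cancel-linear r (≋-trans eq (≋-trans (*ₚ-congˡ g (root⇒linear-∣ hr≈0))
      (*ₚ-exchange g (linear r) (quotient r h)))))

  -- Multiplicity is expressed by a factorization instead of a derivative, so that it behaves well
  -- under products and cancellation in every characteristic.
  record DoubleRoot (p : Poly) (x : Carrier) : Set ℓ where
    constructor doubleRoot
    field
      {cofactor}    : Poly
      factorization : p ≋ linear x *ₚ cofactor
      cofactor-root : Root cofactor x

  double⇒root : ∀ {p x} → DoubleRoot p x → Root p x
  double⇒root {p} {x} (doubleRoot {s} eq _) =
    root-resp (≋-sym eq) (root-*ʳ {linear x} s (root-linear refl))

  double-resp : ∀ {p q x} → p ≋ q → DoubleRoot p x → DoubleRoot q x
  double-resp p≋q (doubleRoot eq sx≈0) = doubleRoot (≋-trans (≋-sym p≋q) eq) sx≈0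

  roots⇒double : ∀ {p q x} → Root p x → Root q x → DoubleRoot (p *ₚ q) x
  roots⇒double {p} {q} {x} px≈0 qx≈0 = doubleRoot
    (≋-trans (*ₚ-cong (root⇒linear-∣ px≈0) (≋-refl {q})) (*ₚ-assoc (linear x) (quotient x p) q))
    (root-*ˡ (quotient x p) qx≈0)

  double-*ˡ : ∀ p {q x} → DoubleRoot q x → DoubleRoot (p *ₚ q) x
  double-*ˡ p {q} {x} (doubleRoot {s} eq sx≈0) = doubleRoot
    (≋-trans (*ₚ-congˡ p eq) (*ₚ-exchange p (linear x) s))
    (root-*ˡ p sx≈0)

  -- Cancelling t - x identifies the cofactor of the product: it is `quotient x p` times `q` if `p`
  -- vanishes at `x`, and `p` times `quotient x q` otherwise. The factor of it that vanishes at `x`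
  -- decides the case.
  double-*⁻ : ∀ {p q x} → DoubleRoot (p *ₚ q) x →
              DoubleRoot p x ⊎ (Root p x × Root q x) ⊎ DoubleRoot q x
  double-*⁻ {p} {q} {x} d@(doubleRoot {s} eq sx≈0) with em {P = Root p x}
  ... | yes px≈0 = p-root (root-* (quotient x p) q (root-resp (≋-sym s-eq) sx≈0))
    where
    s-eq : quotient x p *ₚ q ≋ s
    s-eq = *ₚ-cancel-linear x
      (≋-trans (≋-sym (*ₚ-assoc (linear x) (quotient x p) q))
        (≋-trans (*ₚ-cong (≋-sym (root⇒linear-∣ px≈0)) (≋-refl {q})) eq))
    p-root : Root (quotient x p) x ⊎ Root q x → _
    p-root (inj₁ eq) = inj₁ (doubleRoot (root⇒linear-∣ px≈0) eq)
    p-root (inj₂ eq) = inj₂ (inj₁ (px≈0 , eq))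
  ... | no px≉0 = q-root (root-* p q (double⇒root d))
    where
    s-eq : Root q x → p *ₚ quotient x q ≋ s
    s-eq qx≈0 = *ₚ-cancel-linear x (≋-trans
      (*ₚ-exchange (linear x) p (quotient x q))
      (≋-trans (*ₚ-congˡ p (≋-sym (root⇒linear-∣ qx≈0))) eq))
    q-root : Root p x ⊎ Root q x → _
    q-root (inj₁ px≈0) = ⊥-elim (px≉0 px≈0)
    q-root (inj₂ qx≈0) with root-* p (quotient x q) (root-resp (≋-sym (s-eq qx≈0)) sx≈0)
    ... | inj₁ px≈0 = ⊥-elim (px≉0 px≈0)
    ... | inj₂ eq′  = inj₂ (inj₂ (doubleRoot (root⇒linear-∣ qx≈0) eq′))

  linear-simple : ∀ {r x} → ¬ DoubleRoot (linear r) x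
  linear-simple {r} {x} (doubleRoot {s} eq sx≈0)
    with degree-linear-cofactor {x} {s} (degree-resp eq (degree-linear r))
  ... | l , s° , ≡.refl =
    ℕ.n≮n 0 (roots≤degree {1} s° (λ _ → x) (λ { {zero} {zero} _ → ≡.refl }) (λ _ → sx≈0))

  Disjoint : Poly → Poly → Set ℓ
  Disjoint p q = ∀ x → Root p x → ¬ Root q x

  simple⇒disjoint : ∀ ps → (∀ x → ¬ DoubleRoot (∏ₚ ps) x) → AllPairs Disjoint ps
  simple⇒disjoint []       _      = []
  simple⇒disjoint (p ∷ ps) simple =
    All.tabulate (λ q∈ps x px≈0 qx≈0 → simple x
      (roots⇒double {p} px≈0 (∏-root ps (Any.map (λ { ≡.refl → qx≈0 }) q∈ps)))) ∷
    simple⇒disjoint ps (λ x d → simple x (double-*ˡ p d))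

  -- A double root of a product is double in one factor or common to two, and disjointness excludes
  -- the latter.
  double-∏ : ∀ ps {x} → AllPairs Disjoint ps → DoubleRoot (∏ₚ ps) x → Any (λ p → DoubleRoot p x) ps
  double-∏ [] _ d = ⊥-elim (¬root-1 (double⇒root d))
  double-∏ (p ∷ ps) (p# ∷ ps#) d with double-*⁻ {p} {∏ₚ ps} d
  ... | inj₁ d′ = here d′
  ... | inj₂ (inj₂ d′) = there (double-∏ ps ps# d′)
  ... | inj₂ (inj₁ (px≈0 , eq)) = ⊥-elim (clash p# (root-∏ ps eq))
    where
    clash : ∀ {qs} → All (Disjoint p) qs → ¬ Any (λ q → Root q _) qs
    clash (q# ∷ _)  (here qx≈0) = q# _ px≈0 qx≈0
    clash (_ ∷ qs#) (there any) = clash qs# any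

  unique⇒simple : ∀ rs → Unique.Unique setoid rs → ∀ x → ¬ DoubleRoot (∏linear rs) x
  unique⇒simple rs unique x d = clash rs (double-∏ (map linear rs)
    (AllPairsₚ.map⁺ (AllPairs.map
      (λ r≉s x xr xs → r≉s (trans (sym (root-linear⁻ xr)) (root-linear⁻ xs))) unique)) d)
    where
    clash : ∀ rs → ¬ Any (λ p → DoubleRoot p x) (map linear rs)
    clash (r ∷ rs) (here d)  = linear-simple d
    clash (r ∷ rs) (there a) = clash rs a

  simple⇒unique : ∀ rs → (∀ x → ¬ DoubleRoot (∏linear rs) x) → Unique.Unique setoid rs
  simple⇒unique rs simple = AllPairs.map
    (λ {r} disj r≈s → disj r (root-linear refl) (root-linear r≈s))
    (AllPairsₚ.map⁻ (simple⇒disjoint (map linear rs) simple))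

-- Change of coefficients, and polynomials over a field

module PolynomialMap (A B : CommutativeRing ℓ ℓ)
                     (φ : RingHomomorphism (CommutativeRing.rawRing A) (CommutativeRing.rawRing B)) where
  private
    module A = CommutativeRing A
    module B = CommutativeRing B
    module A[t] = PolynomialRing A
    module φ = RingHomomorphism φ
  open PolynomialRing B
  open Relation.Binary.Reasoning.Setoid B.setoid

  mapₚ : A[t].Poly → Poly
  mapₚ = map φ.⟦_⟧

  coeff-map : ∀ p n → coeff (mapₚ p) n B.≈ φ.⟦ A[t].coeff p n ⟧
  coeff-map []      n       = B.sym φ.0#-homo
  coeff-map (a ∷ p) zero    = B.refl
  coeff-map (a ∷ p) (suc n) = coeff-map p n

  map-≋ : ∀ {p q} → p A[t].≋ q → mapₚ p ≋ mapₚ q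
  map-≋ {p} {q} p≋q = coeffwise λ n →
    B.trans (coeff-map p n) (B.trans (φ.⟦⟧-cong (A[t].at p≋q n)) (B.sym (coeff-map q n)))

  map-+ : ∀ p q → mapₚ (p A[t].+ₚ q) ≋ mapₚ p +ₚ mapₚ q
  map-+ p q = coeffwise λ n → begin
    coeff (mapₚ (p A[t].+ₚ q)) n                  ≈⟨ coeff-map (p A[t].+ₚ q) n ⟩
    φ.⟦ A[t].coeff (p A[t].+ₚ q) n ⟧              ≈⟨ φ.⟦⟧-cong (A[t].coeff-+ p q n) ⟩
    φ.⟦ A[t].coeff p n A.+ A[t].coeff q n ⟧       ≈⟨ φ.+-homo _ _ ⟩
    φ.⟦ A[t].coeff p n ⟧ B.+ φ.⟦ A[t].coeff q n ⟧ ≈⟨ B.+-cong (coeff-map p n) (coeff-map q n) ⟨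
    coeff (mapₚ p) n B.+ coeff (mapₚ q) n         ≈⟨ coeff-+ (mapₚ p) (mapₚ q) n ⟨
    coeff (mapₚ p +ₚ mapₚ q) n                    ∎

  map-neg : ∀ p → mapₚ (A[t].-ₚ p) ≋ -ₚ mapₚ p
  map-neg []      = ≋-refl
  map-neg (a ∷ p) = φ.-‿homo a ∷-cong map-neg p

  map-· : ∀ a p → mapₚ (a A[t].· p) ≋ φ.⟦ a ⟧ · mapₚ p
  map-· a []      = ≋-refl
  map-· a (b ∷ p) = φ.*-homo a b ∷-cong map-· a p

  map-* : ∀ p q → mapₚ (p A[t].*ₚ q) ≋ mapₚ p *ₚ mapₚ q
  map-* []      q = ≋-refl
  map-* (a ∷ p) q = ≋-trans (map-+ (a A[t].· q) (A.0# ∷ p A[t].*ₚ q))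
    (+ₚ-cong (map-· a q) (φ.0#-homo ∷-cong map-* p q))

  map-1 : mapₚ A[t].1ₚ ≋ 1ₚ
  map-1 = φ.1#-homo ∷-cong ≋-refl

  map-∏ : ∀ gs → mapₚ (A[t].∏ₚ gs) ≋ ∏ₚ (map mapₚ gs)
  map-∏ []       = map-1
  map-∏ (g ∷ gs) = ≋-trans (map-* g (A[t].∏ₚ gs)) (*ₚ-congˡ (mapₚ g) (map-∏ gs))

  opaque
    unfolding PolynomialRing.linear

    map-linear : ∀ r → mapₚ (A[t].linear r) ≋ linear φ.⟦ r ⟧
    map-linear r = φ.-‿homo r ∷-cong map-1

  map-∏linear : ∀ rs → mapₚ (A[t].∏linear rs) ≋ ∏linear (map φ.⟦_⟧ rs)
  map-∏linear []       = map-1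
  map-∏linear (r ∷ rs) = ≋-trans (map-* (A[t].linear r) (A[t].∏linear rs))
    (*ₚ-cong (map-linear r) (map-∏linear rs))

  map-Below : ∀ {p n} → A[t].Below p n → Below (mapₚ p) n
  map-Below {p} p<n k n≤k =
    B.trans (coeff-map p k) (B.trans (φ.⟦⟧-cong (p<n k n≤k)) φ.0#-homo)

  map-^ : ∀ x n → φ.⟦ x A[t].^ n ⟧ B.≈ φ.⟦ x ⟧ ^ n
  map-^ x zero    = φ.1#-homo
  map-^ x (suc n) = B.trans (φ.*-homo _ _) (B.*-congˡ (map-^ x n))

field⇒domain : ExcludedMiddle ℓ → (R : CommutativeRing ℓ ℓ) → IsField R → IsDomain (CommutativeRing.rawRing R)
field⇒domain em R isField = IsField.1≉0 isField , zero-product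
  where
  open CommutativeRing R
  open Relation.Binary.Reasoning.Setoid setoid
  zero-product : ∀ x y → x * y ≈ 0# → x ≈ 0# ⊎ y ≈ 0#
  zero-product x y xy≈0 with em {P = x ≈ 0#}
  ... | yes x≈0 = inj₁ x≈0
  ... | no  x≉0 with IsField.inverse isField x x≉0
  ...   | x⁻¹ , xx⁻¹≈1 = inj₂ (begin
    y              ≈⟨ *-identityˡ y ⟨
    1# * y         ≈⟨ *-congʳ (trans (*-comm x⁻¹ x) xx⁻¹≈1) ⟨
    x⁻¹ * x * y    ≈⟨ *-assoc _ _ _ ⟩
    x⁻¹ * (x * y)  ≈⟨ *-congˡ xy≈0 ⟩
    x⁻¹ * 0#       ≈⟨ zeroʳ _ ⟩
    0#             ∎)

module FieldPolynomials (em : ExcludedMiddle ℓ) (k : CommutativeRing ℓ ℓ) (isField : IsField k) where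
  open CommutativeRing k hiding (zero)
  open DomainPolynomials em k (field⇒domain em k isField) public
  open Relation.Binary.Reasoning.Setoid R[t].setoid

  Irreducible : Poly → Set ℓ
  Irreducible = RawSemiring.Irreducible rawSemiring[t]

  infix 4 _∣_
  _∣_ : Poly → Poly → Set ℓ
  p ∣ q = ∃[ s ] s *ₚ p ≋ q

  ∣⇒∣ʳ : ∀ {p q} → p ∣ q → RawSemiring._∣_ rawSemiring[t] p q
  ∣⇒∣ʳ (s , eq) = s RawMagma., at eq

  ∣ʳ⇒∣ : ∀ {p q} → RawSemiring._∣_ rawSemiring[t] p q → p ∣ q
  ∣ʳ⇒∣ (s RawMagma., eq) = s , coeffwise eq

  divide : ∀ u {d} → Degree u d → ∀ h → ∃[ s ] ∃[ r ] h ≋ s *ₚ u +ₚ r × Below r d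
  divide u u° [] = [] , [] , ≋-refl , λ _ _ → refl
  divide u {d} u°@(degree u≉0 u<) (a ∷ h) with divide u u° h
  ... | s , r , h≋su+r , r<d with IsField.inverse isField (coeff u d) u≉0
  ... | l⁻¹ , ll⁻¹≈1 = c ∷ s , (a ∷ r) +ₚ -ₚ (c · u) , eq , below
    where
    -- Prepending `a` multiplies the old remainder by t and may raise its degree to `d`. Subtracting
    -- `c · u` removes exactly that coefficient.
    c = coeff (a ∷ r) d * l⁻¹
    eq : a ∷ h ≋ (c · u +ₚ (0# ∷ s *ₚ u)) +ₚ ((a ∷ r) +ₚ -ₚ (c · u))
    eq = begin
      a ∷ h                                                ≈⟨ sym (+-identityˡ a) ∷-cong h≋su+r ⟩
      (0# ∷ s *ₚ u) +ₚ (a ∷ r)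
        ≈⟨ RingIdentities.shift-sum polynomialRing (0# ∷ s *ₚ u) (a ∷ r) (c · u) ⟩
      (c · u +ₚ (0# ∷ s *ₚ u)) +ₚ ((a ∷ r) +ₚ -ₚ (c · u))  ∎
    below : Below ((a ∷ r) +ₚ -ₚ (c · u)) d
    below i d≤i with ℕ.m≤n⇒m<n∨m≡n d≤i
    ... | inj₁ d<i = Below-+ (a ∷ r) (-ₚ (c · u)) (Below-∷ {a = a} {r} r<d)
                       (Below-neg (c · u) (Below-· c u u<)) i d<i
    ... | inj₂ ≡.refl = trans (coeff-+ (a ∷ r) (-ₚ (c · u)) d)
      (trans (+-congˡ (trans (coeff-neg (c · u) d) (-‿cong (trans (coeff-· c u d) c*l))))
        (-‿inverseʳ (coeff (a ∷ r) d)))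
      where
      c*l : c * coeff u d ≈ coeff (a ∷ r) d
      c*l = trans (*-assoc _ _ _)
        (trans (*-congˡ (trans (*-comm l⁻¹ _) ll⁻¹≈1)) (*-identityʳ _))

  unit-degree : ∀ {p n} → Degree p n → p ∣ 1ₚ → n ≡ 0
  unit-degree {p} {n} p° (s , eq) with degree-factors {s} {p} (degree-resp (≋-sym eq) degree-1)
  ... | k , l , s° , p°′ , k+l≡0 with ≡.refl ← degree-unique p° p°′ = ℕ.m+n≡0⇒n≡0 k k+l≡0

  degree-0-unit : ∀ {p} → Degree p 0 → p ∣ 1ₚ
  degree-0-unit {p} (degree p≉0 p<) with IsField.inverse isField (coeff p 0) p≉0
  ... | c , pc≈1 = c ∷ [] , coeffwise λ n → trans
    (at (≋-trans (+ₚ-cong {c · p} ≋-refl (0∷[] ≋-refl)) (+ₚ-identityʳ (c · p))) n)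
    (trans (coeff-· c p n) (lemma n))
    where
    lemma : ∀ n → c * coeff p n ≈ coeff 1ₚ n
    lemma zero    = trans (*-comm c _) pc≈1
    lemma (suc n) = trans (*-congˡ (p< (suc n) (s≤s z≤n))) (zeroʳ c)

  unit-cofactor : ∀ {s u g h} → s ∣ 1ₚ → s *ₚ u ≋ g → u ∣ h → g ∣ h
  unit-cofactor {s} {u} {g} {h} (s⁻¹ , s⁻¹s≋1) su≋g (w , wu≋h) = w *ₚ s⁻¹ , (begin
    (w *ₚ s⁻¹) *ₚ g          ≈⟨ *ₚ-congˡ (w *ₚ s⁻¹) su≋g ⟨
    (w *ₚ s⁻¹) *ₚ (s *ₚ u)   ≈⟨ *ₚ-assoc w s⁻¹ (s *ₚ u) ⟩
    w *ₚ (s⁻¹ *ₚ (s *ₚ u))   ≈⟨ *ₚ-congˡ w (*ₚ-assoc s⁻¹ s u) ⟨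
    w *ₚ ((s⁻¹ *ₚ s) *ₚ u)   ≈⟨ *ₚ-congˡ w (*ₚ-congʳ (s⁻¹ *ₚ s) 1ₚ u s⁻¹s≋1) ⟩
    w *ₚ (1ₚ *ₚ u)           ≈⟨ *ₚ-congˡ w (*ₚ-identityˡ u) ⟩
    w *ₚ u                   ≈⟨ wu≋h ⟩
    h                        ∎)

  irreducible-degree : ∀ {p n} → Irreducible p → Degree p n → 0 < n
  irreducible-degree {n = suc n} irr p° = s≤s z≤n
  irreducible-degree {n = zero}  irr p° =
    ⊥-elim (RawSemiring.Irreducible.p∤1 irr (∣⇒∣ʳ (degree-0-unit p°)))

  ∏-++ : ∀ gs hs → ∏ₚ (gs ++ hs) ≋ ∏ₚ gs *ₚ ∏ₚ hs
  ∏-++ []       hs = ≋-sym (*ₚ-identityˡ (∏ₚ hs))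
  ∏-++ (g ∷ gs) hs = ≋-trans (*ₚ-congˡ g (∏-++ gs hs)) (≋-sym (*ₚ-assoc g (∏ₚ gs) (∏ₚ hs)))

  IrreducibleOfDegree : Poly → ℕ → Set ℓ
  IrreducibleOfDegree g d = Irreducible g × HasDegree g d

  Factorization : Poly → Set ℓ
  Factorization p = ∃ (HasSplittingType p)

  -- Excluded middle decides whether `p` is a product of two nonunits. If so, both have positive
  -- degree and hence smaller degree than `p`. Factors are not normalized, so the leading
  -- coefficient of `p` is absorbed by them.
  factorize : ∀ n p → Degree p n → 0 < n → Factorization p
  factorize = <-rec (λ n → ∀ p → Degree p n → 0 < n → Factorization p) step
    where
    Splits : Poly → Set ℓ
    Splits p = ∃[ x ] ∃[ y ] p ≈ₚ (x *ₚ y) × ¬ (x ∣ 1ₚ) × ¬ (y ∣ 1ₚ)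

    nonunit-degree : ∀ {p n} → Degree p n → ¬ (p ∣ 1ₚ) → 0 < n
    nonunit-degree {n = zero}  p° p∤1 = ⊥-elim (p∤1 (degree-0-unit p°))
    nonunit-degree {n = suc n} p° p∤1 = s≤s z≤n

    step : ∀ n → (∀ {m} → m < n → ∀ p → Degree p m → 0 < m → Factorization p) →
           ∀ p → Degree p n → 0 < n → Factorization p
    step n rec p p° 0<n with em {P = Splits p}
    ... | no ¬splits = n ∷ [] , p ∷ [] , at (≋-sym (R[t].*-identityʳ p)) ,
      (irreducible , Degree.top p° , Degree.below p°) ∷ []
      where
      irreducible : Irreducible p
      irreducible = RawSemiring.mkIrred
        (λ p∣1 → ℕ.<⇒≢ 0<n (≡.sym (unit-degree p° (∣ʳ⇒∣ p∣1)))) split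
        where
        split : ∀ {x y} → p ≈ₚ (x *ₚ y) →
                RawSemiring._∣_ rawSemiring[t] x 1ₚ ⊎ RawSemiring._∣_ rawSemiring[t] y 1ₚ
        split {x} {y} eq with em {P = x ∣ 1ₚ} | em {P = y ∣ 1ₚ}
        ... | yes x∣1 | _       = inj₁ (∣⇒∣ʳ x∣1)
        ... | no _    | yes y∣1 = inj₂ (∣⇒∣ʳ y∣1)
        ... | no x∤1  | no y∤1  = ⊥-elim (¬splits (x , y , eq , x∤1 , y∤1))
    ... | yes (x , y , eq , x∤1 , y∤1) with degree-factors {x} {y} (degree-resp (coeffwise eq) p°)
    ... | k , l , x° , y° , ≡.refl
      with 0<k ← nonunit-degree x° x∤1 | 0<l ← nonunit-degree y° y∤1
      with rec (ℕ.m<m+n k 0<l) x x° 0<k | rec (ℕ.m<n+m l 0<k) y y° 0<l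
    ... | ds , gs , x≈ , irr | es , hs , y≈ , irr′ = ds ++ es , gs ++ hs ,
      at (≋-trans {p} (coeffwise eq)
        (≋-trans (*ₚ-cong {x} {∏ₚ gs} {y} {∏ₚ hs} (coeffwise x≈) (coeffwise y≈)) (≋-sym (∏-++ gs hs)))) ,
      ++⁺ irr irr′

  factorize-monic : ∀ p → Monic p → Factorization p
  -- Monicity matters in degree 0: the empty product is 1, and no other constant has a splitting
  -- type.
  factorize-monic p (zero  , p≈1 , p<) = [] , [] , (λ { zero → p≈1 ; (suc n) → p< (suc n) (s≤s z≤n) }) , []
  factorize-monic p (suc n , p≈1 , p<) = factorize (suc n) p (leading⇒degree (p≈1 , p<)) (s≤s z≤n)

-- Polynomials over a field evaluated in a domain above it

module FieldExtension (em : ExcludedMiddle ℓ) (k : CommutativeRing ℓ ℓ) (isField : IsField k)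
                      (E : CommutativeRing ℓ ℓ) (isDomain : IsDomain (CommutativeRing.rawRing E))
                      (φ : RingHomomorphism (CommutativeRing.rawRing k) (CommutativeRing.rawRing E)) where
  private
    module k = CommutativeRing k
    module φ = RingHomomorphism φ
  module k[t] = FieldPolynomials em k isField
  open CommutativeRing E hiding (zero)
  open DomainPolynomials em E isDomain public
  open PolynomialMap k E φ public
  open Relation.Binary.Reasoning.Setoid setoid

  φ-injective₀ : ∀ {c} → φ.⟦ c ⟧ ≈ 0# → c k.≈ k.0#
  φ-injective₀ {c} φc≈0 with em {P = c k.≈ k.0#}
  ... | yes c≈0 = c≈0
  ... | no  c≉0 with IsField.inverse isField c c≉0
  ...   | c⁻¹ , cc⁻¹≈1 = ⊥-elim (1≉0 (begin
    1#                     ≈⟨ φ.1#-homo ⟨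
    φ.⟦ k.1# ⟧             ≈⟨ φ.⟦⟧-cong cc⁻¹≈1 ⟨
    φ.⟦ c k.* c⁻¹ ⟧        ≈⟨ φ.*-homo c c⁻¹ ⟩
    φ.⟦ c ⟧ * φ.⟦ c⁻¹ ⟧    ≈⟨ *-congʳ φc≈0 ⟩
    0# * φ.⟦ c⁻¹ ⟧         ≈⟨ zeroˡ _ ⟩
    0#                     ∎))

  φ-injective : ∀ {c d} → φ.⟦ c ⟧ ≈ φ.⟦ d ⟧ → c k.≈ d
  φ-injective {c} {d} eq = k[t].x-y≈0⇒x≈y (φ-injective₀ (begin
    φ.⟦ c k.- d ⟧              ≈⟨ φ.+-homo c (k.- d) ⟩
    φ.⟦ c ⟧ + φ.⟦ k.- d ⟧      ≈⟨ +-cong eq (φ.-‿homo d) ⟩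
    φ.⟦ d ⟧ - φ.⟦ d ⟧          ≈⟨ -‿inverseʳ _ ⟩
    0#                         ∎))

  map-degree : ∀ {p n} → k[t].Degree p n → Degree (mapₚ p) n
  map-degree {p} {n} (k[t].degree p≉0 p<) =
    degree (λ eq → p≉0 (φ-injective₀ (trans (sym (coeff-map p n)) eq))) (map-Below {p} p<)

  infix 4 _RootAt_
  _RootAt_ : k[t].Poly → Carrier → Set ℓ
  p RootAt β = Root (mapₚ p) β

  rootAt-resp : ∀ {p q β} → p k[t].≋ q → p RootAt β → q RootAt β
  rootAt-resp p≋q = root-resp (map-≋ p≋q)

  rootAt-∣ : ∀ {p q β} → p k[t].∣ q → p RootAt β → q RootAt β
  rootAt-∣ {p} {q} (s , sp≋q) pβ≈0 =
    root-resp (≋-trans (≋-sym (map-* s p)) (map-≋ sp≋q)) (root-*ˡ (mapₚ s) pβ≈0)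

  rootAt-remainder : ∀ {s u r h β} → h k[t].≋ s k[t].*ₚ u k[t].+ₚ r → u RootAt β → h RootAt β → r RootAt β
  rootAt-remainder {s} {u} {r} {h} {β} h≋ uβ≈0 (root hβ≈0) = root (begin
    eval (mapₚ r) β                                      ≈⟨ +-identityˡ _ ⟨
    0# + eval (mapₚ r) β
      ≈⟨ +-congʳ (vanishes (rootAt-∣ {u} {s k[t].*ₚ u} (s , k[t].≋-refl) uβ≈0)) ⟨
    eval (mapₚ (s k[t].*ₚ u)) β + eval (mapₚ r) β        ≈⟨ eval-+ (mapₚ (s k[t].*ₚ u)) (mapₚ r) β ⟨
    eval (mapₚ (s k[t].*ₚ u) +ₚ mapₚ r) β
      ≈⟨ eval-cong (mapₚ (s k[t].*ₚ u k[t].+ₚ r)) _ (map-+ (s k[t].*ₚ u) r) refl ⟨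
    eval (mapₚ (s k[t].*ₚ u k[t].+ₚ r)) β                ≈⟨ eval-cong (mapₚ h) _ (map-≋ h≋) refl ⟨
    eval (mapₚ h) β                                      ≈⟨ hβ≈0 ⟩
    0#                                                   ∎)

  rootAt-difference : ∀ p q {β} → eval (mapₚ p) β ≈ eval (mapₚ q) β → (p k[t].+ₚ k[t].-ₚ q) RootAt β
  rootAt-difference p q {β} eq = root (begin
    eval (mapₚ (p k[t].+ₚ k[t].-ₚ q)) β
      ≈⟨ eval-cong (mapₚ (p k[t].+ₚ k[t].-ₚ q)) _ (map-+ p (k[t].-ₚ q)) refl ⟩
    eval (mapₚ p +ₚ mapₚ (k[t].-ₚ q)) β             ≈⟨ eval-+ (mapₚ p) (mapₚ (k[t].-ₚ q)) β ⟩
    eval (mapₚ p) β + eval (mapₚ (k[t].-ₚ q)) β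
      ≈⟨ +-congˡ (eval-cong (mapₚ (k[t].-ₚ q)) (-ₚ mapₚ q) (map-neg q) refl) ⟩
    eval (mapₚ p) β + eval (-ₚ mapₚ q) β            ≈⟨ +-congˡ (eval-neg (mapₚ q) β) ⟩
    eval (mapₚ p) β - eval (mapₚ q) β               ≈⟨ x≈y⇒x-y≈0 eq ⟩
    0#                                              ∎)

  -- A generator of the kernel of evaluation at `β`: the minimal polynomial up to a unit.
  record Annihilator (β : Carrier) : Set ℓ where
    field
      generator : k[t].Poly
      root-β    : generator RootAt β
      divides   : ∀ h → h RootAt β → generator k[t].∣ h

  -- Descent on the degree: if `u` fails to divide some `h` that vanishes at `β`, the remainder of
  -- `h` by `u` is nonzero, vanishes at `β` and has smaller degree.
  annihilator : ∀ {β} n u → k[t].Degree u n → u RootAt β → Annihilator β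
  annihilator {β} = <-rec (λ n → ∀ u → k[t].Degree u n → u RootAt β → Annihilator β) step
    where
    step : ∀ n → (∀ {m} → m < n → ∀ u → k[t].Degree u m → u RootAt β → Annihilator β) →
           ∀ u → k[t].Degree u n → u RootAt β → Annihilator β
    step n rec u u° uβ≈0 with em {P = ∃[ h ] h RootAt β × ¬ (u k[t].∣ h)}
    ... | no none = record { generator = u ; root-β = uβ≈0 ; divides = divides }
      where
      divides : ∀ h → h RootAt β → u k[t].∣ h
      divides h hβ≈0 with em {P = u k[t].∣ h}
      ... | yes u∣h = u∣h
      ... | no  u∤h = ⊥-elim (none (h , hβ≈0 , u∤h))
    ... | yes (h , hβ≈0 , u∤h) with k[t].divide u u° h
    ... | s , r , h≋ , r<n with k[t].degree? r
    ... | inj₁ r≋[] = ⊥-elim (u∤h (s , k[t].≋-sym (k[t].≋-trans h≋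
            (k[t].≋-trans (k[t].+ₚ-cong {s k[t].*ₚ u} k[t].≋-refl r≋[]) (k[t].+ₚ-identityʳ (s k[t].*ₚ u))))))
    ... | inj₂ (m , r°@(k[t].degree r≉0 _)) =
      rec (ℕ.≰⇒> λ n≤m → r≉0 (r<n m n≤m)) r r° (rootAt-remainder {s} {u} {r} h≋ uβ≈0 hβ≈0)

  ¬unit-rootAt : ∀ {p β} → p k[t].∣ k[t].1ₚ → ¬ (p RootAt β)
  ¬unit-rootAt {p} p∣1 pβ≈0 = ¬root-1 (root-resp map-1 (rootAt-∣ {p} p∣1 pβ≈0))

  -- The generator `u` of the annihilator divides `g`, and it is not a unit because it has a root.
  -- Irreducibility makes the complementary factor a unit, so `g` divides whatever `u` divides. This
  -- replaces a Bezout argument.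
  irreducible-∣ : ∀ {g d h β} → k[t].Irreducible g → k[t].Degree g d →
                  g RootAt β → h RootAt β → g k[t].∣ h
  irreducible-∣ {g} {d} {h} {β} irr g° gβ≈0 hβ≈0 with annihilator d g g° gβ≈0
  ... | record { generator = u ; root-β = uβ≈0 ; divides = divides } with divides g gβ≈0 | divides h hβ≈0
  ... | s , su≋g | w , wu≋h = associate (RawSemiring.Irreducible.split-∣1 irr (k[t].at (k[t].≋-sym su≋g)))
    where
    associate : _ → g k[t].∣ h
    associate (inj₂ u∣1) = ⊥-elim (¬unit-rootAt {u} (k[t].∣ʳ⇒∣ u∣1) uβ≈0)
    associate (inj₁ s∣1) = k[t].unit-cofactor {s} {u} (k[t].∣ʳ⇒∣ s∣1) su≋g (w , wu≋h)

  ∣-Below⇒≋[] : ∀ {g d h} → k[t].Degree g d → g k[t].∣ h → k[t].Below h d → h k[t].≋ []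
  ∣-Below⇒≋[] {g} {d} {h} g° (s , sg≋h) h<d with k[t].degree? s
  ... | inj₁ s≋[] = k[t].≋-trans (k[t].≋-sym sg≋h) (k[t].*ₚ-zeroˡ s g s≋[])
  ... | inj₂ (m , s°) with k[t].degree-resp sg≋h (k[t].degree-* s° g°)
  ...   | k[t].degree h≉0 _ = ⊥-elim (h≉0 (h<d (m ℕ.+ d) (ℕ.m≤n+m d m)))

-- Finite fields

iterate-+ : ∀ {a} {A : Set a} (f : A → A) x m n → iterate f x (m ℕ.+ n) ≡ iterate f (iterate f x m) n
iterate-+ f x zero    n = ≡.refl
iterate-+ f x (suc m) n = iterate-+ f (f x) m n

funToFin-cong : ∀ {m n} (f g : Fin m → Fin n) → (∀ i → f i ≡ g i) → funToFin f ≡ funToFin g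
funToFin-cong {zero}  f g f≗g = ≡.refl
funToFin-cong {suc m} f g f≗g = ≡.cong₂ combine (f≗g zero) (funToFin-cong _ _ (λ i → f≗g (suc i)))

module Fermat (em : ExcludedMiddle ℓ) (k : CommutativeRing ℓ ℓ) (isField : IsField k) where
  open CommutativeRing k hiding (zero)
  open FieldPolynomials em k isField using (zero-product; _^_; 1≉0; x-y≈0⇒x≈y; x≈y⇒x-y≈0)
  open Algebra.Properties.CommutativeMonoid.Sum *-commutativeMonoid
    renaming (sum to ∏; sum-cong-≋ to ∏-cong; sum-remove to ∏-remove; sum-replicate to ∏-replicate;
              sum-permute to ∏-permute; ∑-distrib-+ to ∏-distrib-*)
    using ()
  open Relation.Binary.Reasoning.Setoid setoid

  *-cancelˡ-nonzero : ∀ {a x y} → ¬ (a ≈ 0#) → a * x ≈ a * y → x ≈ y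
  *-cancelˡ-nonzero {a} {x} {y} a≉0 eq with zero-product (trans (x[y-z]≈xy-xz a x y) (x≈y⇒x-y≈0 eq))
    where open Algebra.Properties.Ring ring using (x[y-z]≈xy-xz)
  ... | inj₁ a≈0   = ⊥-elim (a≉0 a≈0)
  ... | inj₂ x-y≈0 = x-y≈0⇒x≈y x-y≈0

  ∏-nonzero : ∀ {n} (t : Fin n → Carrier) → (∀ i → ¬ (t i ≈ 0#)) → ¬ (∏ t ≈ 0#)
  ∏-nonzero {zero}  t t≉0 eq = 1≉0 eq
  ∏-nonzero {suc n} t t≉0 eq with zero-product eq
  ... | inj₁ eq′ = t≉0 zero eq′
  ... | inj₂ eq′ = ∏-nonzero (λ i → t (suc i)) (λ i → t≉0 (suc i)) eq′

  if-zero : Carrier → Carrier → Carrier → Carrier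
  if-zero x a b with em {P = x ≈ 0#}
  ... | yes _ = a
  ... | no  _ = b

  if-zero-yes : ∀ {x a b} → x ≈ 0# → if-zero x a b ≈ a
  if-zero-yes {x} x≈0 with em {P = x ≈ 0#}
  ... | yes _   = refl
  ... | no  x≉0 = ⊥-elim (x≉0 x≈0)

  if-zero-no : ∀ {x a b} → ¬ (x ≈ 0#) → if-zero x a b ≈ b
  if-zero-no {x} x≉0 with em {P = x ≈ 0#}
  ... | yes x≈0 = ⊥-elim (x≉0 x≈0)
  ... | no  _   = refl

  -- Multiplication by c permutes the field; comparing the product of its
  -- nonzero elements before and after gives c^(q-1) ≈ 1 for c ≉ 0.
  module _ {n : ℕ} (enumeration : Inverse (≡.setoid (Fin (suc n))) setoid) where
    open Inverse enumeration using (to; from; strictlyInverseˡ; strictlyInverseʳ; from-cong)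

    private
      0ᶠ : Fin (suc n)
      0ᶠ = from 0#

      -- Zero is replaced by 1, so that products can run over the whole enumeration instead of a
      -- subtype of nonzero elements.
      nonzeroPart : Carrier → Carrier
      nonzeroPart x = if-zero x 1# x

      nonzeroPart-cong : ∀ {x y} → x ≈ y → nonzeroPart x ≈ nonzeroPart y
      nonzeroPart-cong {x} {y} x≈y with em {P = x ≈ 0#}
      ... | yes x≈0 = sym (if-zero-yes (trans (sym x≈y) x≈0))
      ... | no  x≉0 = trans x≈y (sym (if-zero-no (λ y≈0 → x≉0 (trans x≈y y≈0))))

      nonzeroPart≉0 : ∀ x → ¬ (nonzeroPart x ≈ 0#)
      nonzeroPart≉0 x with em {P = x ≈ 0#}
      ... | yes _   = 1≉0
      ... | no  x≉0 = x≉0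

    module _ {c : Carrier} (c≉0 : ¬ (c ≈ 0#)) where
      private
        c⁻¹ : Carrier
        c⁻¹ = proj₁ (IsField.inverse isField c c≉0)

        cc⁻¹≈1 : c * c⁻¹ ≈ 1#
        cc⁻¹≈1 = proj₂ (IsField.inverse isField c c≉0)

        cancel : ∀ {a b} → a * b ≈ 1# → ∀ i → from (a * to (from (b * to i))) ≡ i
        cancel {a} {b} ab≈1 i = ≡.trans (from-cong (begin
          a * to (from (b * to i))  ≈⟨ *-congˡ (strictlyInverseˡ _) ⟩
          a * (b * to i)            ≈⟨ *-assoc _ _ _ ⟨
          a * b * to i              ≈⟨ *-congʳ ab≈1 ⟩
          1# * to i                 ≈⟨ *-identityˡ _ ⟩
          to i                      ∎)) (strictlyInverseʳ i)

        π : Permutation (suc n) (suc n)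
        π = permutation (λ i → from (c * to i)) (λ i → from (c⁻¹ * to i))
              (cancel cc⁻¹≈1) (cancel (trans (*-comm c⁻¹ c) cc⁻¹≈1))

        -- The factor by which `nonzeroPart` changes under multiplication by `c`: zero stays put and
        -- keeps its substitute 1, every other element gains a `c`.
        weight : Fin (suc n) → Carrier
        weight i = if-zero (to i) 1# c

        units : Fin (suc n) → Carrier
        units i = nonzeroPart (to i)

        units-π : ∀ i → units (π ⟨$⟩ʳ i) ≈ units i * weight i
        units-π i = trans (nonzeroPart-cong (strictlyInverseˡ (c * to i))) lemma
          where
          lemma : nonzeroPart (c * to i) ≈ units i * weight i
          lemma with em {P = to i ≈ 0#}
          ... | yes x≈0 = trans (if-zero-yes (trans (*-congˡ x≈0) (zeroʳ c))) (sym (*-identityˡ 1#))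
          ... | no  x≉0 = trans (if-zero-no cx≉0) (*-comm c (to i))
            where
            cx≉0 : ¬ (c * to i ≈ 0#)
            cx≉0 eq with zero-product eq
            ... | inj₁ c≈0 = c≉0 c≈0
            ... | inj₂ x≈0 = x≉0 x≈0

        ∏weight≈1 : ∏ weight ≈ 1#
        ∏weight≈1 = *-cancelˡ-nonzero (∏-nonzero units (λ i → nonzeroPart≉0 (to i))) (begin
          ∏ units * ∏ weight            ≈⟨ ∏-distrib-* units weight ⟨
          ∏ (λ i → units i * weight i)  ≈⟨ ∏-cong units-π ⟨
          ∏ (λ i → units (π ⟨$⟩ʳ i))    ≈⟨ ∏-permute units π ⟨
          ∏ units                       ≈⟨ *-identityʳ _ ⟨
          ∏ units * 1#                  ∎)

        -- The index of zero has weight 1, and each of the remaining `n` indices contributes one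
        -- `c`.
        ∏weight≈c^n : ∏ weight ≈ c ^ n
        ∏weight≈c^n = begin
          ∏ weight                              ≈⟨ ∏-remove {i = 0ᶠ} weight ⟩
          weight 0ᶠ * ∏ (removeAt weight 0ᶠ)    ≈⟨ *-cong (if-zero-yes (strictlyInverseˡ 0#))
            (∏-cong {n} {removeAt weight 0ᶠ} {replicate n c} (λ j → if-zero-no (punched≉0 j))) ⟩
          1# * ∏ (replicate n c)                ≈⟨ *-identityˡ _ ⟩
          ∏ (replicate n c)                     ≈⟨ ∏-replicate n ⟩
          c ^ n                                 ∎
          where
          punched≉0 : ∀ j → ¬ (to (punchIn 0ᶠ j) ≈ 0#)
          punched≉0 j eq = Fin.punchInᵢ≢i 0ᶠ j
            (≡.trans (≡.sym (strictlyInverseʳ _)) (from-cong eq))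

      nonzero-fermat : c ^ suc n ≈ c
      nonzero-fermat = begin
        c * c ^ n  ≈⟨ *-congˡ (trans (sym ∏weight≈c^n) ∏weight≈1) ⟩
        c * 1#     ≈⟨ *-identityʳ c ⟩
        c          ∎

  fermat : ∀ {n} → Inverse (≡.setoid (Fin n)) setoid → ∀ c → c ^ n ≈ c
  fermat {zero}  enumeration c with () ← Inverse.from enumeration c
  fermat {suc n} enumeration c with em {P = c ≈ 0#}
  ... | no  c≉0 = nonzero-fermat enumeration c≉0
  ... | yes c≈0 = trans (*-congʳ c≈0) (trans (zeroˡ _) (sym c≈0))

  1<cardinality : ∀ {n} → Inverse (≡.setoid (Fin n)) setoid → 1 < n
  1<cardinality {zero} enumeration with () ← Inverse.from enumeration 0#
  1<cardinality {suc zero} enumeration = ⊥-elim (1≉0 (trans (sym (strictlyInverseˡ 1#))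
    (trans (reflexive (≡.cong to (unique (from 1#) (from 0#)))) (strictlyInverseˡ 0#))))
    where
    open Inverse enumeration
    unique : (i j : Fin 1) → i ≡ j
    unique zero zero = ≡.refl
  1<cardinality {suc (suc n)} enumeration = s≤s (s≤s z≤n)

-- Frobenius orbits and splitting types

module FrobeniusOrbits (em : ExcludedMiddle ℓ) (𝔽q : FiniteField ℓ)
                       (E : CommutativeRing ℓ ℓ) (isDomain : IsDomain (CommutativeRing.rawRing E))
                       (φ : RingHomomorphism (FiniteField.rawRing 𝔽q) (CommutativeRing.rawRing E)) where
  private
    module 𝔽q = FiniteField 𝔽q
    module φ = RingHomomorphism φ
  open 𝔽q using (q; enumeration)
  open CommutativeRing E hiding (zero)
  open FieldExtension em 𝔽q.ring 𝔽q.isField E isDomain φ public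
  open Fermat em 𝔽q.ring 𝔽q.isField using (fermat; 1<cardinality)
  open Algebra.Properties.CommutativeSemiring.Exp commutativeSemiring using (^-distrib-*; ^-congˡ; ^-assocʳ)
  open Algebra.Properties.Ring ring using (-0#≈0#; -‿involutive)
  open Relation.Binary.Reasoning.Setoid setoid

  F : Carrier → Carrier
  F x = x ^ q

  1<q : 1 < q
  1<q = 1<cardinality enumeration

  F-cong : ∀ {x y} → x ≈ y → F x ≈ F y
  F-cong = ^-congˡ q

  F-* : ∀ x y → F (x * y) ≈ F x * F y
  F-* x y = ^-distrib-* x y q

  F-φ : ∀ c → F φ.⟦ c ⟧ ≈ φ.⟦ c ⟧
  F-φ c = trans (sym (map-^ c q)) (φ.⟦⟧-cong (fermat enumeration c))

  constants : Fin q → Carrier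
  constants i = φ.⟦ Inverse.to enumeration i ⟧

  constants-injective : ∀ {i j} → constants i ≈ constants j → i ≡ j
  constants-injective {i} {j} eq = ≡.trans (≡.sym (Inverse.strictlyInverseʳ enumeration i))
    (≡.trans (Inverse.from-cong enumeration (φ-injective eq)) (Inverse.strictlyInverseʳ enumeration j))

  -- (t + y)^q - t^q - y^q has degree less than q, so it vanishes as soon as
  -- the q constants are roots.
  F-+-from-constants : ∀ y → (∀ c → F (φ.⟦ c ⟧ + y) ≈ F φ.⟦ c ⟧ + F y) → ∀ x → F (x + y) ≈ F x + F y
  F-+-from-constants y additive x = x-y≈0⇒x≈y (trans (sym (eval-D x)) (eval-≋[] D x D≋[]))
    where
    D : Poly
    D = (linear (- y) ^ₚ q +ₚ -ₚ (linear 0# ^ₚ q)) +ₚ -ₚ (F y ∷ [])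

    eval-linear-^ : ∀ r z x → x - r ≈ z → eval (linear r ^ₚ q) x ≈ F z
    eval-linear-^ r z x eq =
      trans (eval-^ (linear r) q x) (F-cong (trans (eval-linear r x) eq))

    eval-D : ∀ x → eval D x ≈ F (x + y) - (F x + F y)
    eval-D x = begin
      eval D x  ≈⟨ eval-+ (linear (- y) ^ₚ q +ₚ -ₚ (linear 0# ^ₚ q)) (-ₚ (F y ∷ [])) x ⟩
      eval (linear (- y) ^ₚ q +ₚ -ₚ (linear 0# ^ₚ q)) x + eval (-ₚ (F y ∷ [])) x
        ≈⟨ +-cong (eval-+ (linear (- y) ^ₚ q) (-ₚ (linear 0# ^ₚ q)) x) (eval-const (- F y) x) ⟩
      (eval (linear (- y) ^ₚ q) x + eval (-ₚ (linear 0# ^ₚ q)) x) - F y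
        ≈⟨ +-congʳ (+-cong (eval-linear-^ (- y) (x + y) x (+-congˡ (-‿involutive y)))
             (trans (eval-neg (linear 0# ^ₚ q) x)
               (-‿cong (eval-linear-^ 0# x x (trans (+-congˡ -0#≈0#) (+-identityʳ x)))))) ⟩
      (F (x + y) - F x) - F y  ≈⟨ RingIdentities.sub-sub E (F (x + y)) (F x) (F y) ⟩
      F (x + y) - (F x + F y)  ∎

    Below-D : Below D q
    Below-D = Below-+ (linear (- y) ^ₚ q +ₚ -ₚ (linear 0# ^ₚ q)) (-ₚ (F y ∷ []))
      (leading-difference (linear (- y) ^ₚ q) (linear 0# ^ₚ q) q
        (leading-linear-^ (- y) q) (leading-linear-^ 0# q))
      (Below-weaken {(- F y) ∷ []} (ℕ.<⇒≤ 1<q) λ { (suc k) _ → refl })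

    D≋[] : D ≋ []
    D≋[] = roots-Below⇒≋[] Below-D constants constants-injective
      (λ i → root (trans (eval-D (constants i)) (x≈y⇒x-y≈0 (additive _))))

  -- The reduction to constants is applied twice. With `y` a constant its premise is Fermat's
  -- theorem in `𝔽q`. This gives additivity when one summand is constant, which after swapping the
  -- summands is the premise for arbitrary `y`.
  F-+ : ∀ x y → F (x + y) ≈ F x + F y
  F-+ x y = F-+-from-constants y (λ c → begin
    F (φ.⟦ c ⟧ + y)    ≈⟨ F-cong (+-comm _ _) ⟩
    F (y + φ.⟦ c ⟧)    ≈⟨ F-+-from-constants φ.⟦ c ⟧ (constant+ c) y ⟩
    F y + F φ.⟦ c ⟧    ≈⟨ +-comm _ _ ⟩
    F φ.⟦ c ⟧ + F y    ∎) x
    where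
    constant+ : ∀ c d → F (φ.⟦ d ⟧ + φ.⟦ c ⟧) ≈ F φ.⟦ d ⟧ + F φ.⟦ c ⟧
    constant+ c d = begin
      F (φ.⟦ d ⟧ + φ.⟦ c ⟧)  ≈⟨ F-cong (φ.+-homo d c) ⟨
      F φ.⟦ d 𝔽q.+ c ⟧       ≈⟨ F-φ (d 𝔽q.+ c) ⟩
      φ.⟦ d 𝔽q.+ c ⟧         ≈⟨ φ.+-homo d c ⟩
      φ.⟦ d ⟧ + φ.⟦ c ⟧      ≈⟨ +-cong (F-φ d) (F-φ c) ⟨
      F φ.⟦ d ⟧ + F φ.⟦ c ⟧  ∎

  F-0 : F 0# ≈ 0#
  F-0 = trans (F-cong (sym φ.0#-homo)) (trans (F-φ 𝔽q.0#) φ.0#-homo)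

  -- By additivity the q-th power of the difference vanishes, and a domain has no nilpotents.
  F-injective : ∀ {x y} → F x ≈ F y → x ≈ y
  F-injective {x} {y} eq = x-y≈0⇒x≈y (x^n≈0⇒x≈0 q (begin
    F (x - y)        ≈⟨ F-+ x (- y) ⟩
    F x + F (- y)    ≈⟨ +-congʳ eq ⟩
    F y + F (- y)    ≈⟨ F-+ y (- y) ⟨
    F (y - y)        ≈⟨ F-cong (-‿inverseʳ y) ⟩
    F 0#             ≈⟨ F-0 ⟩
    0#               ∎))

  F-eval : ∀ p x → F (eval (mapₚ p) x) ≈ eval (mapₚ p) (F x)
  F-eval []      x = F-0
  F-eval (a ∷ p) x = trans (F-+ _ _) (+-cong (F-φ a) (trans (F-* x _) (*-congˡ (F-eval p x))))

  F-root : ∀ {p x} → p RootAt x → p RootAt F x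
  F-root {p} {x} (root eq) = root (trans (sym (F-eval p x)) (trans (F-cong eq) F-0))

  iterate-cong : ∀ n {x y} → x ≈ y → iterate F x n ≈ iterate F y n
  iterate-cong zero    x≈y = x≈y
  iterate-cong (suc n) x≈y = iterate-cong n (F-cong x≈y)

  iterate-injective : ∀ n {x y} → iterate F x n ≈ iterate F y n → x ≈ y
  iterate-injective zero    eq = eq
  iterate-injective (suc n) eq = F-injective (iterate-injective n eq)

  iterate-root : ∀ {p x} n → p RootAt x → p RootAt iterate F x n
  iterate-root     zero    px≈0 = px≈0
  iterate-root {p} (suc n) px≈0 = iterate-root {p} n (F-root {p} px≈0)

  iterate-eval : ∀ p x n → iterate F (eval (mapₚ p) x) n ≈ eval (mapₚ p) (iterate F x n)
  iterate-eval p x zero    = refl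
  iterate-eval p x (suc n) = trans (iterate-cong n (F-eval p x)) (iterate-eval p (F x) n)

  iterate-^ : ∀ x n → iterate F x n ≈ x ^ (q ℕ.^ n)
  iterate-^ x zero    = sym (*-identityʳ x)
  iterate-^ x (suc n) = trans (iterate-^ (F x) n) (^-assocʳ x q (q ℕ.^ n))

  coeff-tabulate : ∀ {d} (c : Fin d → 𝔽q.Carrier) i → k[t].coeff (tabulate c) (toℕ i) 𝔽q.≈ c i
  coeff-tabulate c zero    = 𝔽q.refl
  coeff-tabulate c (suc i) = coeff-tabulate (λ j → c (suc j)) i

  Below-tabulate : ∀ {d} (c : Fin d → 𝔽q.Carrier) → k[t].Below (tabulate c) d
  Below-tabulate {zero}  c n       _         = 𝔽q.refl
  Below-tabulate {suc d} c (suc n) (s≤s d≤n) = Below-tabulate (λ j → c (suc j)) n d≤n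

  -- The q^d combinations of 1, β, …, β^(d-1) are distinct roots of t^(q^n) - t.
  period≥degree : ∀ {g d β n} → k[t].Irreducible g → k[t].Degree g d → g RootAt β →
                  0 < n → iterate F β n ≈ β → d ≤ n
  period≥degree {g} {d} {β} {n} irr g° gβ≈0 0<n closes = ℕ.≮⇒≥ λ n<d →
    ℕ.<⇒≱ (ℕ.^-monoʳ-< q 1<q n<d) (roots≤degree T-degree values values-injective values-root)
    where
    Q : ℕ
    Q = q ℕ.^ n

    -- Positivity of `n` enters here: for `Q` equal to 1 the two terms of `T` would cancel.
    1<Q : 1 < Q
    1<Q = ℕ.^-monoʳ-< q 1<q 0<n

    T : Poly
    T = linear 0# ^ₚ Q +ₚ -ₚ linear 0#

    T-leading : HasLeading T Q 1#
    T-leading with leading-linear-^ 0# Q | leading-linear 0#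
    ... | top , below | _ , below′ =
      trans (coeff-+ (linear 0# ^ₚ Q) (-ₚ linear 0#) Q)
        (trans (+-cong top (trans (coeff-neg (linear 0#) Q) (trans (-‿cong (below′ Q 1<Q)) -0#≈0#)))
          (+-identityʳ 1#)) ,
      Below-+ (linear 0# ^ₚ Q) (-ₚ linear 0#) below
        (Below-neg (linear 0#) (Below-weaken {linear 0#} (ℕ.m≤n⇒m≤1+n 1<Q) below′))

    T-degree : Degree T Q
    T-degree = leading⇒degree T-leading

    T-root : ∀ x → iterate F x n ≈ x → Root T x
    T-root x fixed = root (begin
      eval T x                                         ≈⟨ eval-+ (linear 0# ^ₚ Q) (-ₚ linear 0#) x ⟩
      eval (linear 0# ^ₚ Q) x + eval (-ₚ linear 0#) x  ≈⟨ +-cong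
        (trans (eval-^ (linear 0#) Q x) (^-congˡ Q x-0))
        (trans (eval-neg (linear 0#) x) (-‿cong x-0)) ⟩
      x ^ Q - x                                        ≈⟨ x≈y⇒x-y≈0 (trans (sym (iterate-^ x n)) fixed) ⟩
      0#                                               ∎)
      where
      x-0 : eval (linear 0#) x ≈ x
      x-0 = trans (eval-linear 0# x) (trans (+-congˡ -0#≈0#) (+-identityʳ x))

    polys : Fin (q ℕ.^ d) → k[t].Poly
    polys i = tabulate (λ j → Inverse.to enumeration (finToFun {q} {d} i j))

    values : Fin (q ℕ.^ d) → Carrier
    values i = eval (mapₚ (polys i)) β

    values-root : ∀ i → Root T (values i)
    values-root i = T-root (values i) (trans (iterate-eval (polys i) β n)
      (eval-cong (mapₚ (polys i)) (mapₚ (polys i)) ≋-refl closes))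

    -- The difference of two such polynomials vanishes at `β`, hence is a multiple of `g` of degree
    -- less than that of `g`, hence zero. The base-q digits of the two indices then agree.
    values-injective : ∀ {i j} → values i ≈ values j → i ≡ j
    values-injective {i} {j} eq = ≡.trans (≡.sym (Fin.funToFin-finToFin {d} {q} i))
      (≡.trans (funToFin-cong (finToFun {q} {d} i) (finToFun j) digits) (Fin.funToFin-finToFin {d} {q} j))
      where
      u : k[t].Poly
      u = polys i k[t].+ₚ k[t].-ₚ polys j

      uβ≈0 : u RootAt β
      uβ≈0 = rootAt-difference (polys i) (polys j) eq

      u≋[] : u k[t].≋ []
      u≋[] = ∣-Below⇒≋[] g° (irreducible-∣ {g} {d} {u} irr g° gβ≈0 uβ≈0)
        (k[t].Below-+ (polys i) (k[t].-ₚ polys j) (Below-tabulate _)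
          (k[t].Below-neg (polys j) (Below-tabulate _)))

      digits : ∀ l → finToFun {q} {d} i l ≡ finToFun j l
      digits l = ≡.trans (≡.sym (Inverse.strictlyInverseʳ enumeration _))
        (≡.trans (Inverse.from-cong enumeration (𝔽q.trans (𝔽q.sym (coeff-tabulate _ l))
          (𝔽q.trans (k[t].≋[]-difference (polys i) (polys j) u≋[] (toℕ l)) (coeff-tabulate _ l))))
          (Inverse.strictlyInverseʳ enumeration _))

  module Orbit {g d β} (irr : k[t].Irreducible g) (g° : k[t].Degree g d) (gβ≈0 : g RootAt β) where

    -- Injectivity of Frobenius cancels `i` steps and leaves the period `j ∸ i`, which is smaller
    -- than `d`.
    no-short-cycle : ∀ {i j} → i < j → j < d → ¬ (iterate F β i ≈ iterate F β j)
    no-short-cycle {i} {j} i<j j<d eq = ℕ.<⇒≱ j<d (ℕ.≤-trans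
      (period≥degree irr g° gβ≈0 (ℕ.m<n⇒0<n∸m i<j) (iterate-injective i (begin
        iterate F (iterate F β (j ∸ i)) i  ≡⟨ iterate-+ F β (j ∸ i) i ⟨
        iterate F β (j ∸ i ℕ.+ i)          ≡⟨ ≡.cong (iterate F β) (ℕ.m∸n+n≡m (ℕ.<⇒≤ i<j)) ⟩
        iterate F β j                      ≈⟨ eq ⟨
        iterate F β i                      ∎)))
      (ℕ.m∸n≤m j i))

    orbit-injective : ∀ {i j} → i < d → j < d → iterate F β i ≈ iterate F β j → i ≡ j
    orbit-injective {i} {j} i<d j<d eq with ℕ.<-cmp i j
    ... | tri≈ _ i≡j _ = i≡j
    ... | tri< i<j _ _ = ⊥-elim (no-short-cycle i<j j<d eq)
    ... | tri> _ _ j<i = ⊥-elim (no-short-cycle j<i i<d (sym eq))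

    -- A root outside the orbit, together with the `d` distinct members of the orbit, would exceed
    -- the degree.
    orbit-complete : ∀ {γ} → g RootAt γ → ∃[ e ] γ ≈ iterate F β (toℕ {d} e)
    orbit-complete {γ} gγ≈0 with em {P = ∃[ e ] γ ≈ iterate F β (toℕ {d} e)}
    ... | yes γ∈ = γ∈
    ... | no  γ∉ = ⊥-elim (ℕ.n≮n d (roots≤degree {suc d} (map-degree g°) ρ ρ-injective ρ-root))
      where
      ρ : Fin (suc d) → Carrier
      ρ zero    = γ
      ρ (suc e) = iterate F β (toℕ e)

      ρ-root : ∀ i → g RootAt ρ i
      ρ-root zero    = gγ≈0
      ρ-root (suc e) = iterate-root {g} (toℕ e) gβ≈0

      ρ-injective : ∀ {i j} → ρ i ≈ ρ j → i ≡ j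
      ρ-injective {zero}  {zero}  eq = ≡.refl
      ρ-injective {zero}  {suc j} eq = ⊥-elim (γ∉ (j , eq))
      ρ-injective {suc i} {zero}  eq = ⊥-elim (γ∉ (i , sym eq))
      ρ-injective {suc i} {suc j} eq =
        ≡.cong suc (Fin.toℕ-injective (orbit-injective (Fin.toℕ<n i) (Fin.toℕ<n j) eq))

    -- The `d`-th iterate is a root of `g`, so it equals some earlier iterate. If that were not `β`
    -- itself, cancelling the common steps would give a positive period below `d`.
    orbit-closes : iterate F β d ≈ β
    orbit-closes with orbit-complete (iterate-root {g} d gβ≈0)
    ... | e , eq with toℕ e in toℕe≡
    ...   | zero  = eq
    ...   | suc i = ⊥-elim (ℕ.<⇒≱ (ℕ.∸-monoʳ-< (s≤s z≤n) 1+i≤d)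
      (period≥degree irr g° gβ≈0 (ℕ.m<n⇒0<n∸m 1+i<d) (iterate-injective (suc i) (begin
        iterate F (iterate F β (d ∸ suc i)) (suc i)  ≡⟨ iterate-+ F β (d ∸ suc i) (suc i) ⟨
        iterate F β (d ∸ suc i ℕ.+ suc i)            ≡⟨ ≡.cong (iterate F β) (ℕ.m∸n+n≡m 1+i≤d) ⟩
        iterate F β d                                ≈⟨ eq ⟩
        iterate F β (suc i)                          ∎))))
      where
      1+i<d : suc i < d
      1+i<d = ≡.subst (_< d) toℕe≡ (Fin.toℕ<n e)
      1+i≤d : suc i ≤ d
      1+i≤d = ℕ.<⇒≤ 1+i<d

-- Positions in lists

module _ {a r} {A : Set a} {R : A → A → Set r} where

  allPairs-lookup : ∀ {xs} → Symmetric R → AllPairs R xs → ∀ {i j} → i ≢ j → R (lookup xs i) (lookup xs j)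
  allPairs-lookup R-sym (x# ∷ xs#) {zero}  {zero}  i≢j = ⊥-elim (i≢j ≡.refl)
  allPairs-lookup R-sym (x# ∷ xs#) {zero}  {suc j} i≢j = All.lookup x# (∈-lookup j)
  allPairs-lookup R-sym (x# ∷ xs#) {suc i} {zero}  i≢j = R-sym (All.lookup x# (∈-lookup i))
  allPairs-lookup R-sym (x# ∷ xs#) {suc i} {suc j} i≢j =
    allPairs-lookup R-sym xs# (λ i≡j → i≢j (≡.cong suc i≡j))

module _ (S : Setoid ℓ ℓ) {_~_ : Setoid.Carrier S → Setoid.Carrier S → Set ℓ} (~-isEquivalence : IsEquivalence _~_)
         (≈⇒~ : ∀ {x y} → Setoid._≈_ S x y → x ~ y) where
  open Setoid S
  private module ~ = IsEquivalence ~-isEquivalence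

  -- Applied with `~` congruence modulo `M`: once the listed roots are pairwise incongruent,
  -- reduction is injective on them.
  unique-members-~⇒≈ : ∀ {us x y} → AllPairs (λ u v → ¬ (u ~ v)) us →
                       Any (x ≈_) us → Any (y ≈_) us → x ~ y → x ≈ y
  unique-members-~⇒≈ {us} unique x∈ y∈ x~y
    with Any.index x∈ Fin.≟ Any.index y∈ | Anyₚ.lookup-index x∈ | Anyₚ.lookup-index y∈
  ... | yes i≡j | x≈ | y≈ = trans x≈ (trans (reflexive (≡.cong (lookup us) i≡j)) (sym y≈))
  ... | no  i≢j | x≈ | y≈ = ⊥-elim (allPairs-lookup (λ u≁v v~u → u≁v (~.sym v~u)) unique i≢j
    (~.trans (~.sym (≈⇒~ x≈)) (~.trans x~y (≈⇒~ y≈))))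

module _ {a b r} {A : Set a} {B : Set b} {R : A → B → Set r} where

  -- The equality of the two lengths is only implicit in the relation. This is the resulting
  -- identification of positions, used to number factors by their degrees.
  index : ∀ {xs ys} → Pointwise R xs ys → Fin (length ys) → Fin (length xs)
  index (_ ∷ _)  zero    = zero
  index (_ ∷ rs) (suc j) = suc (index rs j)

  index-related : ∀ {xs ys} (rs : Pointwise R xs ys) j → R (lookup xs (index rs j)) (lookup ys j)
  index-related (r ∷ _)  zero    = r
  index-related (_ ∷ rs) (suc j) = index-related rs j

  index-injective : ∀ {xs ys} (rs : Pointwise R xs ys) {i j} → index rs i ≡ index rs j → i ≡ j
  index-injective (_ ∷ _)  {zero}  {zero}  eq = ≡.refl
  index-injective (_ ∷ rs) {suc i} {suc j} eq = ≡.cong suc (index-injective rs (Fin.suc-injective eq))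

  index-surjective : ∀ {xs ys} (rs : Pointwise R xs ys) i → ∃[ j ] index rs j ≡ i
  index-surjective (_ ∷ _)  zero    = zero , ≡.refl
  index-surjective (_ ∷ rs) (suc i) with index-surjective rs i
  ... | j , ≡.refl = suc j , ≡.refl

  pointwise-tabulate : ∀ ys (f : Fin (length ys) → A) → (∀ j → R (f j) (lookup ys j)) → Pointwise R (tabulate f) ys
  pointwise-tabulate []       f fR = []
  pointwise-tabulate (y ∷ ys) f fR = fR zero ∷ pointwise-tabulate ys (λ j → f (suc j)) (λ j → fR (suc j))

-- Splitting type and cycle type in a domain where the polynomial splits

module SplittingTypes (em : ExcludedMiddle ℓ) (𝔽q : FiniteField ℓ)
                      (E : CommutativeRing ℓ ℓ) (isDomain : IsDomain (CommutativeRing.rawRing E))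
                      (φ : RingHomomorphism (FiniteField.rawRing 𝔽q) (CommutativeRing.rawRing E)) where
  private
    module 𝔽q = FiniteField 𝔽q
  open 𝔽q using (q)
  open CommutativeRing E hiding (zero)
  open FrobeniusOrbits em 𝔽q E isDomain φ public

  Rootsₛ : k[t].Poly → Setoid ℓ ℓ
  Rootsₛ = Roots 𝔽q.ring E φ

  frobenius : ∀ p → Setoid.Carrier (Rootsₛ p) → Setoid.Carrier (Rootsₛ p)
  frobenius p (x , px≈0) = F x , vanishes (F-root {p} (root px≈0))

  iterate-frobenius : ∀ p n x → proj₁ (iterate (frobenius p) x n) ≡ iterate F (proj₁ x) n
  iterate-frobenius p zero    x = ≡.refl
  iterate-frobenius p (suc n) x = iterate-frobenius p n (frobenius p x)

  rootAt-∏ : ∀ gs i {x} → lookup gs i RootAt x → k[t].∏ₚ gs RootAt x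
  rootAt-∏ (g ∷ gs) zero    gx≈0 =
    root-resp (≋-sym (map-* g (k[t].∏ₚ gs))) (root-*ʳ {mapₚ g} (mapₚ (k[t].∏ₚ gs)) gx≈0)
  rootAt-∏ (g ∷ gs) (suc i) gx≈0 =
    root-resp (≋-sym (map-* g (k[t].∏ₚ gs))) (root-*ˡ (mapₚ g) (rootAt-∏ gs i gx≈0))

  ∏-rootAt : ∀ gs {x} → k[t].∏ₚ gs RootAt x → ∃[ i ] lookup gs i RootAt x
  ∏-rootAt []       eq = ⊥-elim (¬root-1 (root-resp map-1 eq))
  ∏-rootAt (g ∷ gs) eq with root-* (mapₚ g) (mapₚ (k[t].∏ₚ gs)) (root-resp (map-* g (k[t].∏ₚ gs)) eq)
  ... | inj₁ gx≈0 = zero , gx≈0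
  ... | inj₂ eq′ with ∏-rootAt gs eq′
  ...   | i , gx≈0 = suc i , gx≈0

  ∏-cofactor : ∀ gs i → ∃[ h ] k[t].∏ₚ gs k[t].≋ lookup gs i k[t].*ₚ h
  ∏-cofactor (g ∷ gs) zero    = k[t].∏ₚ gs , k[t].≋-refl
  ∏-cofactor (g ∷ gs) (suc i) with ∏-cofactor gs i
  ... | h , eq = g k[t].*ₚ h ,
    k[t].≋-trans (k[t].*ₚ-congˡ g eq) (k[t].*ₚ-exchange g (lookup gs i) h)

  -- It involves only polynomials over `𝔽q`, so it can be proved in one extension domain and used in
  -- another.
  NonDividing : List k[t].Poly → Set ℓ
  NonDividing = AllPairs (λ g h → ¬ (g k[t].∣ h))

  DisjointIn : k[t].Poly → k[t].Poly → Set ℓ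
  DisjointIn g h = ∀ x → g RootAt x → ¬ (h RootAt x)

  disjoint⇒nonDividing : ∀ {gs} → All (λ g → ∃ (g RootAt_)) gs → AllPairs DisjointIn gs → NonDividing gs
  disjoint⇒nonDividing []                 []         = []
  disjoint⇒nonDividing ((x , gx≈0) ∷ rs) (g# ∷ gs#) =
    All.map (λ g#h g∣h → g#h x gx≈0 (rootAt-∣ g∣h gx≈0)) g# ∷ disjoint⇒nonDividing rs gs#

  nonDividing⇒disjoint : ∀ {gs ds} → Pointwise k[t].IrreducibleOfDegree gs ds →
                         NonDividing gs → AllPairs DisjointIn gs
  nonDividing⇒disjoint []                       []         = []
  nonDividing⇒disjoint ((irr , top , below) ∷ irrs) (g∤ ∷ gs∤) =
    All.map (λ {h} g∤h x gx hx → g∤h (irreducible-∣ {h = h} irr (k[t].degree top below) gx hx)) g∤ ∷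
    nonDividing⇒disjoint irrs gs∤

  module Split (p : k[t].Poly) {rs} (splits : mapₚ p ≋ ∏linear rs) where

    -- The coefficients are read off from the linear factors and pulled back along the injective
    -- `φ`, instead of being traced through the specialization of `f`.
    split-monic : k[t].Monic p
    split-monic = length rs ,
      φ-injective (trans (sym (coeff-map p (length rs))) (trans (at splits (length rs))
        (trans (proj₁ (leading-∏linear rs)) (sym (RingHomomorphism.1#-homo φ))))) ,
      λ m l<m → φ-injective₀ (trans (sym (coeff-map p m))
        (trans (at splits m) (proj₂ (leading-∏linear rs) m l<m)))

    member : Setoid.Carrier (Rootsₛ p) → ∃ λ u → u ∈ₗ rs
    member (y , py≈0) with root-∏linear rs (root-resp splits (root py≈0))
    ... | y∈ = lookup rs (Any.index y∈) , ∈-lookup (Any.index y∈)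

    member-≈ : ∀ y → proj₁ y ≈ proj₁ (member y)
    member-≈ (y , py≈0) = Anyₚ.lookup-index (root-∏linear rs (root-resp splits (root py≈0)))

    member-root : ∀ {x} → Any (x ≈_) rs → p RootAt x
    member-root x∈ = root-resp (≋-sym splits) (∏linear-root rs x∈)

    module _ {gs ds} (p≋∏gs : p k[t].≋ k[t].∏ₚ gs) (irrs : Pointwise k[t].IrreducibleOfDegree gs ds) where

      factor : Fin (length ds) → k[t].Poly
      factor j = lookup gs (index irrs j)

      factor-irreducible : ∀ j → k[t].Irreducible (factor j)
      factor-irreducible j = proj₁ (index-related irrs j)

      factor-degree : ∀ j → k[t].Degree (factor j) (lookup ds j)
      factor-degree j with index-related irrs j
      ... | _ , top , below = k[t].degree top below

      degree>0 : ∀ j → 0 < lookup ds j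
      degree>0 j = k[t].irreducible-degree (factor-irreducible j) (factor-degree j)

      factor-root : ∀ j → ∃ (factor j RootAt_)
      factor-root j with lookup ds j in d≡ | degree>0 j | ∏-cofactor gs (index irrs j)
      ... | suc d | _ | h , eq = ∏linear-factor-root rs (mapₚ (factor j)) (mapₚ h)
        (map-degree (≡.subst (k[t].Degree (factor j)) d≡ (factor-degree j)))
        (≋-trans (≋-sym splits) (≋-trans (map-≋ (k[t].≋-trans p≋∏gs eq)) (map-* (factor j) h)))

      factor-root⇒root : ∀ j {x} → factor j RootAt x → p RootAt x
      factor-root⇒root j gx≈0 = rootAt-resp (k[t].≋-sym p≋∏gs) (rootAt-∏ gs (index irrs j) gx≈0)

      root⇒factor-root : ∀ {x} → p RootAt x → ∃[ j ] factor j RootAt x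
      root⇒factor-root px≈0 with ∏-rootAt gs (rootAt-resp p≋∏gs px≈0)
      ... | i , gx≈0 with index-surjective irrs i
      ...   | j , ≡.refl = j , gx≈0

      mapped-product : mapₚ p ≋ ∏ₚ (map mapₚ gs)
      mapped-product = ≋-trans (map-≋ p≋∏gs) (map-∏ gs)

      -- Every factor has a root, since `p` splits. A factor dividing a later one would share that
      -- root with it, and the shared root would be a double root of `p`.
      unique⇒nonDividing : Unique.Unique setoid rs → NonDividing gs
      unique⇒nonDividing unique = disjoint⇒nonDividing
        (All.tabulate λ g∈gs → ≡.subst (λ g → ∃ (g RootAt_)) (≡.sym (Anyₚ.lookup-index g∈gs))
          (roots (Any.index g∈gs)))
        (AllPairsₚ.map⁻ (simple⇒disjoint (map mapₚ gs) λ x double → unique⇒simple rs unique x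
          (double-resp (≋-trans (≋-sym mapped-product) splits) double)))
        where
        roots : ∀ i → ∃ (lookup gs i RootAt_)
        roots i with index-surjective irrs i
        ... | j , ≡.refl = factor-root j

      -- Every conjugate of `x` would be a root of the cofactor: `x` itself by assumption, the
      -- others because they are not roots of t - x. That is d distinct roots in degree d - 1.
      irreducible-simple : ∀ j {x} → ¬ DoubleRoot (mapₚ (factor j)) x
      irreducible-simple j {x} d@(doubleRoot {s} eq sx≈0)
        with degree-linear-cofactor {x} {s} (degree-resp eq (map-degree (factor-degree j)))
      ... | l , s° , 1+l≡d = ℕ.<⇒≱ (ℕ.≤-reflexive 1+l≡d)
        (roots≤degree s° (λ e → iterate F x (toℕ e))
          (λ {e} {e′} eq → Fin.toℕ-injective (orbit-injective (Fin.toℕ<n e) (Fin.toℕ<n e′) eq)) s-root)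
        where
        open Orbit (factor-irreducible j) (factor-degree j) (double⇒root d)
        s-root : ∀ e → Root s (iterate F x (toℕ {lookup ds j} e))
        s-root e with root-* (linear x) s
          (root-resp eq (iterate-root {factor j} (toℕ e) (double⇒root d)))
        ... | inj₂ s-root = s-root
        ... | inj₁ x-root = root-≈ {s} (sym (root-linear⁻ x-root)) sx≈0

      module _ (gs∤ : NonDividing gs) where

        -- A double root of `p` would be double in one irreducible factor, or common to two factors,
        -- the earlier of which would then divide the later.
        nonDividing⇒unique : Unique.Unique setoid rs
        nonDividing⇒unique = simple⇒unique rs λ x double → clash
          (double-∏ (map mapₚ gs) (AllPairsₚ.map⁺ (nonDividing⇒disjoint irrs gs∤))
            (double-resp (≋-trans (≋-sym splits) mapped-product) double))
          where
          clash : ∀ {x} → ¬ Any (λ g → DoubleRoot g x) (map mapₚ gs)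
          clash any with Anyₚ.map⁻ any
          ... | any′ with index-surjective irrs (Any.index any′) | Anyₚ.lookup-index any′
          ...   | j , eq | double = irreducible-simple j
            (≡.subst (λ i → DoubleRoot (mapₚ (lookup gs i)) _) (≡.sym eq) double)

        factor-unique : ∀ {i j x} → factor i RootAt x → factor j RootAt x → i ≡ j
        factor-unique {i} {j} gx≈0 hx≈0 with i Fin.≟ j
        ... | yes i≡j = i≡j
        ... | no  i≢j = ⊥-elim (allPairs-lookup (λ g#h x hx gx → g#h x gx hx)
          (nonDividing⇒disjoint irrs gs∤) (λ eq → i≢j (index-injective irrs eq)) _ gx≈0 hx≈0)

        module FactorOrbit (j : Fin (length ds)) where
          β : Carrier
          β = proj₁ (factor-root j)
          β-root : factor j RootAt β
          β-root = proj₂ (factor-root j)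
          open Orbit (factor-irreducible j) (factor-degree j) β-root public

        start : Fin (length ds) → Setoid.Carrier (Rootsₛ p)
        start j = FactorOrbit.β j , vanishes (factor-root⇒root j (FactorOrbit.β-root j))

        splitting⇒cycle : HasCycleType (Rootsₛ p) (frobenius p) ds
        splitting⇒cycle = record
          { positive  = All.tabulate λ d∈ds →
              ≡.subst (0 <_) (≡.sym (Anyₚ.lookup-index d∈ds)) (degree>0 (Any.index d∈ds))
          ; start     = start
          ; closes    = λ j → trans (reflexive (iterate-frobenius p (lookup ds j) (start j)))
                                    (FactorOrbit.orbit-closes j)
          ; partition = injective , surjective
          }
          where
          element : Σ[ j ∈ Fin (length ds) ] Fin (lookup ds j) → Carrier
          element (j , e) = proj₁ (iterate (frobenius p) (start j) (toℕ e))

          element-iterate : ∀ j e → element (j , e) ≡ iterate F (FactorOrbit.β j) (toℕ e)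
          element-iterate j e = iterate-frobenius p (toℕ e) (start j)

          element-root : ∀ j e → factor j RootAt element (j , e)
          element-root j e = ≡.subst (factor j RootAt_) (≡.sym (element-iterate j e))
            (iterate-root {factor j} (toℕ e) (FactorOrbit.β-root j))

          injective : ∀ {s t} → element s ≈ element t → s ≡ t
          injective {i , e} {j , e′} eq
            with factor-unique (element-root i e) (root-≈ {mapₚ (factor j)} (sym eq) (element-root j e′))
          ... | ≡.refl = ≡.cong (i ,_) (Fin.toℕ-injective
            (FactorOrbit.orbit-injective i (Fin.toℕ<n e) (Fin.toℕ<n e′)
              (trans (reflexive (≡.sym (element-iterate i e))) (trans eq (reflexive (element-iterate i e′))))))

          surjective : ∀ y → ∃[ s ] ∀ {t} → t ≡ s → element t ≈ proj₁ y
          surjective (x , px≈0) with root⇒factor-root (root px≈0)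
          ... | j , gx≈0 with FactorOrbit.orbit-complete j gx≈0
          ...   | e , eq = (j , e) , λ { ≡.refl → trans (reflexive (element-iterate j e)) (sym eq) }

        module FromCycle {es} (cycle : HasCycleType (Rootsₛ p) (frobenius p) es) where
          private module C = HasCycleType cycle

          β : Fin (length es) → Carrier
          β j = proj₁ (C.start j)

          -- The factor to which the start of the j-th cycle belongs. It is shown to be a
          -- degree-preserving bijection, so that a given cycle type reindexes a known
          -- factorization; `es` may list the degrees in another order than `ds`.
          κ : Fin (length es) → Fin (length ds)
          κ j = proj₁ (root⇒factor-root (root (proj₂ (C.start j))))

          β-root : ∀ j → factor (κ j) RootAt β j
          β-root j = proj₂ (root⇒factor-root (root (proj₂ (C.start j))))

          module βOrbit (j : Fin (length es)) =
            Orbit (factor-irreducible (κ j)) (factor-degree (κ j)) (β-root j)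

          positive : ∀ j → 0 < lookup es j
          positive j = All.lookup C.positive (∈-lookup j)

          iterates-distinct : ∀ {i j m n} → m < lookup es i → n < lookup es j →
                              iterate F (β i) m ≈ iterate F (β j) n → i ≡ j × m ≡ n
          iterates-distinct {i} {j} {m} {n} m< n< eq = ≡.cong proj₁ same ,
            ≡.trans (≡.sym (Fin.toℕ-fromℕ< m<)) (≡.trans (≡.cong (λ s → toℕ (proj₂ s)) same) (Fin.toℕ-fromℕ< n<))
            where
            iterate-fromℕ< : ∀ i {m} (m< : m < lookup es i) →
              proj₁ (iterate (frobenius p) (C.start i) (toℕ (fromℕ< m<))) ≡ iterate F (β i) m
            iterate-fromℕ< i m< = ≡.trans (iterate-frobenius p (toℕ (fromℕ< m<)) (C.start i))
              (≡.cong (iterate F (β i)) (Fin.toℕ-fromℕ< m<))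
            same : (i , fromℕ< m<) ≡ (j , fromℕ< n<)
            same = proj₁ C.partition (trans (reflexive (iterate-fromℕ< i m<))
              (trans eq (reflexive (≡.sym (iterate-fromℕ< j n<)))))

          -- The degree is at most the cycle length because the cycle is a period. Conversely the
          -- members of the cycle are distinct roots of the factor.
          κ-degree : ∀ j → lookup ds (κ j) ≡ lookup es j
          κ-degree j = ℕ.≤-antisym
            (period≥degree (factor-irreducible (κ j)) (factor-degree (κ j)) (β-root j) (positive j)
              (trans (reflexive (≡.sym (iterate-frobenius p (lookup es j) (C.start j)))) (C.closes j)))
            (roots≤degree (map-degree (factor-degree (κ j))) (λ e → iterate F (β j) (toℕ {lookup es j} e))
              (λ {e} {e′} eq → Fin.toℕ-injective (proj₂ (iterates-distinct (Fin.toℕ<n e) (Fin.toℕ<n e′) eq)))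
              (λ e → iterate-root {factor (κ j)} (toℕ e) (β-root j)))

          -- All roots of one factor form a single orbit, so the start of cycle `i`, taken as its
          -- zeroth iterate, lies on cycle `j`. Distinct cycles are disjoint.
          κ-injective : ∀ {i j} → κ i ≡ κ j → i ≡ j
          κ-injective {i} {j} κi≡κj
            with βOrbit.orbit-complete j (≡.subst (λ l → factor l RootAt β i) κi≡κj (β-root i))
          ... | e , eq = proj₁ (iterates-distinct {i} {j} {0} (positive i)
            (≡.subst (toℕ e <_) (κ-degree j) (Fin.toℕ<n e)) eq)

          κ-surjective : ∀ i → ∃[ j ] κ j ≡ i
          κ-surjective i with factor-root i
          ... | γ , γ-root with proj₂ C.partition (γ , vanishes (factor-root⇒root i γ-root))
          ...   | (j , e) , eq = j , factor-unique (iterate-root {factor (κ j)} (toℕ e) (β-root j))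
            (root-≈ {mapₚ (factor i)}
              (sym (trans (reflexive (≡.sym (iterate-frobenius p (toℕ e) (C.start j)))) (eq ≡.refl))) γ-root)

          private
            module ∏ = Algebra.Properties.CommutativeMonoid.Sum
              (CommutativeRing.*-commutativeMonoid k[t].polynomialRing)

            ∏-lookup : ∀ hs → k[t].∏ₚ hs ≡ ∏.sum (lookup hs)
            ∏-lookup []       = ≡.refl
            ∏-lookup (h ∷ hs) = ≡.cong (h k[t].*ₚ_) (∏-lookup hs)

            ∏-tabulate : ∀ {n} (f : Fin n → k[t].Poly) → k[t].∏ₚ (tabulate f) ≡ ∏.sum f
            ∏-tabulate {zero}  f = ≡.refl
            ∏-tabulate {suc n} f = ≡.cong (f zero k[t].*ₚ_) (∏-tabulate (λ i → f (suc i)))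

            π-inverse : ∀ i → ∃[ j ] index irrs (κ j) ≡ i
            π-inverse i with index-surjective irrs i
            ... | l , ≡.refl with κ-surjective l
            ...   | j , ≡.refl = j , ≡.refl

            π : Permutation (length es) (length gs)
            π = permutation (λ j → index irrs (κ j)) (λ i → proj₁ (π-inverse i)) (λ i → proj₂ (π-inverse i))
              (λ j → κ-injective (index-injective irrs (proj₂ (π-inverse (index irrs (κ j))))))

          cycle⇒splitting : k[t].HasSplittingType p es
          cycle⇒splitting = tabulate (λ j → factor (κ j)) ,
            k[t].at (k[t].≋-trans p≋∏gs (k[t].≋-trans (k[t].R[t].reflexive (∏-lookup gs))
              (k[t].≋-trans (∏.sum-permute (lookup gs) π)
                (k[t].R[t].reflexive (≡.sym (∏-tabulate (λ j → factor (κ j)))))))) ,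
            pointwise-tabulate es (λ j → factor (κ j)) (λ j →
              ≡.subst (k[t].IrreducibleOfDegree (factor (κ j))) (κ-degree j) (index-related irrs (κ j)))

-- Permutations with the same cycle type

iterate-suc : ∀ {a} {A : Set a} (f : A → A) x n → iterate f x (suc n) ≡ f (iterate f x n)
iterate-suc f x zero    = ≡.refl
iterate-suc f x (suc n) = iterate-suc f (f x) n

record Action (ℓ : Level) : Set (Level.suc ℓ) where
  field
    setoid : Setoid ℓ ℓ
  open Setoid setoid public
  field
    π      : Carrier → Carrier
    π-cong : ∀ {x y} → x ≈ y → π x ≈ π y

  iterate-cong : ∀ n {x y} → x ≈ y → iterate π x n ≈ iterate π y n
  iterate-cong zero    x≈y = x≈y
  iterate-cong (suc n) x≈y = iterate-cong n (π-cong x≈y)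

module _ (S T : Action ℓ) where
  private
    module S = Action S
    module T = Action T

  record _≅_ : Set ℓ where
    field
      bijection   : Bijection S.setoid T.setoid
      equivariant : ∀ x → Bijection.to bijection (S.π x) T.≈ T.π (Bijection.to bijection x)
    open Bijection bijection public using (to; cong; injective; surjective)

    to-iterate : ∀ n x → to (iterate S.π x n) T.≈ iterate T.π (to x) n
    to-iterate zero    x = T.refl
    to-iterate (suc n) x = T.trans (to-iterate n (S.π x)) (T.iterate-cong n (equivariant x))

    from : T.Carrier → S.Carrier
    from y = proj₁ (surjective y)

    to-from : ∀ y → to (from y) T.≈ y
    to-from y = proj₂ (surjective y) S.refl

open _≅_ public using (bijection; equivariant)

≅-sym : {S T : Action ℓ} → S ≅ T → T ≅ S
≅-sym {S = S} {T} S≅T = record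
  { bijection = record
    { to        = from
    ; cong      = λ {x} {y} x≈y → injective (T.trans (to-from x) (T.trans x≈y (T.sym (to-from y))))
    ; bijective =
      (λ {x} {y} eq → T.trans (T.sym (to-from x)) (T.trans (cong eq) (to-from y))) ,
      λ x → to x , λ {y} y≈ → injective (T.trans (to-from y) y≈)
    }
  ; equivariant = λ y → injective (T.trans (to-from (T.π y))
      (T.trans (T.π-cong (T.sym (to-from y))) (T.sym (equivariant-S (from y)))))
  }
  where
  module S = Action S
  module T = Action T
  open _≅_ S≅T renaming (equivariant to equivariant-S)

≅-trans : {S T U : Action ℓ} → S ≅ T → T ≅ U → S ≅ U
≅-trans {S = S} {T} {U} S≅T T≅U = record
  { bijection   = Composition.bijection (bijection S≅T) (bijection T≅U)
  ; equivariant = λ x → Action.trans U (_≅_.cong T≅U (equivariant S≅T x)) (equivariant T≅U _)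
  }

transport-cycleType : {S T : Action ℓ} → S ≅ T → ∀ {ds} →
  HasCycleType (Action.setoid S) (Action.π S) ds → HasCycleType (Action.setoid T) (Action.π T) ds
transport-cycleType {S = S} {T} S≅T {ds} cycle = record
  { positive  = C.positive
  ; start     = λ j → to (C.start j)
  ; closes    = λ j → T.trans (T.sym (to-iterate (lookup ds j) (C.start j))) (cong (C.closes j))
  ; partition =
    (λ {(i , e)} {(j , e′)} eq → proj₁ C.partition (injective
      (T.trans (to-iterate (toℕ e) (C.start i)) (T.trans eq (T.sym (to-iterate (toℕ e′) (C.start j))))))) ,
    λ y → proj₁ (proj₂ C.partition (from y)) , λ { {j , e} eq →
      T.trans (T.sym (to-iterate (toℕ e) (C.start j))) (T.trans (cong (proj₂ (proj₂ C.partition (from y)) eq)) (to-from y)) }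
  }
  where
  module S = Action S
  module T = Action T
  module C = HasCycleType cycle
  open _≅_ S≅T

module _ {S T : Action ℓ} {ds : List ℕ}
         (cycleS : HasCycleType (Action.setoid S) (Action.π S) ds)
         (cycleT : HasCycleType (Action.setoid T) (Action.π T) ds) where
  private
    module S = Action S
    module T = Action T
    module CS = HasCycleType cycleS
    module CT = HasCycleType cycleT

    Index : Set
    Index = Σ[ j ∈ Fin (length ds) ] Fin (lookup ds j)

    elementS : Index → S.Carrier
    elementS (j , e) = iterate S.π (CS.start j) (toℕ e)

    elementT : Index → T.Carrier
    elementT (j , e) = iterate T.π (CT.start j) (toℕ e)

    indexS : S.Carrier → Index
    indexS x = proj₁ (proj₂ CS.partition x)

    elementS-index : ∀ x → elementS (indexS x) S.≈ x
    elementS-index x = proj₂ (proj₂ CS.partition x) ≡.refl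

    indexT : T.Carrier → Index
    indexT y = proj₁ (proj₂ CT.partition y)

    elementT-index : ∀ y → elementT (indexT y) T.≈ y
    elementT-index y = proj₂ (proj₂ CT.partition y) ≡.refl

    to : S.Carrier → T.Carrier
    to x = elementT (indexS x)

    to-element : ∀ {x} s → x S.≈ elementS s → to x T.≈ elementT s
    to-element {x} s x≈ = T.reflexive (≡.cong elementT (proj₁ CS.partition {indexS x} {s} (S.trans (elementS-index x) x≈)))

    to-< : ∀ {x} j {n} → n < lookup ds j → x S.≈ iterate S.π (CS.start j) n → to x T.≈ iterate T.π (CT.start j) n
    to-< {x} j {n} n<d x≈ = T.trans
      (to-element (j , fromℕ< n<d)
        (S.trans x≈ (S.reflexive (≡.cong (iterate S.π (CS.start j)) (≡.sym (Fin.toℕ-fromℕ< n<d))))))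
      (T.reflexive (≡.cong (iterate T.π (CT.start j)) (Fin.toℕ-fromℕ< n<d)))

    -- The bound includes the cycle length itself, since one step from the last position wraps
    -- around to the start. Equivariance needs that case.
    to-≤ : ∀ {x} j {n} → n ≤ lookup ds j → x S.≈ iterate S.π (CS.start j) n → to x T.≈ iterate T.π (CT.start j) n
    to-≤ {x} j n≤d x≈ with ℕ.m≤n⇒m<n∨m≡n n≤d
    ... | inj₁ n<d    = to-< j n<d x≈
    ... | inj₂ ≡.refl = T.trans (to-< j (All.lookup CS.positive (∈-lookup j)) (S.trans x≈ (CS.closes j)))
                                (T.sym (CT.closes j))

  sameCycleType⇒≅ : S ≅ T
  sameCycleType⇒≅ = record
    { bijection = record
      { to        = to
      ; cong      = λ {x} {y} x≈y → to-element (indexS y) (S.trans x≈y (S.sym (elementS-index y)))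
      ; bijective =
        (λ {x} {y} eq → S.trans (S.sym (elementS-index x))
          (S.trans (S.reflexive (≡.cong elementS (proj₁ CT.partition {indexS x} {indexS y} eq))) (elementS-index y))) ,
        λ y → elementS (indexT y) , λ x≈ → T.trans (to-element (indexT y) x≈) (elementT-index y)
      }
    ; equivariant = λ x → let (j , e) = indexS x in T.trans
        (to-≤ j (Fin.toℕ<n e) (S.trans (S.π-cong (S.sym (elementS-index x)))
          (S.reflexive (≡.sym (iterate-suc S.π (CS.start j) (toℕ e))))))
        (T.reflexive (iterate-suc T.π (CT.start j) (toℕ e)))
    }

≅-identity : {S : Setoid ℓ ℓ} (π ρ : Setoid.Carrier S → Setoid.Carrier S)
             (π-cong : ∀ {x y} → Setoid._≈_ S x y → Setoid._≈_ S (π x) (π y))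
             (ρ-cong : ∀ {x y} → Setoid._≈_ S x y → Setoid._≈_ S (ρ x) (ρ y)) →
             (∀ x → Setoid._≈_ S (π x) (ρ x)) →
             record { setoid = S ; π = π ; π-cong = π-cong } ≅ record { setoid = S ; π = ρ ; π-cong = ρ-cong }
≅-identity {S = S} π ρ _ _ π≈ρ = record { bijection = Identity.bijection S ; equivariant = π≈ρ }

Π-bijection : ∀ {m} {S T : Fin m → Setoid ℓ ℓ} → (∀ i → Bijection (S i) (T i)) → Bijection (Πₛ S) (Πₛ T)
Π-bijection φ = record
  { to        = λ x i → φ.to i (x i)
  ; cong      = λ x≈y i → φ.cong i (x≈y i)
  ; bijective = (λ eq i → φ.injective i (eq i)) ,
      λ y → (λ i → proj₁ (φ.surjective i (y i))) , λ x≈ i → proj₂ (φ.surjective i (y i)) (x≈ i)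
  }
  where module φ i = Bijection (φ i)

-- Integral elements

module Integrality (R B : CommutativeRing ℓ ℓ)
                   (ψ : RingHomomorphism (CommutativeRing.rawRing R) (CommutativeRing.rawRing B)) where
  private
    module R = CommutativeRing R
    module R[t] = PolynomialRing R
    module B[t] = PolynomialRing B
    module ψ = RingHomomorphism ψ
  open R[t] using (Poly; HasLeading; Below; _*ₚ_; _+ₚ_; -ₚ_)
  open B[t] using (eval; _^_)
  open PolynomialMap R B ψ
  open CommutativeRing B hiding (zero)
  open Algebra.Properties.Semiring.Sum semiring 
    using (sum; sum-cong-≋; sum-remove; ∑-distrib-+; *-distribˡ-sum; *-distribʳ-sum; sum-replicate-zero)
  open Algebra.Properties.Ring ring using (-‿distribˡ-*; -0#≈0#)
  open Relation.Binary.Reasoning.Setoid setoid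

  Integral : Carrier → Set ℓ
  Integral z = ∃[ p ] R[t].Monic p × eval (mapₚ p) z ≈ 0#

  evalₘ : Poly → Carrier → Carrier
  evalₘ p z = eval (mapₚ p) z

  evalₘ-* : ∀ p q z → evalₘ (p *ₚ q) z ≈ evalₘ p z * evalₘ q z
  evalₘ-* p q z = trans (B[t].eval-cong (mapₚ (p *ₚ q)) _ (map-* p q) refl) (B[t].eval-* (mapₚ p) (mapₚ q) z)

  evalₘ-+ : ∀ p q z → evalₘ (p +ₚ q) z ≈ evalₘ p z + evalₘ q z
  evalₘ-+ p q z = trans (B[t].eval-cong (mapₚ (p +ₚ q)) _ (map-+ p q) refl) (B[t].eval-+ (mapₚ p) (mapₚ q) z)

  evalₘ-neg : ∀ p z → evalₘ (-ₚ p) z ≈ - evalₘ p z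
  evalₘ-neg p z = trans (B[t].eval-cong (mapₚ (-ₚ p)) _ (map-neg p) refl) (B[t].eval-neg (mapₚ p) z)

  sum-zero : ∀ {n} (t : Fin n → Carrier) → (∀ i → t i ≈ 0#) → sum t ≈ 0#
  sum-zero {n} t t≈0 = trans (sum-cong-≋ t≈0) (sum-replicate-zero n)

  -- The degree pattern of t times the identity minus a constant matrix, where `k` is 1. Each
  -- elimination doubles `k`.
  record Dominant {n} (b : Fin n → Fin n → Poly) (k : ℕ) : Set ℓ where
    field
      diagonal    : ∀ i → HasLeading (b i i) k R.1#
      offDiagonal : ∀ {i j} → i ≢ j → Below (b i j) k

  Annihilates : ∀ {n} → Carrier → (Fin n → Fin n → Poly) → (Fin n → Carrier) → Set ℓ
  Annihilates z b e = ∀ i → sum (λ j → evalₘ (b i j) z * e j) ≈ 0#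

  -- Cross multiplication eliminates the unknown e 1 without division and keeps the
  -- matrix dominant, so the last remaining entry is a monic polynomial in z.
  eliminate : ∀ {n} → (Fin (suc (suc n)) → Fin (suc (suc n)) → Poly) → Fin (suc n) → Fin (suc n) → Poly
  eliminate b i j = b i′ j′ *ₚ b 1ᶠ 1ᶠ +ₚ -ₚ (b i′ 1ᶠ *ₚ b 1ᶠ j′)
    where
    1ᶠ = suc zero
    i′ = punchIn 1ᶠ i
    j′ = punchIn 1ᶠ j

  eliminate-dominant : ∀ {n} {b : Fin (suc (suc n)) → Fin (suc (suc n)) → Poly} {k} →
                       Dominant b k → Dominant (eliminate b) (k ℕ.+ k)
  eliminate-dominant {b = b} {k} dominant = record
    { diagonal = λ i → R[t].leading-Below (b (pivot i) (pivot i) *ₚ b 1ᶠ 1ᶠ) (b (pivot i) 1ᶠ *ₚ b 1ᶠ (pivot i)) (k ℕ.+ k)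
        (R[t].leading-* (b (pivot i) (pivot i)) (b 1ᶠ 1ᶠ) k k (diagonal (pivot i)) (diagonal 1ᶠ))
        (below (pivot i) (pivot i) (Fin.punchInᵢ≢i 1ᶠ i))
    ; offDiagonal = λ {i} {j} i≢j → R[t].Below-+ (b (pivot i) (pivot j) *ₚ b 1ᶠ 1ᶠ) (-ₚ (b (pivot i) 1ᶠ *ₚ b 1ᶠ (pivot j)))
        (R[t].Below-resp (R[t].*ₚ-comm (b 1ᶠ 1ᶠ) (b (pivot i) (pivot j)))
          (R[t].Below-* (b 1ᶠ 1ᶠ) (b (pivot i) (pivot j)) k k (proj₂ (diagonal 1ᶠ))
            (offDiagonal (λ eq → i≢j (Fin.punchIn-injective 1ᶠ i j eq)))))
        (R[t].Below-neg (b (pivot i) 1ᶠ *ₚ b 1ᶠ (pivot j)) (below (pivot i) (pivot j) (Fin.punchInᵢ≢i 1ᶠ j)))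
    }
    where
    open Dominant dominant
    1ᶠ = suc zero
    pivot = punchIn 1ᶠ
    below : ∀ i j → j ≢ 1ᶠ → Below (b i 1ᶠ *ₚ b 1ᶠ j) (k ℕ.+ k)
    below i j j≢1 = R[t].Below-* (b i 1ᶠ) (b 1ᶠ j) k k top (offDiagonal (λ 1≡j → j≢1 (≡.sym 1≡j)))
      where
      top : Below (b i 1ᶠ) (suc k)
      top with i Fin.≟ 1ᶠ
      ... | yes ≡.refl = proj₂ (diagonal 1ᶠ)
      ... | no  i≢1    = R[t].Below-weaken {b i 1ᶠ} (ℕ.n≤1+n k) (offDiagonal i≢1)

  eliminate-annihilates : ∀ {n z} {b : Fin (suc (suc n)) → Fin (suc (suc n)) → Poly} {e} →
    Annihilates z b e → Annihilates z (eliminate b) (λ j → e (punchIn (suc zero) j))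
  eliminate-annihilates {n} {z} {b} {e} kills i = begin
    sum (λ j → evalₘ (eliminate b i j) z * e′ j)                  ≈⟨ sum-cong-≋ expand ⟩
    sum (λ j → [1,1] * row i′ j + (- [i,1]) * row 1ᶠ j)
      ≈⟨ ∑-distrib-+ (λ j → [1,1] * row i′ j) (λ j → (- [i,1]) * row 1ᶠ j) ⟩
    sum (λ j → [1,1] * row i′ j) + sum (λ j → (- [i,1]) * row 1ᶠ j)
      ≈⟨ +-cong (*-distribˡ-sum [1,1] (row i′)) (*-distribˡ-sum (- [i,1]) (row 1ᶠ)) ⟨
    [1,1] * sum (row i′) + (- [i,1]) * sum (row 1ᶠ)
      ≈⟨ RingIdentities.cross-multiply B [1,1] [i,1] (e 1ᶠ) _ _ ⟩
    [1,1] * ([i,1] * e 1ᶠ + sum (row i′)) + (- [i,1]) * ([1,1] * e 1ᶠ + sum (row 1ᶠ))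
      ≈⟨ +-cong (*-congˡ (row-zero i′)) (*-congˡ (row-zero 1ᶠ)) ⟩
    [1,1] * 0# + (- [i,1]) * 0#
      ≈⟨ trans (+-cong (zeroʳ _) (zeroʳ _)) (+-identityˡ 0#) ⟩
    0#                                                            ∎
    where
    1ᶠ = suc zero
    i′ = punchIn 1ᶠ i
    e′ = λ j → e (punchIn 1ᶠ j)
    [1,1] = evalₘ (b 1ᶠ 1ᶠ) z
    [i,1] = evalₘ (b i′ 1ᶠ) z

    row : Fin (suc (suc n)) → Fin (suc n) → Carrier
    row l j = evalₘ (b l (punchIn 1ᶠ j)) z * e′ j

    row-zero : ∀ l → evalₘ (b l 1ᶠ) z * e 1ᶠ + sum (row l) ≈ 0#
    row-zero l = trans (sym (sum-remove {i = 1ᶠ} (λ j → evalₘ (b l j) z * e j))) (kills l)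

    expand : ∀ j → evalₘ (eliminate b i j) z * e′ j ≈ [1,1] * row i′ j + (- [i,1]) * row 1ᶠ j
    expand j = begin
      evalₘ (eliminate b i j) z * e′ j  ≈⟨ *-congʳ (trans (evalₘ-+ (b i′ j′ *ₚ b 1ᶠ 1ᶠ) (-ₚ (b i′ 1ᶠ *ₚ b 1ᶠ j′)) z)
        (+-cong (evalₘ-* (b i′ j′) (b 1ᶠ 1ᶠ) z)
          (trans (evalₘ-neg (b i′ 1ᶠ *ₚ b 1ᶠ j′) z) (-‿cong (evalₘ-* (b i′ 1ᶠ) (b 1ᶠ j′) z))))) ⟩
      (evalₘ (b i′ j′) z * [1,1] - [i,1] * evalₘ (b 1ᶠ j′) z) * e′ j  ≈⟨ RingIdentities.expand-minor B _ _ _ _ _ ⟩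
      [1,1] * row i′ j + (- [i,1]) * row 1ᶠ j ∎
      where j′ = punchIn 1ᶠ j

  -- Index 1 is always the one eliminated, so that `e zero` survives to the last row. In the
  -- application it is the unit element.
  annihilator : ∀ n {z b k} {e : Fin (suc n) → Carrier} → Dominant b k → Annihilates z b e →
                ∃[ p ] R[t].Monic p × evalₘ p z * e zero ≈ 0#
  annihilator zero {b = b} {k} dominant kills =
    b zero zero , (k , Dominant.diagonal dominant zero) , trans (sym (+-identityʳ _)) (kills zero)
  annihilator (suc n) {z} {b} {k} {e} dominant kills =
    annihilator n {z} {eliminate b} {k ℕ.+ k} {λ j → e (punchIn (suc zero) j)}
      (eliminate-dominant dominant) (eliminate-annihilates {z = z} {b} {e} kills)

  record Span {n} (e : Fin n → Carrier) (z : Carrier) : Set ℓ where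
    constructor _,_
    field
      coefficients : Fin n → R.Carrier
      combination  : z ≈ sum (λ i → ψ.⟦ coefficients i ⟧ * e i)
  open Span

  module _ {n} {e : Fin n → Carrier} where

    span-≈ : ∀ {y z} → y ≈ z → Span e y → Span e z
    span-≈ y≈z (c , eq) = c , trans (sym y≈z) eq

    span-0 : Span e 0#
    span-0 = (λ _ → R.0#) , sym (sum-zero (λ i → ψ.⟦ R.0# ⟧ * e i) (λ i → trans (*-congʳ ψ.0#-homo) (zeroˡ _)))

    span-+ : ∀ {y z} → Span e y → Span e z → Span e (y + z)
    span-+ (c , y≈) (d , z≈) = (λ i → c i R.+ d i) , trans (+-cong y≈ z≈)
      (trans (sym (∑-distrib-+ (λ i → ψ.⟦ c i ⟧ * e i) (λ i → ψ.⟦ d i ⟧ * e i)))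
        (sum-cong-≋ {n} {λ i → ψ.⟦ c i ⟧ * e i + ψ.⟦ d i ⟧ * e i} {λ i → ψ.⟦ c i R.+ d i ⟧ * e i}
          (λ i → trans (sym (distribʳ (e i) ψ.⟦ c i ⟧ ψ.⟦ d i ⟧)) (*-congʳ (sym (ψ.+-homo (c i) (d i)))))))

    span-· : ∀ a {z} → Span e z → Span e (ψ.⟦ a ⟧ * z)
    span-· a (c , z≈) = (λ i → a R.* c i) , trans (*-congˡ z≈)
      (trans (*-distribˡ-sum ψ.⟦ a ⟧ (λ i → ψ.⟦ c i ⟧ * e i))
        (sum-cong-≋ {n} {λ i → ψ.⟦ a ⟧ * (ψ.⟦ c i ⟧ * e i)} {λ i → ψ.⟦ a R.* c i ⟧ * e i}
          (λ i → trans (sym (*-assoc ψ.⟦ a ⟧ ψ.⟦ c i ⟧ (e i))) (*-congʳ (sym (ψ.*-homo a (c i)))))))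

    span-sum : ∀ {m} (t : Fin m → Carrier) → (∀ i → Span e (t i)) → Span e (sum t)
    span-sum {zero}  t t∈ = span-0
    span-sum {suc m} t t∈ = span-+ (t∈ zero) (span-sum (λ i → t (suc i)) (λ i → t∈ (suc i)))

  δ : ∀ {n} → Fin n → Fin n → R.Carrier
  δ zero    zero    = R.1#
  δ zero    (suc j) = R.0#
  δ (suc i) zero    = R.0#
  δ (suc i) (suc j) = δ i j

  sum-δ : ∀ {n} (e : Fin n → Carrier) i → sum (λ j → ψ.⟦ δ i j ⟧ * e j) ≈ e i
  sum-δ {suc n} e zero    = trans (+-cong (trans (*-congʳ ψ.1#-homo) (*-identityˡ _))
    (sum-zero (λ j → ψ.⟦ R.0# ⟧ * e (suc j)) (λ j → trans (*-congʳ ψ.0#-homo) (zeroˡ _)))) (+-identityʳ _)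
  sum-δ {suc n} e (suc i) = trans (+-cong (trans (*-congʳ ψ.0#-homo) (zeroˡ _)) (sum-δ (λ j → e (suc j)) i)) (+-identityˡ _)

  span-gen : ∀ {n} (e : Fin n → Carrier) i → Span e (e i)
  span-gen e i = δ i , sym (sum-δ e i)

  Stable : ∀ {n} → (Fin n → Carrier) → Carrier → Set ℓ
  Stable e z = ∀ i → Span e (z * e i)

  stable-span : ∀ {n} {e : Fin n → Carrier} {y z} → Stable e z → Span e y → Span e (z * y)
  stable-span {e = e} {y} {z} z-stable (c , y≈) = span-≈
    (sym (trans (*-congˡ y≈) (trans (*-distribˡ-sum z (λ i → ψ.⟦ c i ⟧ * e i))
      (sum-cong-≋ {_} {λ i → z * (ψ.⟦ c i ⟧ * e i)} (λ i → x∙yz≈y∙xz z ψ.⟦ c i ⟧ (e i))))))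
    (span-sum (λ i → ψ.⟦ c i ⟧ * (z * e i)) (λ i → span-· (c i) (z-stable i)))
    where
    open import Algebra.Properties.CommutativeSemigroup *-commutativeSemigroup using (x∙yz≈y∙xz)

  stable-+ : ∀ {n} {e : Fin n → Carrier} {y z} → Stable e y → Stable e z → Stable e (y + z)
  stable-+ sy sz i = span-≈ (sym (distribʳ _ _ _)) (span-+ (sy i) (sz i))

  stable-* : ∀ {n} {e : Fin n → Carrier} {y z} → Stable e y → Stable e z → Stable e (y * z)
  stable-* {y = y} {z} sy sz i = span-≈ (sym (*-assoc _ _ _)) (stable-span {z = y} sy (sz i))

  -- Writing z e_i as the sum of a_ij e_j, the matrix of t minus a_ij, evaluated at `z`, kills the
  -- vector `e`. Elimination replaces the determinant of the Cayley-Hamilton argument.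
  stable⇒integral : ∀ {n z} {e : Fin (suc n) → Carrier} → e zero ≈ 1# → Stable e z → Integral z
  stable⇒integral {n} {z} {e} e₀≈1 stable with annihilator n {z} {b} {1} {e} dominant kills
    where
    a : Fin (suc n) → Fin (suc n) → R.Carrier
    a i = coefficients (stable i)

    b : Fin (suc n) → Fin (suc n) → Poly
    b i j = R.- a i j ∷ δ i j ∷ []

    δ-refl : ∀ {m} (i : Fin m) → δ i i R.≈ R.1#
    δ-refl zero    = R.refl
    δ-refl (suc i) = δ-refl i

    δ-≢ : ∀ {m} {i j : Fin m} → i ≢ j → δ i j R.≈ R.0#
    δ-≢ {i = zero}  {zero}  i≢j = ⊥-elim (i≢j ≡.refl)
    δ-≢ {i = zero}  {suc j} i≢j = R.refl
    δ-≢ {i = suc i} {zero}  i≢j = R.refl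
    δ-≢ {i = suc i} {suc j} i≢j = δ-≢ (λ i≡j → i≢j (≡.cong suc i≡j))

    dominant : Dominant b 1
    dominant = record
      { diagonal    = λ i → δ-refl i , λ { (suc (suc k)) _ → R.refl ; (suc zero) (s≤s ()) }
      ; offDiagonal = λ { i≢j (suc zero) _ → δ-≢ i≢j ; i≢j (suc (suc k)) _ → R.refl }
      }

    entry : ∀ i j → evalₘ (b i j) z * e j ≈ z * (ψ.⟦ δ i j ⟧ * e j) + (- 1#) * (ψ.⟦ a i j ⟧ * e j)
    entry i j = trans (*-congʳ (+-congʳ (ψ.-‿homo (a i j)))) (RingIdentities.expand-entry B _ _ _ _)

    kills : Annihilates z b e
    kills i = begin
      sum (λ j → evalₘ (b i j) z * e j)  ≈⟨ sum-cong-≋ (entry i) ⟩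
      sum (λ j → z * (ψ.⟦ δ i j ⟧ * e j) + (- 1#) * (ψ.⟦ a i j ⟧ * e j))
        ≈⟨ ∑-distrib-+ (λ j → z * (ψ.⟦ δ i j ⟧ * e j)) (λ j → (- 1#) * (ψ.⟦ a i j ⟧ * e j)) ⟩
      sum (λ j → z * (ψ.⟦ δ i j ⟧ * e j)) + sum (λ j → (- 1#) * (ψ.⟦ a i j ⟧ * e j))
        ≈⟨ +-cong (*-distribˡ-sum z (λ j → ψ.⟦ δ i j ⟧ * e j)) (*-distribˡ-sum (- 1#) (λ j → ψ.⟦ a i j ⟧ * e j)) ⟨
      z * sum (λ j → ψ.⟦ δ i j ⟧ * e j) + (- 1#) * sum (λ j → ψ.⟦ a i j ⟧ * e j)
        ≈⟨ +-cong (*-congˡ (sum-δ e i)) (*-congˡ (sym (combination (stable i)))) ⟩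
      z * e i + (- 1#) * (z * e i)  ≈⟨ RingIdentities.minus-self B (z * e i) ⟩
      0#                            ∎
  ... | p , monic , pz≈0 = p , monic , trans (sym (*-identityʳ _)) (trans (*-congˡ (sym e₀≈1)) pz≈0)

  powers : ∀ n → Carrier → Fin n → Carrier
  powers n x i = x ^ toℕ i

  evalₘ-sum : ∀ n u x → Below u n → evalₘ u x ≈ sum (λ i → ψ.⟦ R[t].coeff u (toℕ i) ⟧ * powers n x i)
  evalₘ-sum n       []      x u<n = sym (sum-zero {n} _ (λ i → trans (*-congʳ ψ.0#-homo) (zeroˡ _)))
  evalₘ-sum zero    (a ∷ u) x u<n =
    B[t].eval-≋[] (mapₚ (a ∷ u)) x (map-≋ {a ∷ u} {[]} (R[t].Below-0 u<n))
  evalₘ-sum (suc n) (a ∷ u) x u<n = +-cong (sym (*-identityʳ _)) (begin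
    x * evalₘ u x
      ≈⟨ *-congˡ (evalₘ-sum n u x (R[t].Below-tail {a = a} u<n)) ⟩
    x * sum (λ i → ψ.⟦ R[t].coeff u (toℕ i) ⟧ * powers n x i)
      ≈⟨ *-distribˡ-sum x (λ i → ψ.⟦ R[t].coeff u (toℕ i) ⟧ * powers n x i) ⟩
    sum (λ i → x * (ψ.⟦ R[t].coeff u (toℕ i) ⟧ * powers n x i))
      ≈⟨ sum-cong-≋ (λ i → x∙yz≈y∙xz x ψ.⟦ R[t].coeff u (toℕ i) ⟧ (powers n x i)) ⟩
    sum (λ i → ψ.⟦ R[t].coeff u (toℕ i) ⟧ * (x * powers n x i)) ∎)
    where
    open import Algebra.Properties.CommutativeSemigroup *-commutativeSemigroup using (x∙yz≈y∙xz)

  evalₘ-linear-^ : ∀ n x → evalₘ (R[t].linear R.0# R[t].^ₚ n) x ≈ x ^ n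
  evalₘ-linear-^ zero    x = trans (B[t].eval-cong _ B[t].1ₚ map-1 refl) (B[t].eval-const 1# x)
  evalₘ-linear-^ (suc n) x = trans (evalₘ-* (R[t].linear R.0#) (R[t].linear R.0# R[t].^ₚ n) x)
    (*-cong (trans (B[t].eval-cong _ (B[t].linear ψ.⟦ R.0# ⟧) (map-linear R.0#) refl)
      (trans (B[t].eval-linear ψ.⟦ R.0# ⟧ x) (trans (+-congˡ (trans (-‿cong ψ.0#-homo) -0#≈0#)) (+-identityʳ x))))
      (evalₘ-linear-^ n x))

  reduction : ∀ {x} → Integral x → ∃[ a ] Span (powers (suc a) x) (x ^ suc a)
  reduction {x} (p , (n , monic) , px≈0) = n , (λ i → R[t].coeff u (toℕ i)) , trans (sym ux≈) (evalₘ-sum (suc n) u x u<)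
    where
    -- The extra factor t makes the powers up to the n-th suffice for the next one. At least the
    -- zeroth power is then present, also when the monic polynomial has degree 0.
    tp : Poly
    tp = R[t].linear R.0# *ₚ p
    u : Poly
    u = R[t].linear R.0# R[t].^ₚ suc n +ₚ -ₚ tp
    u< : Below u (suc n)
    u< = R[t].leading-difference (R[t].linear R.0# R[t].^ₚ suc n) tp (suc n) (R[t].leading-linear-^ R.0# (suc n))
      (R[t].leading-* (R[t].linear R.0#) p 1 n (R[t].leading-linear R.0#) monic)
    ux≈ : evalₘ u x ≈ x ^ suc n
    ux≈ = begin
      evalₘ u x  ≈⟨ evalₘ-+ (R[t].linear R.0# R[t].^ₚ suc n) (-ₚ tp) x ⟩
      evalₘ (R[t].linear R.0# R[t].^ₚ suc n) x + evalₘ (-ₚ tp) x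
        ≈⟨ +-cong (evalₘ-linear-^ (suc n) x)
             (trans (evalₘ-neg tp x) (-‿cong (trans (evalₘ-* (R[t].linear R.0#) p x) (trans (*-congˡ px≈0) (zeroʳ _))))) ⟩
      x ^ suc n - 0#  ≈⟨ trans (+-congˡ -0#≈0#) (+-identityʳ _) ⟩
      x ^ suc n       ∎

  module _ {x y} (x-integral : Integral x) (y-integral : Integral y) where
    private
      a = proj₁ (reduction x-integral)
      b = proj₁ (reduction y-integral)

      monomial : Fin (suc a) × Fin (suc b) → Carrier
      monomial (i , j) = x ^ toℕ i * y ^ toℕ j

      -- The products of powers of `x` and `y` span a module stable under both. Flattening the two
      -- exponents into one index puts the monomial 1 at index 0.
      e : Fin (suc a ℕ.* suc b) → Carrier
      e k = monomial (remQuot (suc b) k)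

      span-monomial : ∀ i j → Span e (monomial (i , j))
      span-monomial i j = span-≈ (reflexive (≡.cong monomial (Fin.remQuot-combine i j))) (span-gen e (combine i j))

      next : ∀ {n} z (i : Fin (suc n)) → Span (powers (suc n) z) (z ^ suc n) → Span (powers (suc n) z) (z * z ^ toℕ i)
      next {n} z i top with suc (toℕ i) ℕ.<? suc n
      ... | yes 1+i<1+n = span-≈ (reflexive (≡.cong (z ^_) (Fin.toℕ-fromℕ< 1+i<1+n)))
        (span-gen (powers (suc n) z) (fromℕ< 1+i<1+n))
      ... | no  1+i≮1+n = span-≈ (reflexive (≡.cong (z ^_) (ℕ.≤-antisym (ℕ.≮⇒≥ 1+i≮1+n) (Fin.toℕ<n i)))) top

      x-stable : Stable e x
      x-stable k = let (i , j) = remQuot (suc b) k ; (c , eq) = next x i (proj₂ (reduction x-integral)) in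
        span-≈ (trans (sym (*-distribʳ-sum (y ^ toℕ j) (λ l → ψ.⟦ c l ⟧ * x ^ toℕ l)))
                 (trans (*-congʳ (sym eq)) (*-assoc x _ _)))
          (span-sum (λ l → ψ.⟦ c l ⟧ * x ^ toℕ l * y ^ toℕ j)
            (λ l → span-≈ (sym (*-assoc _ _ _)) (span-· (c l) (span-monomial l j))))

      y-stable : Stable e y
      y-stable k = let (i , j) = remQuot (suc b) k ; (c , eq) = next y j (proj₂ (reduction y-integral)) in
        span-≈ (trans (sym (*-distribˡ-sum (x ^ toℕ i) (λ l → ψ.⟦ c l ⟧ * y ^ toℕ l)))
                 (trans (*-congˡ (sym eq)) (x∙yz≈y∙xz (x ^ toℕ i) y _)))
          (span-sum (λ l → x ^ toℕ i * (ψ.⟦ c l ⟧ * y ^ toℕ l))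
            (λ l → span-≈ (x∙yz≈y∙xz ψ.⟦ c l ⟧ (x ^ toℕ i) (y ^ toℕ l)) (span-· (c l) (span-monomial i l))))
        where
        open import Algebra.Properties.CommutativeSemigroup *-commutativeSemigroup using (x∙yz≈y∙xz)

      e₀≈1 : e zero ≈ 1#
      e₀≈1 = *-identityˡ 1#

    integral-+ : Integral (x + y)
    integral-+ = stable⇒integral e₀≈1 (stable-+ {y = x} {y} x-stable y-stable)

    integral-* : Integral (x * y)
    integral-* = stable⇒integral e₀≈1 (stable-* {y = x} {y} x-stable y-stable)

  integral-≈ : ∀ {x y} → x ≈ y → Integral x → Integral y
  integral-≈ x≈y (p , monic , px≈0) = p , monic , trans (B[t].eval-cong (mapₚ p) (mapₚ p) B[t].≋-refl (sym x≈y)) px≈0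

  integral-base : ∀ c → Integral ψ.⟦ c ⟧
  integral-base c = R[t].linear c , (1 , R[t].leading-linear c) ,
    trans (B[t].eval-cong _ (B[t].linear ψ.⟦ c ⟧) (map-linear c) refl)
      (trans (B[t].eval-linear ψ.⟦ c ⟧ ψ.⟦ c ⟧) (-‿inverseʳ _))

  integral-neg : ∀ {x} → Integral x → Integral (- x)
  integral-neg {x} x-integral = integral-≈
    (trans (*-congʳ (trans (ψ.-‿homo R.1#) (-‿cong ψ.1#-homo))) (trans (sym (-‿distribˡ-* 1# x)) (-‿cong (*-identityˡ x))))
    (integral-* (integral-base (R.- R.1#)) x-integral)

-- Subrings and quotient rings

isRingHom : (R S : RawRing ℓ ℓ) → let module R = RawRing R ; module S = RawRing S in
  (f : R.Carrier → S.Carrier) →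
  (∀ {x y} → x R.≈ y → f x S.≈ f y) →
  (∀ x y → f (x R.+ y) S.≈ f x S.+ f y) → (∀ x y → f (x R.* y) S.≈ f x S.* f y) →
  (∀ x → f (R.- x) S.≈ S.- f x) → f R.0# S.≈ S.0# → f R.1# S.≈ S.1# → IsRingHomomorphism R S f
isRingHom R S f f-cong f-+ f-* f-neg f-0 f-1 = record
  { isSemiringHomomorphism = record
    { isNearSemiringHomomorphism = record
      { +-isMonoidHomomorphism = record
        { isMagmaHomomorphism = record { isRelHomomorphism = record { cong = f-cong } ; homo = f-+ }
        ; ε-homo = f-0
        }
      ; *-homo = f-*
      }
    ; 1#-homo = f-1
    }
  ; -‿homo = f-neg
  }

record IsSubring (R : CommutativeRing ℓ ℓ) (P : Pred (CommutativeRing.Carrier R) ℓ) : Set ℓ where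
  open CommutativeRing R
  field
    0∈ : 0# ∈ P
    1∈ : 1# ∈ P
    +∈ : ∀ {x y} → x ∈ P → y ∈ P → x + y ∈ P
    *∈ : ∀ {x y} → x ∈ P → y ∈ P → x * y ∈ P
    -∈ : ∀ {x} → x ∈ P → - x ∈ P

module Subring (R : CommutativeRing ℓ ℓ) (P : Pred (CommutativeRing.Carrier R) ℓ) (isSubring : IsSubring R P) where
  open CommutativeRing R
  open IsSubring isSubring

  rawSubring : RawRing ℓ ℓ
  rawSubring = record
    { Carrier = ∃ P
    ; _≈_     = _≈_ on proj₁
    ; _+_     = λ (x , x∈) (y , y∈) → x + y , +∈ x∈ y∈
    ; _*_     = λ (x , x∈) (y , y∈) → x * y , *∈ x∈ y∈
    ; -_      = λ (x , x∈) → - x , -∈ x∈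
    ; 0#      = 0# , 0∈
    ; 1#      = 1# , 1∈
    }

  inclusion : IsRingHomomorphism rawSubring rawRing proj₁
  inclusion = isRingHom rawSubring rawRing proj₁
    (λ eq → eq) (λ _ _ → refl) (λ _ _ → refl) (λ _ → refl) refl refl

  subring : CommutativeRing ℓ ℓ
  subring = record
    { isCommutativeRing = Algebra.Morphism.RingMonomorphism.isCommutativeRing
        {R₁ = rawSubring} {R₂ = rawRing} (record { isRingHomomorphism = inclusion ; injective = λ eq → eq })
        isCommutativeRing
    }

record IsRingIdeal (R : CommutativeRing ℓ ℓ) (I : Pred (CommutativeRing.Carrier R) ℓ) : Set ℓ where
  open CommutativeRing R
  field
    ≈∈ : ∀ {x y} → x ≈ y → x ∈ I → y ∈ I
    0∈ : 0# ∈ I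
    +∈ : ∀ {x y} → x ∈ I → y ∈ I → x + y ∈ I
    *∈ : ∀ r {x} → x ∈ I → r * x ∈ I

module Quotient (R : CommutativeRing ℓ ℓ) (I : Pred (CommutativeRing.Carrier R) ℓ) (isIdeal : IsRingIdeal R I) where
  open CommutativeRing R
  open IsRingIdeal isIdeal
  open IntegerSolver R

  infix 4 _~_
  record _~_ (x y : Carrier) : Set ℓ where
    constructor difference
    field
      difference∈ : x - y ∈ I
  open _~_ public

  ≈⇒~ : ∀ {x y} → x ≈ y → x ~ y
  ≈⇒~ {x} {y} x≈y = difference (≈∈ (sym (trans (+-congʳ x≈y) (-‿inverseʳ y))) 0∈)

  ~-neg : ∀ {x y} → x ~ y → - x ~ - y
  ~-neg {x} {y} (difference d) = difference (≈∈
    (solve 2 (λ x y → (:- con (+ 1)) :* (x :- y) := :- x :- :- y) refl x y) (*∈ (- 1#) d))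

  ~-sym : ∀ {x y} → x ~ y → y ~ x
  ~-sym {x} {y} x~y = difference (≈∈
    (solve 2 (λ x y → :- x :- :- y := y :- x) refl x y) (difference∈ (~-neg x~y)))

  ~-trans : ∀ {x y z} → x ~ y → y ~ z → x ~ z
  ~-trans {x} {y} {z} (difference d) (difference e) = difference (≈∈
    (solve 3 (λ x y z → (x :- y) :+ (y :- z) := x :- z) refl x y z) (+∈ d e))

  ~-+ : ∀ {x y u v} → x ~ y → u ~ v → x + u ~ y + v
  ~-+ {x} {y} {u} {v} (difference d) (difference e) = difference (≈∈
    (solve 4 (λ x y u v → (x :- y) :+ (u :- v) := (x :+ u) :- (y :+ v)) refl x y u v) (+∈ d e))

  ~-* : ∀ {x y u v} → x ~ y → u ~ v → x * u ~ y * v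
  ~-* {x} {y} {u} {v} (difference d) (difference e) = difference (≈∈
    (solve 4 (λ x y u v → u :* (x :- y) :+ y :* (u :- v) := x :* u :- y :* v) refl x y u v)
    (+∈ (*∈ u d) (*∈ y e)))

  -- The carrier is kept and only the equality is coarsened, so the projection is the identity
  -- function and no representatives are chosen.
  quotientRing : CommutativeRing ℓ ℓ
  quotientRing = record
    { Carrier = Carrier ; _≈_ = _~_ ; _+_ = _+_ ; _*_ = _*_ ; -_ = -_ ; 0# = 0# ; 1# = 1#
    ; isCommutativeRing = record
      { isRing = record
        { +-isAbelianGroup = record
          { isGroup = record
            { isMonoid = record
              { isSemigroup = record
                { isMagma = record
                  { isEquivalence = record { refl = ≈⇒~ refl ; sym = ~-sym ; trans = ~-trans }
                  ; ∙-cong = ~-+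
                  }
                ; assoc = λ x y z → ≈⇒~ (+-assoc x y z)
                }
              ; identity = (λ x → ≈⇒~ (+-identityˡ x)) , λ x → ≈⇒~ (+-identityʳ x)
              }
            ; inverse = (λ x → ≈⇒~ (-‿inverseˡ x)) , λ x → ≈⇒~ (-‿inverseʳ x)
            ; ⁻¹-cong = ~-neg
            }
          ; comm = λ x y → ≈⇒~ (+-comm x y)
          }
        ; *-cong = ~-*
        ; *-assoc = λ x y z → ≈⇒~ (*-assoc x y z)
        ; *-identity = (λ x → ≈⇒~ (*-identityˡ x)) , λ x → ≈⇒~ (*-identityʳ x)
        ; distrib = (λ x y z → ≈⇒~ (distribˡ x y z)) , λ x y z → ≈⇒~ (distribʳ x y z)
        }
      ; *-comm = λ x y → ≈⇒~ (*-comm x y)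
      }
    }

  projection : IsRingHomomorphism rawRing (CommutativeRing.rawRing quotientRing) (λ x → x)
  projection = isRingHom rawRing (CommutativeRing.rawRing quotientRing) (λ x → x)
    ≈⇒~ (λ _ _ → ≈⇒~ refl) (λ _ _ → ≈⇒~ refl) (λ _ → ≈⇒~ refl) (≈⇒~ refl) (≈⇒~ refl)

-- Reduction modulo a maximal ideal over x₀

map-toList : ∀ {a p} {A : Set a} {P : Pred A p} {xs} (pxs : All P xs) → map proj₁ (All.toList pxs) ≡ xs
map-toList []         = ≡.refl
map-toList (px ∷ pxs) = ≡.cong (_ ∷_) (map-toList pxs)

module Reductions (em : ExcludedMiddle ℓ) (𝒮 : Setting ℓ) where
  open Over 𝒮
  private
    module toK = RingHomomorphism toK
    module ev = RingHomomorphism x₀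
    module s = RingHomomorphism structure
    module ι = RingHomomorphism Ω.embed

    ev-nonzero-* : ∀ {b d} → ¬ (ev.⟦ b ⟧ 𝔽q.≈ 𝔽q.0#) → ¬ (ev.⟦ d ⟧ 𝔽q.≈ 𝔽q.0#) → ¬ (ev.⟦ b A.* d ⟧ 𝔽q.≈ 𝔽q.0#)
    ev-nonzero-* {b} {d} b≉0 d≉0 bd≈0
      with proj₂ (field⇒domain em 𝔽q.ring 𝔽q.isField) ev.⟦ b ⟧ ev.⟦ d ⟧ (𝔽q.trans (𝔽q.sym (ev.*-homo b d)) bd≈0)
    ... | inj₁ b≈0 = b≉0 b≈0
    ... | inj₂ d≈0 = d≉0 d≈0

  regular-A : ∀ a → Regular toK.⟦ a ⟧
  regular-A a = a , A.1# , (λ eq → IsField.1≉0 𝔽q.isField (𝔽q.trans (𝔽q.sym ev.1#-homo) eq)) ,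
    K.trans (K.*-congˡ toK.1#-homo) (K.*-identityʳ _)

  regular-≈ : ∀ {x y} → x K.≈ y → Regular x → Regular y
  regular-≈ x≈y (a , b , b≉0 , eq) = a , b , b≉0 , K.trans (K.*-congʳ (K.sym x≈y)) eq

  regular-+ : ∀ {x y} → Regular x → Regular y → Regular (x K.+ y)
  regular-+ {x} {y} (a , b , b≉0 , xb≈a) (c , d , d≉0 , yd≈c) =
    a A.* d A.+ c A.* b , b A.* d , ev-nonzero-* b≉0 d≉0 , (begin
    (x K.+ y) K.* toK.⟦ b A.* d ⟧                                  ≈⟨ K.*-congˡ (toK.*-homo b d) ⟩
    (x K.+ y) K.* (toK.⟦ b ⟧ K.* toK.⟦ d ⟧)
      ≈⟨ RingIdentities.sum-fraction K x y toK.⟦ b ⟧ toK.⟦ d ⟧ ⟩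
    (x K.* toK.⟦ b ⟧) K.* toK.⟦ d ⟧ K.+ (y K.* toK.⟦ d ⟧) K.* toK.⟦ b ⟧
      ≈⟨ K.+-cong (K.*-congʳ xb≈a) (K.*-congʳ yd≈c) ⟩
    toK.⟦ a ⟧ K.* toK.⟦ d ⟧ K.+ toK.⟦ c ⟧ K.* toK.⟦ b ⟧            ≈⟨ K.+-cong (toK.*-homo a d) (toK.*-homo c b) ⟨
    toK.⟦ a A.* d ⟧ K.+ toK.⟦ c A.* b ⟧                            ≈⟨ toK.+-homo _ _ ⟨
    toK.⟦ a A.* d A.+ c A.* b ⟧                                    ∎)
    where open Relation.Binary.Reasoning.Setoid K.setoid

  regular-* : ∀ {x y} → Regular x → Regular y → Regular (x K.* y)
  regular-* {x} {y} (a , b , b≉0 , xb≈a) (c , d , d≉0 , yd≈c) =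
    a A.* c , b A.* d , ev-nonzero-* b≉0 d≉0 , (begin
    (x K.* y) K.* toK.⟦ b A.* d ⟧               ≈⟨ K.*-congˡ (toK.*-homo b d) ⟩
    (x K.* y) K.* (toK.⟦ b ⟧ K.* toK.⟦ d ⟧)     ≈⟨ RingIdentities.product-fraction K x y toK.⟦ b ⟧ toK.⟦ d ⟧ ⟩
    (x K.* toK.⟦ b ⟧) K.* (y K.* toK.⟦ d ⟧)     ≈⟨ K.*-cong xb≈a yd≈c ⟩
    toK.⟦ a ⟧ K.* toK.⟦ c ⟧                     ≈⟨ toK.*-homo a c ⟨
    toK.⟦ a A.* c ⟧                             ∎)
    where open Relation.Binary.Reasoning.Setoid K.setoid

  regular-neg : ∀ {x} → Regular x → Regular (K.- x)
  regular-neg {x} (a , b , b≉0 , xb≈a) = A.- a , b , b≉0 ,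
    K.trans (K.sym (-‿distribˡ-* x _)) (K.trans (K.-‿cong xb≈a) (K.sym (toK.-‿homo a)))
    where open Algebra.Properties.Ring K.ring using (-‿distribˡ-*)

  private
    regular-subring : IsSubring K Regular
    regular-subring = record
      { 0∈ = regular-≈ toK.0#-homo (regular-A A.0#) ; 1∈ = regular-≈ toK.1#-homo (regular-A A.1#)
      ; +∈ = regular-+ ; *∈ = regular-* ; -∈ = regular-neg }

    module Sub = Subring K Regular regular-subring

  localRing : CommutativeRing ℓ ℓ
  localRing = Sub.subring

  localRing→K : RingHomomorphism (CommutativeRing.rawRing localRing) K.rawRing
  localRing→K = record { ⟦_⟧ = proj₁ ; isRingHomomorphism = Sub.inclusion }

  localRing→Ω : RingHomomorphism (CommutativeRing.rawRing localRing) Ω.rawRing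
  localRing→Ω = record
    { ⟦_⟧ = λ r → ι.⟦ proj₁ r ⟧
    ; isRingHomomorphism = isRingHomomorphism Ω.trans Sub.inclusion ι.isRingHomomorphism
    }

  constant : 𝔽q.Carrier → K.Carrier
  constant c = toK.⟦ s.⟦ c ⟧ ⟧

  -- `value` is attached to a chosen fraction. Keeping the denominator `b` gives a numerator that
  -- visibly vanishes at `x₀`, so independence of the choice need not be shown first.
  regular-difference : ∀ {x} (r : Regular x) → Regular (x K.- constant (value r))
  regular-difference {x} r@(a , b , b≉0 , xb≈a) = a A.- s.⟦ value r ⟧ A.* b , b , b≉0 , (begin
    (x K.- constant (value r)) K.* toK.⟦ b ⟧                  ≈⟨ RingIdentities.difference-* K x _ _ ⟩
    x K.* toK.⟦ b ⟧ K.- constant (value r) K.* toK.⟦ b ⟧      ≈⟨ K.+-cong xb≈a (K.-‿cong (K.sym (toK.*-homo _ b))) ⟩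
    toK.⟦ a ⟧ K.- toK.⟦ s.⟦ value r ⟧ A.* b ⟧                 ≈⟨ K.+-congˡ (toK.-‿homo _) ⟨
    toK.⟦ a ⟧ K.+ toK.⟦ A.- (s.⟦ value r ⟧ A.* b) ⟧           ≈⟨ toK.+-homo _ _ ⟨
    toK.⟦ a A.- s.⟦ value r ⟧ A.* b ⟧                         ∎)
    where open Relation.Binary.Reasoning.Setoid K.setoid

  value-difference : ∀ {x} (r : Regular x) → value (regular-difference r) 𝔽q.≈ 𝔽q.0#
  value-difference r@(a , b , b≉0 , _) = begin
    ev.⟦ a A.- s.⟦ value r ⟧ A.* b ⟧ 𝔽q.* i
      ≈⟨ 𝔽q.*-congʳ (𝔽q.trans (ev.+-homo _ _) (𝔽q.+-congˡ (ev.-‿homo _))) ⟩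
    (ev.⟦ a ⟧ 𝔽q.- ev.⟦ s.⟦ value r ⟧ A.* b ⟧) 𝔽q.* i
      ≈⟨ 𝔽q.*-congʳ (𝔽q.+-congˡ (𝔽q.-‿cong (𝔽q.trans (ev.*-homo _ b) (𝔽q.*-congʳ (x₀-𝔽q (value r)))))) ⟩
    (ev.⟦ a ⟧ 𝔽q.- (ev.⟦ a ⟧ 𝔽q.* i) 𝔽q.* ev.⟦ b ⟧) 𝔽q.* i
      ≈⟨ RingIdentities.vanishing-numerator 𝔽q.ring ev.⟦ a ⟧ ev.⟦ b ⟧ i ⟩
    ev.⟦ a ⟧ 𝔽q.* i 𝔽q.- (ev.⟦ a ⟧ 𝔽q.* i) 𝔽q.* (ev.⟦ b ⟧ 𝔽q.* i)
      ≈⟨ 𝔽q.+-congˡ (𝔽q.-‿cong (𝔽q.trans (𝔽q.*-congˡ bi≈1) (𝔽q.*-identityʳ _))) ⟩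
    ev.⟦ a ⟧ 𝔽q.* i 𝔽q.- ev.⟦ a ⟧ 𝔽q.* i                       ≈⟨ 𝔽q.-‿inverseʳ _ ⟩
    𝔽q.0#                                                      ∎
    where
    open Relation.Binary.Reasoning.Setoid 𝔽q.setoid
    i : 𝔽q.Carrier
    i = proj₁ (IsField.inverse 𝔽q.isField ev.⟦ b ⟧ b≉0)
    bi≈1 : ev.⟦ b ⟧ 𝔽q.* i 𝔽q.≈ 𝔽q.1#
    bi≈1 = proj₂ (IsField.inverse 𝔽q.isField ev.⟦ b ⟧ b≉0)

  module localRing[t] = PolynomialRing localRing
  module K[t] = PolynomialRing K
  module Ω[t] = PolynomialRing Ω.ring
  open Integrality localRing Ω.ring localRing→Ω public
    using (Integral; integral-≈; integral-+; integral-*; integral-neg; integral-base)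

  private
    module →K = PolynomialMap localRing K localRing→K

  -- Passes from polynomials over `K` with regular coefficients to polynomials over the local ring
  -- itself, where the span argument applies.
  integralOver⇒integral : ∀ {z} → IntegralOver K Ω.ring Ω.embed Regular z → Integral z
  integralOver⇒integral {z} (p , (n , p≈1 , p<) , reg , pz≈0) =
    All.toList reg ,
    (n , K.trans (coeff-p n) p≈1 , λ m n<m → K.trans (coeff-p m) (p< m n<m)) ,
    ≡.subst (λ u → Ω[t].eval u z Ω.≈ Ω.0#)
      (≡.sym (≡.trans (map-∘ (All.toList reg)) (≡.cong (map ι.⟦_⟧) (map-toList reg)))) pz≈0
    where
    coeff-p : ∀ m → proj₁ (localRing[t].coeff (All.toList reg) m) K.≈ K[t].coeff p m
    coeff-p m = K.trans (K.sym (→K.coeff-map (All.toList reg) m))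
      (K.reflexive (≡.cong (λ u → K[t].coeff u m) (map-toList reg)))

  integral⇒integralOver : ∀ {z} → Integral z → IntegralOver K Ω.ring Ω.embed Regular z
  integral⇒integralOver {z} (p , (n , p≈1 , p<) , pz≈0) =
    map proj₁ p ,
    (n , K.trans (→K.coeff-map p n) p≈1 , λ m n<m → K.trans (→K.coeff-map p m) (p< m n<m)) ,
    Allₚ.map⁺ (All.universal proj₂ p) ,
    ≡.subst (λ u → Ω[t].eval u z Ω.≈ Ω.0#) (map-∘ p) pz≈0

  module _ (S : Pred Ω.Carrier ℓ) where

    opaque
      base∈𝒪 : ∀ {x} → Regular x → ι.⟦ x ⟧ ∈ 𝒪 S
      base∈𝒪 {x} r = base x , integral⇒integralOver (integral-base (x , r))

      0∈𝒪 : Ω.0# ∈ 𝒪 S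
      0∈𝒪 = resp ι.0#-homo (base K.0#) , integral⇒integralOver
        (integral-≈ ι.0#-homo (integral-base (CommutativeRing.0# localRing)))

      1∈𝒪 : Ω.1# ∈ 𝒪 S
      1∈𝒪 = resp ι.1#-homo (base K.1#) , integral⇒integralOver
        (integral-≈ ι.1#-homo (integral-base (CommutativeRing.1# localRing)))

      +∈𝒪 : ∀ {x y} → x ∈ 𝒪 S → y ∈ 𝒪 S → x Ω.+ y ∈ 𝒪 S
      +∈𝒪 (x∈ , x-int) (y∈ , y-int) = add x∈ y∈ ,
        integral⇒integralOver (integral-+ (integralOver⇒integral x-int) (integralOver⇒integral y-int))

      *∈𝒪 : ∀ {x y} → x ∈ 𝒪 S → y ∈ 𝒪 S → x Ω.* y ∈ 𝒪 S
      *∈𝒪 (x∈ , x-int) (y∈ , y-int) = mul x∈ y∈ ,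
        integral⇒integralOver (integral-* (integralOver⇒integral x-int) (integralOver⇒integral y-int))

      -∈𝒪 : ∀ {x} → x ∈ 𝒪 S → Ω.- x ∈ 𝒪 S
      -∈𝒪 (x∈ , x-int) = neg x∈ , integral⇒integralOver (integral-neg (integralOver⇒integral x-int))

    private
      𝒪-subring : IsSubring Ω.ring (𝒪 S)
      𝒪-subring = record { 0∈ = 0∈𝒪 ; 1∈ = 1∈𝒪 ; +∈ = +∈𝒪 ; *∈ = *∈𝒪 ; -∈ = -∈𝒪 }

      module 𝒪-Sub = Subring Ω.ring (𝒪 S) 𝒪-subring

    𝒪ring : CommutativeRing ℓ ℓ
    𝒪ring = 𝒪-Sub.subring

    𝒪→Ω : RingHomomorphism (CommutativeRing.rawRing 𝒪ring) Ω.rawRing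
    𝒪→Ω = record { ⟦_⟧ = proj₁ ; isRingHomomorphism = 𝒪-Sub.inclusion }

  module Residue (S M : Pred Ω.Carrier ℓ) (isMaximal : IsMaximalIdeal (𝒪 S) M) (over : LiesOver-x₀ M) where
    open IsMaximalIdeal isMaximal
    open IsIdeal isIdeal
    private
      module 𝒪S = CommutativeRing (𝒪ring S)

      M-ideal : IsRingIdeal (𝒪ring S) (λ u → proj₁ u ∈ M)
      M-ideal = record { ≈∈ = ≈∈ ; 0∈ = 0∈ ; +∈ = +∈ ; *∈ = λ r x∈ → *∈ (proj₂ r) x∈ }

    open Quotient (𝒪ring S) (λ u → proj₁ u ∈ M) M-ideal

    residueRing : CommutativeRing ℓ ℓ
    residueRing = quotientRing

    private
      module E = CommutativeRing residueRing

    ~0⇒∈M : ∀ {u} → u ~ E.0# → proj₁ u ∈ M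
    ~0⇒∈M {u} (difference d) = ≈∈ (Ω.trans (Ω.+-congˡ -0#≈0#) (Ω.+-identityʳ _)) d
      where open Algebra.Properties.Ring (CommutativeRing.ring Ω.ring) using (-0#≈0#)

    ∈M⇒~0 : ∀ {u} → proj₁ u ∈ M → u ~ E.0#
    ∈M⇒~0 {u} u∈ = difference (≈∈ (Ω.sym (Ω.trans (Ω.+-congˡ -0#≈0#) (Ω.+-identityʳ _))) u∈)
      where open Algebra.Properties.Ring (CommutativeRing.ring Ω.ring) using (-0#≈0#)

    -- The ideal generated by `M` and `x`.
    Extend : Ω.Carrier → Pred Ω.Carrier ℓ
    Extend x z = ∃[ m ] ∃[ r ] m ∈ M × r ∈ 𝒪 S × z Ω.≈ m Ω.+ r Ω.* x

    extend-ideal : ∀ {x} → x ∈ 𝒪 S → IsIdeal (𝒪 S) (Extend x)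
    extend-ideal {x} x∈ = record
      { ≈∈     = λ { y≈z (m , r , m∈ , r∈ , y≈) → m , r , m∈ , r∈ , Ω.trans (Ω.sym y≈z) y≈ }
      ; subset = λ { {z} (m , r , m∈ , r∈ , z≈) → 𝒪-resp (Ω.sym z≈) (+∈𝒪 S (subset m∈) (*∈𝒪 S r∈ x∈)) }
      ; 0∈     = Ω.0# , Ω.0# , 0∈ , 0∈𝒪 S , Ω.sym (Ω.trans (Ω.+-identityˡ _) (Ω.zeroˡ x))
      ; +∈     = λ { {y} {z} (m , r , m∈ , r∈ , y≈) (n , s , n∈ , s∈ , z≈) →
          m Ω.+ n , r Ω.+ s , +∈ m∈ n∈ , +∈𝒪 S r∈ s∈ ,
          Ω.trans (Ω.+-cong y≈ z≈) (RingIdentities.combine-sum Ω.ring m r n s x) }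
      ; *∈     = λ { {t} {z} t∈ (m , r , m∈ , r∈ , z≈) →
          t Ω.* m , t Ω.* r , *∈ t∈ m∈ , *∈𝒪 S t∈ r∈ ,
          Ω.trans (Ω.*-congˡ z≈) (RingIdentities.combine-product Ω.ring t m r x) }
      }
      where
      𝒪-resp : ∀ {y z} → y Ω.≈ z → y ∈ 𝒪 S → z ∈ 𝒪 S
      𝒪-resp y≈z (y∈ , y-int) = resp y≈z y∈ , integral⇒integralOver
        (integral-≈ y≈z (integralOver⇒integral y-int))

    -- If 1 is not in the ideal generated by `M` and `x`, maximality puts `x` in `M`. If 1 = m + r
    -- x, multiplying by `y` puts `y` in `M`.
    prime : ∀ {x y} → x ∈ 𝒪 S → y ∈ 𝒪 S → x Ω.* y ∈ M → x ∈ M ⊎ y ∈ M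
    prime {x} {y} x∈ y∈ xy∈ with em {P = Extend x Ω.1#}
    ... | no 1∉ = inj₁ (maximal (Extend x) (extend-ideal x∈) 1∉
      (λ {z} z∈ → z , Ω.0# , z∈ , 0∈𝒪 S , Ω.sym (Ω.trans (Ω.+-congˡ (Ω.zeroˡ x)) (Ω.+-identityʳ z)))
      (Ω.0# , Ω.1# , 0∈ , 1∈𝒪 S , Ω.sym (Ω.trans (Ω.+-identityˡ _) (Ω.*-identityˡ x))))
    ... | yes (m , r , m∈ , r∈ , 1≈) = inj₂ (≈∈
      (Ω.sym (Ω.trans (Ω.sym (Ω.*-identityˡ y)) (Ω.trans (Ω.*-congʳ 1≈) (RingIdentities.distribute-unit Ω.ring m r x y))))
      (+∈ (*∈ y∈ m∈) (*∈ r∈ xy∈)))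

    residue-domain : IsDomain E.rawRing
    residue-domain = (λ 1~0 → proper (~0⇒∈M {E.1#} 1~0)) , zero-product
      where
      zero-product : ∀ u v → u E.* v ~ E.0# → u ~ E.0# ⊎ v ~ E.0#
      zero-product u v uv~0 with prime (proj₂ u) (proj₂ v) (~0⇒∈M {u E.* v} uv~0)
      ... | inj₁ u∈ = inj₁ (∈M⇒~0 {u} u∈)
      ... | inj₂ v∈ = inj₂ (∈M⇒~0 {v} v∈)

    𝔽q→Ω : RingHomomorphism 𝔽q.rawRing Ω.rawRing
    𝔽q→Ω = record
      { ⟦_⟧ = λ c → ι.⟦ constant c ⟧
      ; isRingHomomorphism = isRingHomomorphism Ω.trans
          (isRingHomomorphism K.trans s.isRingHomomorphism toK.isRingHomomorphism) ι.isRingHomomorphism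
      }

    𝔽q→E : RingHomomorphism 𝔽q.rawRing E.rawRing
    𝔽q→E = record
      { ⟦_⟧ = λ c → ι.⟦ constant c ⟧ , base∈𝒪 S (regular-A s.⟦ c ⟧)
      ; isRingHomomorphism = isRingHom 𝔽q.rawRing E.rawRing _
          (λ eq → ≈⇒~ (h.⟦⟧-cong eq)) (λ c d → ≈⇒~ (h.+-homo c d)) (λ c d → ≈⇒~ (h.*-homo c d))
          (λ c → ≈⇒~ (h.-‿homo c)) (≈⇒~ h.0#-homo) (≈⇒~ h.1#-homo)
      }
      where
      module h = RingHomomorphism 𝔽q→Ω

    𝒪→E : RingHomomorphism 𝒪S.rawRing E.rawRing
    𝒪→E = record { ⟦_⟧ = λ u → u ; isRingHomomorphism = projection }

    open SplittingTypes em 𝔽q residueRing residue-domain 𝔽q→E public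

    reduceRegular : ∀ {x} → Regular x → 𝒪S.Carrier
    reduceRegular {x} r = ι.⟦ x ⟧ , base∈𝒪 S r

    -- The regular function minus its value vanishes at `x₀`, and `over` places it in `M`.
    value-reduces : ∀ {x} (r : Regular x) → RingHomomorphism.⟦_⟧ 𝔽q→E (value r) ~ reduceRegular r
    value-reduces {x} r = ~-sym (difference (≈∈
      (Ω.trans (ι.+-homo _ _) (Ω.+-congˡ (ι.-‿homo _)))
      (Equivalence.from (over _ (regular-difference r)) (value-difference r))))

    ≈⇒residue : ∀ {u v : E.Carrier} → proj₁ u Ω.≈ proj₁ v → u E.≈ v
    ≈⇒residue = ≈⇒~

    power : ∀ (u : E.Carrier) n → proj₁ (u ^ n) Ω.≈ proj₁ u ^Ω n
    power u zero    = Ω.refl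
    power u (suc n) = Ω.*-congˡ (power u n)

    residue-difference : ∀ {u v : E.Carrier} {w} → proj₁ u Ω.- w ∈ M → proj₁ v Ω.≈ w → u E.≈ v
    residue-difference d v≈w = difference (≈∈ (Ω.+-congˡ (Ω.-‿cong (Ω.sym v≈w))) d)

  module RootReduction
    (S M : Pred Ω.Carrier ℓ) (isMaximal : IsMaximalIdeal (𝒪 S) M) (over : LiesOver-x₀ M)
    (f : List K.Carrier) (monic : Polynomial.Monic K.rawRing f) (separable : Separable f) (reg : All Regular f)
    (R⊆ : RootOf f ⊆ K⟮ S ⟯) (distinct : DistinctRoots𝔽̄q (specialize reg)) where
    open Residue S M isMaximal over
    private
      module ΩD = DomainPolynomials em Ω.ring (field⇒domain em Ω.ring Ω.isField)
      module 𝒪S = CommutativeRing (𝒪ring S)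
      module 𝒪[t] = PolynomialRing (𝒪ring S)
      module E = CommutativeRing residueRing
      module →Ω = PolynomialMap (𝒪ring S) Ω.ring (𝒪→Ω S)
      module →E = PolynomialMap (𝒪ring S) residueRing 𝒪→E
      module 𝔽̄ = SplittingTypes em 𝔽q 𝔽̄q.ring (field⇒domain em 𝔽̄q.ring 𝔽̄q.isField) 𝔽̄q.embed

    p̄ : k[t].Poly
    p̄ = specialize reg

    rs : List Ω.Carrier
    rs = proj₁ separable

    f-splits : map ι.⟦_⟧ f ΩD.≋ ΩD.∏linear rs
    f-splits = ≡.subst (map ι.⟦_⟧ f ΩD.≋_) (≡.sym (ΩD.∏linear≡∏t- rs)) (ΩD.coeffwise (proj₂ (proj₂ separable)))

    root∈rs : ∀ {z} → RootOf f z → Any (z Ω.≈_) rs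
    root∈rs fz≈0 = ΩD.root-∏linear rs (ΩD.root-resp f-splits (ΩD.root fz≈0))

    rs-root : ∀ {z} → Any (z Ω.≈_) rs → RootOf f z
    rs-root z∈ = ΩD.vanishes (ΩD.root-resp (ΩD.≋-sym f-splits) (ΩD.∏linear-root rs z∈))

    root∈𝒪 : ∀ {z} → RootOf f z → z ∈ 𝒪 S
    root∈𝒪 fz≈0 = R⊆ fz≈0 , f , monic , reg , fz≈0

    us : List 𝒪S.Carrier
    us = All.toList (All.tabulate {xs = rs} λ r∈rs → root∈𝒪 (rs-root (Any.map Ω.reflexive r∈rs)))

    map-us : map proj₁ us ≡ rs
    map-us = map-toList (All.tabulate {xs = rs} λ r∈rs → root∈𝒪 (rs-root (Any.map Ω.reflexive r∈rs)))

    -- `f` with coefficients in the integral closure: it maps to `f` over `Ω` and to the specialized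
    -- polynomial over the residue ring, and so carries the splitting from one to the other.
    lifted : 𝒪[t].Poly
    lifted = All.reduce reduceRegular reg

    map-lifted : map proj₁ lifted ≡ map ι.⟦_⟧ f
    map-lifted = go reg
      where
      go : ∀ {f} (reg : All Regular f) → map proj₁ (All.reduce reduceRegular reg) ≡ map ι.⟦_⟧ f
      go []        = ≡.refl
      go (r ∷ reg) = ≡.cong (_ ∷_) (go reg)

    -- Equality in the integral closure is equality in `Ω`, so the factorization over `Ω` descends
    -- coefficient by coefficient.
    lifted-splits : lifted 𝒪[t].≋ 𝒪[t].∏linear us
    lifted-splits = 𝒪[t].coeffwise λ n → begin
      proj₁ (𝒪[t].coeff lifted n)              ≈⟨ →Ω.coeff-map lifted n ⟨
      ΩD.coeff (map proj₁ lifted) n            ≡⟨ ≡.cong (λ p → ΩD.coeff p n) map-lifted ⟩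
      ΩD.coeff (map ι.⟦_⟧ f) n                 ≈⟨ ΩD.at f-splits n ⟩
      ΩD.coeff (ΩD.∏linear rs) n               ≡⟨ ≡.cong (λ zs → ΩD.coeff (ΩD.∏linear zs) n) map-us ⟨
      ΩD.coeff (ΩD.∏linear (map proj₁ us)) n   ≈⟨ ΩD.at (→Ω.map-∏linear us) n ⟨
      ΩD.coeff (map proj₁ (𝒪[t].∏linear us)) n ≈⟨ →Ω.coeff-map (𝒪[t].∏linear us) n ⟩
      proj₁ (𝒪[t].coeff (𝒪[t].∏linear us) n)   ∎
      where open Relation.Binary.Reasoning.Setoid Ω.setoid

    specialize-lifted : mapₚ p̄ ≋ lifted
    specialize-lifted = go reg
      where
      go : ∀ {f} (reg : All Regular f) → mapₚ (specialize reg) ≋ All.reduce reduceRegular reg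
      go []        = ≋-refl
      go (r ∷ reg) = value-reduces r ∷-cong go reg

    residue-splits : mapₚ p̄ ≋ ∏linear us
    residue-splits = ≋-trans specialize-lifted (≡.subst₂ _≋_ (map-id lifted) (≡.cong ∏linear (map-id us))
      (≋-trans (→E.map-≋ lifted-splits) (→E.map-∏linear us)))

    𝔽̄-splits : 𝔽̄.mapₚ p̄ 𝔽̄.≋ 𝔽̄.∏linear (proj₁ distinct)
    𝔽̄-splits = ≡.subst (𝔽̄.mapₚ p̄ 𝔽̄.≋_) (≡.sym (𝔽̄.∏linear≡∏t- (proj₁ distinct)))
      (𝔽̄.coeffwise (proj₂ (proj₂ distinct)))

    module Residual = Split p̄ {us} residue-splits
    module Geometric = 𝔽̄.Split p̄ {proj₁ distinct} 𝔽̄-splits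

    -- The bridge: distinctness over the closure of `𝔽q` becomes a property of the factors over
    -- `𝔽q`, which is then available in the residue ring.
    factors∤ : ∀ {gs ds} → p̄ k[t].≋ k[t].∏ₚ gs → Pointwise k[t].IrreducibleOfDegree gs ds → NonDividing gs
    factors∤ p̄≋ irrs = Geometric.unique⇒nonDividing p̄≋ irrs (proj₁ (proj₂ distinct))

    factorization : k[t].Factorization p̄
    factorization = k[t].factorize-monic p̄ Residual.split-monic

    ds : List ℕ
    ds = proj₁ factorization

    private
      gs : List k[t].Poly
      gs = proj₁ (proj₂ factorization)

      p̄≋∏gs : p̄ k[t].≋ k[t].∏ₚ gs
      p̄≋∏gs = k[t].coeffwise (proj₁ (proj₂ (proj₂ factorization)))

      irrs : Pointwise k[t].IrreducibleOfDegree gs ds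
      irrs = proj₂ (proj₂ (proj₂ factorization))

    us-unique : Unique.Unique E.setoid us
    us-unique = Residual.nonDividing⇒unique p̄≋∏gs irrs (factors∤ p̄≋∏gs irrs)

    residualAction : Action ℓ
    residualAction = record { setoid = Rootsₛ p̄ ; π = frobenius p̄ ; π-cong = F-cong }

    geometricAction : Action ℓ
    geometricAction = record { setoid = 𝔽̄.Rootsₛ p̄ ; π = 𝔽̄.frobenius p̄ ; π-cong = 𝔽̄.F-cong }

    residual≅geometric : residualAction ≅ geometricAction
    residual≅geometric = sameCycleType⇒≅ {S = residualAction} {geometricAction}
      (Residual.splitting⇒cycle p̄≋∏gs irrs (factors∤ p̄≋∏gs irrs))
      (Geometric.splitting⇒cycle p̄≋∏gs irrs (factors∤ p̄≋∏gs irrs))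

    splitting⇒residualCycle : ∀ {es} → k[t].HasSplittingType p̄ es → HasCycleType (Rootsₛ p̄) (frobenius p̄) es
    splitting⇒residualCycle (hs , p̄≈ , irrs′) =
      Residual.splitting⇒cycle {hs} (k[t].coeffwise p̄≈) irrs′ (factors∤ (k[t].coeffwise p̄≈) irrs′)

    residualCycle⇒splitting : ∀ {es} → HasCycleType (Rootsₛ p̄) (frobenius p̄) es → k[t].HasSplittingType p̄ es
    residualCycle⇒splitting cycle =
      Residual.FromCycle.cycle⇒splitting p̄≋∏gs irrs (factors∤ p̄≋∏gs irrs) cycle

    z∈us : ∀ {z} (fz≈0 : RootOf f z) → Any (λ u → z Ω.≈ proj₁ u) us
    z∈us {z} fz≈0 = Anyₚ.map⁻ (≡.subst (Any (z Ω.≈_)) (≡.sym map-us) (root∈rs fz≈0))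

    reduceRoot : Setoid.Carrier (RootsΩ f) → Setoid.Carrier (Rootsₛ p̄)
    reduceRoot (z , fz≈0) = z̄ , vanishes (Residual.member-root (Any.map (λ {u} eq → ≈⇒residue {z̄} {u} eq) (z∈us fz≈0)))
      where
      z̄ : E.Carrier
      z̄ = z , root∈𝒪 fz≈0

    reduceRoot-injective : ∀ x y → proj₁ (reduceRoot x) E.≈ proj₁ (reduceRoot y) → proj₁ x Ω.≈ proj₁ y
    reduceRoot-injective x@(_ , fz≈0) y@(_ , fw≈0) = unique-members-~⇒≈ 𝒪S.setoid E.isEquivalence
      (λ {u} {v} eq → ≈⇒residue {u} {v} eq) {us} {proj₁ (reduceRoot x)} {proj₁ (reduceRoot y)}
      us-unique (z∈us fz≈0) (z∈us fw≈0)

    memberRoot : ∀ {u} → u ∈ₗ us → RootOf f (proj₁ u)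
    memberRoot {u} u∈ = rs-root (≡.subst (Any (proj₁ u Ω.≈_)) map-us (Anyₚ.map⁺ (Any.map (λ { ≡.refl → Ω.refl }) u∈)))

    preimage : Setoid.Carrier (Rootsₛ p̄) → Setoid.Carrier (RootsΩ f)
    preimage y = proj₁ (proj₁ (Residual.member y)) , memberRoot (proj₂ (Residual.member y))

    reduceRoot-preimage : ∀ y {x} → proj₁ x Ω.≈ proj₁ (preimage y) → proj₁ (reduceRoot x) E.≈ proj₁ y
    reduceRoot-preimage y {x} eq = E.trans {proj₁ (reduceRoot x)} {proj₁ (Residual.member y)} {proj₁ y}
      (≈⇒residue {proj₁ (reduceRoot x)} {proj₁ (Residual.member y)} eq)
      (E.sym {proj₁ y} {proj₁ (Residual.member y)} (Residual.member-≈ y))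

    reduction : Bijection (RootsΩ f) (Rootsₛ p̄)
    reduction = record
      { to        = reduceRoot
      ; cong      = λ {x} {y} eq → ≈⇒residue {proj₁ (reduceRoot x)} {proj₁ (reduceRoot y)} eq
      ; bijective = (λ {x} {y} eq → reduceRoot-injective x y eq) ,
          λ y → preimage y , λ {x} eq → reduceRoot-preimage y {x} eq
      }

    module _ (σ : Gal S) (isFrobenius : IsFrobenius M σ) where

      galoisAction : Action ℓ
      galoisAction = record { setoid = RootsΩ f ; π = act σ f R⊆ ; π-cong = Gal.to.⟦⟧-cong σ }

      reduceRoot-equivariant : ∀ x → proj₁ (reduceRoot (act σ f R⊆ x)) E.≈ F (proj₁ (reduceRoot x))
      reduceRoot-equivariant x@(z , fz≈0) = residue-difference {proj₁ (reduceRoot (act σ f R⊆ x))} {F z̄}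
        (isFrobenius z (root∈𝒪 fz≈0)) (power z̄ q)
        where
        z̄ : E.Carrier
        z̄ = proj₁ (reduceRoot x)

      galois≅residual : galoisAction ≅ residualAction
      galois≅residual = record { bijection = reduction ; equivariant = reduceRoot-equivariant }

      -- Both `y` and the image of `x` under `σ` reduce to the q-th power of the reduction of `x`,
      -- and reduction is injective on roots.
      frobenius-on-roots : ∀ x y → proj₁ y Ω.- (proj₁ x ^Ω q) ∈ M →
                           Setoid._≈_ (RootsΩ f) (act σ f R⊆ x) y
      frobenius-on-roots x y d = reduceRoot-injective (act σ f R⊆ x) y
        (E.trans {ȳ′} {F x̄} {ȳ} (reduceRoot-equivariant x) (E.sym {ȳ} {F x̄}
          (residue-difference {ȳ} {F x̄} d (power x̄ q))))
        where
        x̄ ȳ ȳ′ : E.Carrier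
        x̄  = proj₁ (reduceRoot x)
        ȳ  = proj₁ (reduceRoot y)
        ȳ′ = proj₁ (reduceRoot (act σ f R⊆ x))

-- Galois groups

module GaloisGroups (𝒮 : Setting ℓ) where
  open Over 𝒮
  private
    module ι = RingHomomorphism Ω.embed
    module F (S : Pred Ω.Carrier ℓ) = RawAlgebra (subfield S)

  inverse-unique : ∀ {x y x′ y′} → x Ω.* y Ω.≈ Ω.1# → x′ Ω.* y′ Ω.≈ Ω.1# → x Ω.≈ x′ → y Ω.≈ y′
  inverse-unique {x} {y} {x′} {y′} xy≈1 x′y′≈1 x≈x′ = begin
    y                   ≈⟨ Ω.*-identityʳ y ⟨
    y Ω.* Ω.1#          ≈⟨ Ω.*-congˡ x′y′≈1 ⟨
    y Ω.* (x′ Ω.* y′)   ≈⟨ Ω.*-assoc y x′ y′ ⟨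
    (y Ω.* x′) Ω.* y′   ≈⟨ Ω.*-congʳ (Ω.*-congˡ x≈x′) ⟨
    (y Ω.* x) Ω.* y′    ≈⟨ Ω.*-congʳ (Ω.trans (Ω.*-comm y x) xy≈1) ⟩
    Ω.1# Ω.* y′         ≈⟨ Ω.*-identityˡ y′ ⟩
    y′                  ∎
    where open import Relation.Binary.Reasoning.Setoid Ω.setoid

  module Apply {S : Pred Ω.Carrier ℓ} (σ : Gal S) where
    open Gal σ using () renaming (module to to to-hom)

    -- Elements of a subfield carry a membership derivation. Since an automorphism respects equality
    -- in `Ω`, its value does not depend on the derivation, and any convenient one may be used.
    apply : ∀ {z} → z ∈ K⟮ S ⟯ → Ω.Carrier
    apply {z} z∈ = proj₁ (Gal.to σ (z , z∈))

    apply-≈ : ∀ {y z} {y∈ : y ∈ K⟮ S ⟯} {z∈ : z ∈ K⟮ S ⟯} → y Ω.≈ z → apply y∈ Ω.≈ apply z∈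
    apply-≈ {y} {z} {y∈} {z∈} y≈z = to-hom.⟦⟧-cong {y , y∈} {z , z∈} y≈z

    apply-irrelevant : ∀ {z} (z∈ z∈′ : z ∈ K⟮ S ⟯) → apply z∈ Ω.≈ apply z∈′
    apply-irrelevant z∈ z∈′ = apply-≈ Ω.refl

    apply-base : ∀ {c} (c∈ : ι.⟦ c ⟧ ∈ K⟮ S ⟯) → apply c∈ Ω.≈ ι.⟦ c ⟧
    apply-base {c} c∈ = Ω.trans (apply-irrelevant c∈ (base c)) (Gal.fixes σ c)

    apply-add : ∀ {y z} (y∈ : y ∈ K⟮ S ⟯) (z∈ : z ∈ K⟮ S ⟯) (yz∈ : y Ω.+ z ∈ K⟮ S ⟯) →
                apply yz∈ Ω.≈ apply y∈ Ω.+ apply z∈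
    apply-add y∈ z∈ yz∈ = Ω.trans (apply-irrelevant yz∈ (add y∈ z∈)) (to-hom.+-homo (_ , y∈) (_ , z∈))

    apply-mul : ∀ {y z} (y∈ : y ∈ K⟮ S ⟯) (z∈ : z ∈ K⟮ S ⟯) (yz∈ : y Ω.* z ∈ K⟮ S ⟯) →
                apply yz∈ Ω.≈ apply y∈ Ω.* apply z∈
    apply-mul y∈ z∈ yz∈ = Ω.trans (apply-irrelevant yz∈ (mul y∈ z∈)) (to-hom.*-homo (_ , y∈) (_ , z∈))

    apply-neg : ∀ {z} (z∈ : z ∈ K⟮ S ⟯) (-z∈ : Ω.- z ∈ K⟮ S ⟯) → apply -z∈ Ω.≈ Ω.- apply z∈
    apply-neg z∈ -z∈ = Ω.trans (apply-irrelevant -z∈ (neg z∈)) (to-hom.-‿homo (_ , z∈))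

    apply-inv : ∀ {y z} (y∈ : y ∈ K⟮ S ⟯) (z∈ : z ∈ K⟮ S ⟯) → y Ω.* z Ω.≈ Ω.1# →
                apply y∈ Ω.* apply z∈ Ω.≈ Ω.1#
    apply-inv y∈ z∈ yz≈1 = Ω.trans (Ω.sym (apply-mul y∈ z∈ (mul y∈ z∈)))
      (Ω.trans (apply-≈ {y∈ = mul y∈ z∈} {proj₂ (F.1# S)} yz≈1) to-hom.1#-homo)

  module _ {S : Pred Ω.Carrier ℓ} (σ τ : Gal S) where
    private
      module σ = Apply σ
      module τ = Apply τ

    agree-on-generators : (∀ {z} (z∈ : z ∈ S) → σ.apply (gen z∈) Ω.≈ τ.apply (gen z∈)) →
                          ∀ {z} (z∈ : z ∈ K⟮ S ⟯) → σ.apply z∈ Ω.≈ τ.apply z∈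
    agree-on-generators agree = go
      where
      go : ∀ {z} (z∈ : z ∈ K⟮ S ⟯) → σ.apply z∈ Ω.≈ τ.apply z∈
      go (resp x≈y x∈) = Ω.trans (σ.apply-≈ (Ω.sym x≈y)) (Ω.trans (go x∈) (τ.apply-≈ x≈y))
      go (base c)      = Ω.trans (σ.apply-base (base c)) (Ω.sym (τ.apply-base (base c)))
      go (gen z∈)      = agree z∈
      go (add x∈ y∈)   = Ω.trans (σ.apply-add x∈ y∈ _) (Ω.trans (Ω.+-cong (go x∈) (go y∈)) (Ω.sym (τ.apply-add x∈ y∈ _)))
      go (mul x∈ y∈)   = Ω.trans (σ.apply-mul x∈ y∈ _) (Ω.trans (Ω.*-cong (go x∈) (go y∈)) (Ω.sym (τ.apply-mul x∈ y∈ _)))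
      go (neg x∈)      = Ω.trans (σ.apply-neg x∈ _) (Ω.trans (Ω.-‿cong (go x∈)) (Ω.sym (τ.apply-neg x∈ _)))
      go (inv x∈ xy≈1) = inverse-unique (σ.apply-inv x∈ (inv x∈ xy≈1) xy≈1) (τ.apply-inv x∈ (inv x∈ xy≈1) xy≈1) (go x∈)

  module Restriction {m : ℕ} (f : Fin m → List K.Carrier) where
    L : Pred Ω.Carrier ℓ
    L = ⋃L f

    Lᵢ : Fin m → Pred Ω.Carrier ℓ
    Lᵢ i = RootOf (f i)

    G : RawGroup ℓ ℓ
    G = galoisGroup L

    private module G = RawGroup G

    -- Normality of a splitting field: `σ` fixes the coefficients of `f i` and hence sends roots to
    -- roots. The remaining cases follow the derivation of membership.
    preserves : (σ : Gal L) → ∀ {i z} (z∈ : z ∈ K⟮ Lᵢ i ⟯) → Apply.apply σ (gen (i , z∈)) ∈ K⟮ Lᵢ i ⟯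
    preserves σ {i} = go
      where
      open Apply σ
      lift : ∀ {z} → z ∈ K⟮ Lᵢ i ⟯ → z ∈ K⟮ L ⟯
      lift z∈ = gen (i , z∈)
      go : ∀ {z} (z∈ : z ∈ K⟮ Lᵢ i ⟯) → apply (lift z∈) ∈ K⟮ Lᵢ i ⟯
      go (resp x≈y x∈) = resp (apply-≈ x≈y) (go x∈)
      go (base c)      = resp (Ω.sym (apply-base (lift (base c)))) (base c)
      go (gen z∈)      = gen (proj₂ (act σ (f i) (λ z∈R → lift (gen z∈R)) (_ , z∈)))
      go (add x∈ y∈)   = resp (Ω.sym (apply-add (lift x∈) (lift y∈) _)) (add (go x∈) (go y∈))
      go (mul x∈ y∈)   = resp (Ω.sym (apply-mul (lift x∈) (lift y∈) _)) (mul (go x∈) (go y∈))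
      go (neg x∈)      = resp (Ω.sym (apply-neg (lift x∈) _)) (neg (go x∈))
      go (inv x∈ xy≈1) = inv (go x∈) (apply-inv (lift x∈) (lift (inv x∈ xy≈1)) xy≈1)

    restrictMap : Gal L → ∀ i → F.Carrier (Lᵢ i) → F.Carrier (Lᵢ i)
    restrictMap σ i (z , z∈) = Apply.apply σ (gen (i , z∈)) , preserves σ z∈

    restrictMap-hom : ∀ σ i → IsRingHomomorphism (F.rawRing (Lᵢ i)) (F.rawRing (Lᵢ i)) (restrictMap σ i)
    restrictMap-hom σ i = isRingHom (F.rawRing (Lᵢ i)) (F.rawRing (Lᵢ i)) (restrictMap σ i)
      apply-≈
      (λ (_ , x∈) (_ , y∈) → apply-add (gen (i , x∈)) (gen (i , y∈)) _)
      (λ (_ , x∈) (_ , y∈) → apply-mul (gen (i , x∈)) (gen (i , y∈)) _)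
      (λ (_ , x∈) → apply-neg (gen (i , x∈)) _)
      (Ω.trans (apply-irrelevant _ (proj₂ (F.0# L))) (Gal.to.0#-homo σ))
      (Ω.trans (apply-irrelevant _ (proj₂ (F.1# L))) (Gal.to.1#-homo σ))
      where open Apply σ

    restrict : Gal L → ∀ i → Gal (Lᵢ i)
    restrict σ i = record
      { to       = restrictMap σ i
      ; from     = restrictMap (σ G.⁻¹) i
      ; to-hom   = restrictMap-hom σ i
      ; from-hom = restrictMap-hom (σ G.⁻¹) i
      ; to-from  = λ (z , z∈) → Ω.trans (Apply.apply-irrelevant σ _ _) (Gal.to-from σ (z , gen (i , z∈)))
      ; from-to  = λ (z , z∈) → Ω.trans (Apply.apply-irrelevant (σ G.⁻¹) _ _) (Gal.from-to σ (z , gen (i , z∈)))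
      ; fixes    = λ c → Apply.apply-base σ _
      }

    restrict-injective : ∀ σ τ → (∀ i z → proj₁ (Gal.to (restrict σ i) z) Ω.≈ proj₁ (Gal.to (restrict τ i) z)) →
                         ∀ z → proj₁ (Gal.to σ z) Ω.≈ proj₁ (Gal.to τ z)
    restrict-injective σ τ eq (z , z∈) = agree-on-generators σ τ (λ (i , z∈) → eq i (_ , z∈)) z∈

    module Extend (disjoint : LinearlyDisjoint f) where
      private
        module L⊗ = Tensor K (λ i → subfield (Lᵢ i))
        μ : L⊗.Formal → F.Carrier L
        μ = L⊗.multiply (subfield L) (Lᵢ⊆L f)
        module μ = IsRingIsomorphism disjoint
      open L⊗ using (Formal; Pure; _≈⊗_)

      tensor : F.Carrier L → Formal
      tensor z = proj₁ (μ.surjective z)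

      μ-tensor : ∀ z → proj₁ (μ (tensor z)) Ω.≈ proj₁ z
      μ-tensor z = proj₂ (μ.surjective z) L⊗.refl

      tensor-≈ : ∀ z s → proj₁ z Ω.≈ proj₁ (μ s) → tensor z ≈⊗ s
      tensor-≈ z s eq = μ.injective (Ω.trans (μ-tensor z) eq)

      EntryEq : K.Carrier × Pure → K.Carrier × Pure → Set ℓ
      EntryEq (c , x) (d , y) = c K.≈ d × (∀ i → proj₁ (x i) Ω.≈ proj₁ (y i))

      pointwise⇒≈⊗ : ∀ {s t} → Pointwise EntryEq s t → s ≈⊗ t
      pointwise⇒≈⊗ []                       = L⊗.refl
      pointwise⇒≈⊗ ((c≈d , x≈y) ∷ s≈t) = L⊗.trans (L⊗.cong c≈d x≈y) (L⊗.prep _ (pointwise⇒≈⊗ s≈t))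

      module Componentwise (τ : ∀ i → Gal (Lᵢ i)) where
        private module τ i = Gal (τ i)

        onPure : Pure → Pure
        onPure x i = τ.to i (x i)

        onEntry : K.Carrier × Pure → K.Carrier × Pure
        onEntry (c , x) = c , onPure x

        T : Formal → Formal
        T = map onEntry

        onPure-cong : ∀ i {y z : F.Carrier (Lᵢ i)} → proj₁ y Ω.≈ proj₁ z → proj₁ (τ.to i y) Ω.≈ proj₁ (τ.to i z)
        onPure-cong i {y} {z} = τ.to.⟦⟧-cong i {y} {z}

        -- Each defining relation of the tensor product is preserved because every `τ i` is additive
        -- and `K`-linear.
        T-cong : ∀ {s t} → s ≈⊗ t → T s ≈⊗ T t
        T-cong L⊗.refl = L⊗.refl
        T-cong (L⊗.sym eq) = L⊗.sym (T-cong eq)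
        T-cong (L⊗.trans eq eq′) = L⊗.trans (T-cong eq) (T-cong eq′)
        T-cong (L⊗.prep e eq) = L⊗.prep (onEntry e) (T-cong eq)
        T-cong (L⊗.swap e e′ s) = L⊗.swap (onEntry e) (onEntry e′) (T s)
        T-cong (L⊗.cong {x = x} {y} c≈d x≈y) = L⊗.cong c≈d (λ i → onPure-cong i {x i} {y i} (x≈y i))
        T-cong (L⊗.coeff-+ c d x s) = L⊗.coeff-+ c d (onPure x) (T s)
        T-cong (L⊗.coeff-0 x s) = L⊗.coeff-0 (onPure x) (T s)
        T-cong (L⊗.additive i {x = x} {y} {z} x~y x~z xᵢ≈) = L⊗.additive i
          (λ j j≢i → onPure-cong j {x j} {y j} (x~y j j≢i)) (λ j j≢i → onPure-cong j {x j} {z j} (x~z j j≢i))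
          (Ω.trans (onPure-cong i {x i} {F._+_ (Lᵢ i) (y i) (z i)} xᵢ≈) (τ.to.+-homo i (y i) (z i)))
        T-cong (L⊗.homogeneous i {a = a} {x} {y} x~y xᵢ≈) = L⊗.homogeneous i
          (λ j j≢i → onPure-cong j {x j} {y j} (x~y j j≢i))
          (Ω.trans (onPure-cong i {x i} {F._*_ (Lᵢ i) (F.scalar (Lᵢ i) a) (y i)} xᵢ≈)
            (Ω.trans (τ.to.*-homo i (F.scalar (Lᵢ i) a) (y i)) (Ω.*-congʳ (τ.fixes i a))))

        T-* : ∀ s t → Pointwise EntryEq (T (RawRing._*_ L⊗.rawRing s t)) (RawRing._*_ L⊗.rawRing (T s) (T t))
        T-* []            t = []
        T-* ((c , x) ∷ s) t = ≡.subst (λ u → Pointwise EntryEq u (RawRing._*_ L⊗.rawRing (T ((c , x) ∷ s)) (T t)))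
          (≡.sym (map-++ onEntry (map (times (c , x)) t) _)) (++⁺ (row t) (T-* s t))
          where
          times : K.Carrier × Pure → K.Carrier × Pure → K.Carrier × Pure
          times (c , x) (d , y) = c K.* d , λ i → F._*_ (Lᵢ i) (x i) (y i)
          row : ∀ t → Pointwise EntryEq (T (map (times (c , x)) t)) (map (times (c , onPure x)) (T t))
          row []            = []
          row ((d , y) ∷ t) = (K.refl , λ i → τ.to.*-homo i (x i) (y i)) ∷ row t

        extendMap : F.Carrier L → F.Carrier L
        extendMap z = μ (T (tensor z))

        -- Injectivity of `μ`, that is linear disjointness, allows any tensor representing `z` to be
        -- used. All homomorphism laws come from choosing a suitable one.
        extendMap-μ : ∀ z s → proj₁ z Ω.≈ proj₁ (μ s) → proj₁ (extendMap z) Ω.≈ proj₁ (μ (T s))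
        extendMap-μ z s eq = μ.⟦⟧-cong (T-cong (tensor-≈ z s eq))

        extendMap-hom : IsRingHomomorphism (F.rawRing L) (F.rawRing L) extendMap
        extendMap-hom = isRingHom (F.rawRing L) (F.rawRing L) extendMap
          (λ {y} {z} y≈z → extendMap-μ y (tensor z) (Ω.trans y≈z (Ω.sym (μ-tensor z))))
          (λ y z → Ω.trans
            (extendMap-μ (F._+_ L y z) (tensor y ++ tensor z)
              (Ω.sym (Ω.trans (μ.+-homo (tensor y) (tensor z)) (Ω.+-cong (μ-tensor y) (μ-tensor z)))))
            (Ω.trans (Ω.reflexive (≡.cong (λ s → proj₁ (μ s)) (map-++ onEntry (tensor y) (tensor z))))
              (μ.+-homo (T (tensor y)) (T (tensor z)))))
          (λ y z → Ω.trans
            (extendMap-μ (F._*_ L y z) (RawRing._*_ L⊗.rawRing (tensor y) (tensor z))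
              (Ω.sym (Ω.trans (μ.*-homo (tensor y) (tensor z)) (Ω.*-cong (μ-tensor y) (μ-tensor z)))))
            (Ω.trans (μ.⟦⟧-cong (pointwise⇒≈⊗ (T-* (tensor y) (tensor z))))
              (μ.*-homo (T (tensor y)) (T (tensor z)))))
          (λ z → Ω.trans
            (extendMap-μ (F.-_ L z) (RawRing.-_ L⊗.rawRing (tensor z))
              (Ω.sym (Ω.trans (μ.-‿homo (tensor z)) (Ω.-‿cong (μ-tensor z)))))
            -- Negation changes only the coefficient of an entry and `T` only its tensor, so the two
            -- composites are the same function by computation. Fusing and splitting the maps swaps
            -- them.
            (Ω.trans (Ω.reflexive (≡.cong (λ s → proj₁ (μ s)) (≡.trans (≡.sym (map-∘ (tensor z))) (map-∘ (tensor z)))))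
              (μ.-‿homo (T (tensor z)))))
          (extendMap-μ (F.0# L) [] Ω.refl)
          (Ω.trans (extendMap-μ (F.1# L) (RawRing.1# L⊗.rawRing) (Ω.sym μ.1#-homo))
            (Ω.trans (μ.⟦⟧-cong (pointwise⇒≈⊗ ((K.refl , λ i → τ.to.1#-homo i) ∷ []))) μ.1#-homo))

      product-ones : ∀ {n} (t : Fin n → F.Carrier L) → (∀ i → proj₁ (t i) Ω.≈ Ω.1#) →
                     proj₁ (product (RawRing.rawSemiring (F.rawRing L)) t) Ω.≈ Ω.1#
      product-ones {zero}  t t≈1 = Ω.refl
      product-ones {suc n} t t≈1 =
        Ω.trans (Ω.*-cong (t≈1 zero) (product-ones (λ i → t (suc i)) (λ i → t≈1 (suc i)))) (Ω.*-identityˡ Ω.1#)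

      product-single : ∀ {n} (t : Fin n → F.Carrier L) i → (∀ j → j ≢ i → proj₁ (t j) Ω.≈ Ω.1#) →
                       proj₁ (product (RawRing.rawSemiring (F.rawRing L)) t) Ω.≈ proj₁ (t i)
      product-single {suc n} t zero    t≈1 =
        Ω.trans (Ω.*-congˡ (product-ones (λ i → t (suc i)) (λ i → t≈1 (suc i) λ ()))) (Ω.*-identityʳ _)
      product-single {suc n} t (suc i) t≈1 =
        Ω.trans (Ω.*-cong (t≈1 zero λ ()) (product-single (λ i → t (suc i)) i
          (λ j j≢i → t≈1 (suc j) (λ eq → j≢i (Fin.suc-injective eq))))) (Ω.*-identityˡ _)

      ones : Pure
      ones i = F.1# (Lᵢ i)

      μ-scalar : ∀ c → proj₁ (μ ((c , ones) ∷ [])) Ω.≈ ι.⟦ c ⟧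
      μ-scalar c = Ω.trans (Ω.+-identityʳ _)
        (Ω.trans (Ω.*-congˡ (product-ones (λ i → Lᵢ⊆L f i (ones i)) (λ i → Ω.refl))) (Ω.*-identityʳ _))

      -- The type of the entry depends on `j`. Taking the decision as an argument lets its equality
      -- proof be matched, which puts `z` in the right field.
      place : ∀ i (z : F.Carrier (Lᵢ i)) j → Dec (j ≡ i) → F.Carrier (Lᵢ j)
      place i z j (yes ≡.refl) = z
      place i z j (no _)       = ones j

      single : ∀ i → F.Carrier (Lᵢ i) → Formal
      single i z = (K.1# , λ j → place i z j (j Fin.≟ i)) ∷ []

      μ-pure : ∀ i (x : Pure) → (∀ j → j ≢ i → proj₁ (x j) Ω.≈ Ω.1#) →
               proj₁ (μ ((K.1# , x) ∷ [])) Ω.≈ proj₁ (x i)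
      μ-pure i x x≈1 = Ω.trans (Ω.+-identityʳ _) (Ω.trans (Ω.*-cong ι.1#-homo
        (product-single (λ j → Lᵢ⊆L f j (x j)) i x≈1)) (Ω.*-identityˡ _))

      extend : (∀ i → Gal (Lᵢ i)) → Gal L
      extend τ = record
        { to = to.extendMap ; from = from.extendMap
        ; to-hom = to.extendMap-hom ; from-hom = from.extendMap-hom
        ; to-from = λ z → Ω.trans (to.extendMap-μ _ (from.T (tensor z)) Ω.refl)
            (Ω.trans (μ.⟦⟧-cong (pointwise⇒≈⊗
              (cancel (λ i → Gal.to (τ i)) (λ i → Gal.from (τ i)) (λ i → Gal.to-from (τ i)) (tensor z)))) (μ-tensor z))
        ; from-to = λ z → Ω.trans (from.extendMap-μ _ (to.T (tensor z)) Ω.refl)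
            (Ω.trans (μ.⟦⟧-cong (pointwise⇒≈⊗
              (cancel (λ i → Gal.from (τ i)) (λ i → Gal.to (τ i)) (λ i → Gal.from-to (τ i)) (tensor z)))) (μ-tensor z))
        ; fixes = λ c → Ω.trans (to.extendMap-μ _ ((c , ones) ∷ []) (Ω.sym (μ-scalar c)))
            (Ω.trans (μ.⟦⟧-cong (pointwise⇒≈⊗ ((K.refl , λ i → Gal.to.1#-homo (τ i)) ∷ []))) (μ-scalar c))
        }
        where
        module to = Componentwise τ
        module from = Componentwise (λ i → RawGroup._⁻¹ (galoisGroup (Lᵢ i)) (τ i))
        cancel : (g h : ∀ i → F.Carrier (Lᵢ i) → F.Carrier (Lᵢ i)) →
                 (∀ i z → proj₁ (g i (h i z)) Ω.≈ proj₁ z) →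
                 ∀ s → Pointwise EntryEq (map (λ (c , x) → c , λ i → g i (x i)) (map (λ (c , x) → c , λ i → h i (x i)) s)) s
        cancel g h gh []            = []
        cancel g h gh ((c , x) ∷ s) = (K.refl , λ i → gh i (x i)) ∷ cancel g h gh s

      -- An element of the i-th field is represented by the pure tensor with `z` at `i` and 1
      -- elsewhere, and the other automorphisms fix 1.
      restrict-extend : ∀ τ i z → proj₁ (Gal.to (restrict (extend τ) i) z) Ω.≈ proj₁ (Gal.to (τ i) z)
      restrict-extend τ i z = Ω.trans
        (to.extendMap-μ (Lᵢ⊆L f i z) (single i z) (Ω.sym (Ω.trans (μ-pure i _ off) (on (i Fin.≟ i)))))
        (Ω.trans (μ-pure i (to.onPure _) (λ j j≢i →
          Ω.trans (to.onPure-cong j {place i z j (j Fin.≟ i)} {ones j} (off j j≢i)) (Gal.to.1#-homo (τ j))))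
          (to.onPure-cong i {place i z i (i Fin.≟ i)} {z} (on (i Fin.≟ i))))
        where
        module to = Componentwise τ
        on : ∀ d → proj₁ (place i z i d) Ω.≈ proj₁ z
        on (yes ≡.refl) = Ω.refl
        on (no  i≢i)    = ⊥-elim (i≢i ≡.refl)
        off : ∀ j → j ≢ i → proj₁ (place i z j (j Fin.≟ i)) Ω.≈ Ω.1#
        off j j≢i with j Fin.≟ i
        ... | yes j≡i = ⊥-elim (j≢i j≡i)
        ... | no  _   = Ω.refl

      restrict-isomorphism : IsGroupIsomorphism G (Πᵍ (λ i → galoisGroup (Lᵢ i))) restrict
      restrict-isomorphism = record
        { isGroupMonomorphism = record
          { isGroupHomomorphism = record
            { isMonoidHomomorphism = record
              { isMagmaHomomorphism = record
                { isRelHomomorphism = record { cong = λ σ≈τ i (z , z∈) → σ≈τ (z , gen (i , z∈)) }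
                ; homo = λ σ τ i (z , z∈) → Apply.apply-irrelevant σ _ _
                }
              ; ε-homo = λ i z → Ω.refl
              }
            ; ⁻¹-homo = λ σ i z → Ω.refl
            }
          ; injective = λ {σ} {τ} eq → restrict-injective σ τ eq
          }
        ; surjective = λ τ → extend τ , λ {σ} σ≈ i (z , z∈) →
            Ω.trans (σ≈ (z , gen (i , z∈))) (restrict-extend τ i (z , z∈))
        }

-- The Frobenius element of the compositum and simultaneous splitting

open Defs using (Poly; Monic; HasSplittingType)

module SimultaneousSplitting (em : ExcludedMiddle ℓ) (𝒮 : Setting ℓ) where
  open Over 𝒮
  open GaloisGroups 𝒮
  open Reductions em 𝒮

  module FrobeniusSplitting
    {m : ℕ} (f : Fin m → Poly K)
    (monic : ∀ i → Monic K (f i)) (separable : ∀ i → Separable (f i)) (reg : ∀ i → All Regular (f i))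
    (distinct : ∀ i → DistinctRoots𝔽̄q (specialize (reg i)))
    (M : Pred Ω.Carrier ℓ) (isMaximal : IsMaximalIdeal (𝒪 (⋃L f)) M) (over : LiesOver-x₀ M)
    (Frob : Gal (⋃L f)) (isFrobenius : IsFrobenius M Frob) where
    open Restriction f using (restrict; preserves)

    -- Every `f i` is reduced inside the compositum, modulo the same `M`. Hence no maximality of the
    -- contraction of `M` to a single field has to be proved.
    module Reduction i = RootReduction (⋃L f) M isMaximal over (f i) (monic i) (separable i) (reg i)
                           (λ z∈R → gen (i , gen z∈R)) (distinct i)

    opaque
      galois≅geometric : ∀ i → Reduction.galoisAction i Frob isFrobenius ≅ Reduction.geometricAction i
      galois≅geometric i = ≅-trans
        {S = Reduction.galoisAction i Frob isFrobenius} {Reduction.residualAction i} {Reduction.geometricAction i}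
        (Reduction.galois≅residual i Frob isFrobenius) (Reduction.residual≅geometric i)

    Φ : Bijection (Πₛ (λ i → RootsΩ (f i))) (Πₛ (λ i → Roots𝔽̄q (specialize (reg i))))
    Φ = Π-bijection {S = λ i → RootsΩ (f i)} {λ i → Roots𝔽̄q (specialize (reg i))}
      (λ i → bijection (galois≅geometric i))

    Φ-equivariant : ∀ r i →
      proj₁ (Bijection.to Φ (λ j → act Frob (f j) (λ z∈R → gen (j , gen z∈R)) (r j)) i)
        𝔽̄q.≈ (proj₁ (Bijection.to Φ r i) ^𝔽̄q q)
    Φ-equivariant r i = equivariant (galois≅geometric i) (r i)

    power∈ : ∀ {S : Pred Ω.Carrier ℓ} {z} → z ∈ K⟮ S ⟯ → ∀ n → (z ^Ω n) ∈ K⟮ S ⟯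
    power∈ {S} z∈ zero    = proj₂ (RawAlgebra.1# (subfield S))
    power∈     z∈ (suc n) = mul z∈ (power∈ z∈ n)

    restrict-frobenius : ∀ i → IsFrobenius (M ∩ K⟮ RootOf (f i) ⟯) (restrict Frob i)
    restrict-frobenius i a (a∈ , a-integral) =
      isFrobenius a (gen (i , a∈) , a-integral) , add (preserves Frob a∈) (neg (power∈ a∈ q))

    -- A root of `f i` is integral, so `Frobᵢ i` sends it to a root congruent to its q-th power
    -- modulo `M`. The only such root is its image under `Frob`, and the roots generate the field.
    frobenius-unique : (Frobᵢ : ∀ i → Gal (RootOf (f i))) →
                       (∀ i → IsFrobenius (M ∩ K⟮ RootOf (f i) ⟯) (Frobᵢ i)) →
                       RawGroup._≈_ (Πᵍ (λ i → galoisGroup (RootOf (f i)))) (restrict Frob) Frobᵢ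
    frobenius-unique Frobᵢ isFrobeniusᵢ i (z , z∈) = agree-on-generators (restrict Frob i) (Frobᵢ i)
      (λ {z} z∈R → Reduction.frobenius-on-roots i Frob isFrobenius (z , z∈R) (act (Frobᵢ i) (f i) gen (z , z∈R))
        (proj₁ (isFrobeniusᵢ i z (gen z∈R , f i , monic i , reg i , z∈R)))) z∈

    -- The restricted and the unrestricted Frobenius act on the roots by the same values in `Ω`, so
    -- cycle types computed in the residue ring apply to the restriction.
    restricted≅residual : ∀ i →
      record { setoid = RootsΩ (f i) ; π = act (restrict Frob i) (f i) gen ; π-cong = Gal.to.⟦⟧-cong (restrict Frob i) }
        ≅ Reduction.residualAction i
    restricted≅residual i = ≅-trans {T = Reduction.galoisAction i Frob isFrobenius} {Reduction.residualAction i}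
      (≅-identity {S = RootsΩ (f i)} (act (restrict Frob i) (f i) gen) (act Frob (f i) (λ z∈R → gen (i , gen z∈R)))
        (Gal.to.⟦⟧-cong (restrict Frob i)) (Gal.to.⟦⟧-cong Frob) (λ _ → Ω.refl))
      (Reduction.galois≅residual i Frob isFrobenius)

    splittingType⇔cycleType : ∀ i ds → HasSplittingType 𝔽q.ring (specialize (reg i)) ds ⇔
                              HasCycleType (RootsΩ (f i)) (act (restrict Frob i) (f i) gen) ds
    splittingType⇔cycleType i ds = mk⇔
      (λ splitting → transport-cycleType {S = Reduction.residualAction i} {Restricted}
          (≅-sym {S = Restricted} {Reduction.residualAction i} (restricted≅residual i))
        (Reduction.splitting⇒residualCycle i splitting))
      (λ cycle → Reduction.residualCycle⇒splitting i
        (transport-cycleType {S = Restricted} {Reduction.residualAction i} (restricted≅residual i) cycle))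
      where
      Restricted : Action ℓ
      Restricted = record
        { setoid = RootsΩ (f i) ; π = act (restrict Frob i) (f i) gen ; π-cong = Gal.to.⟦⟧-cong (restrict Frob i) }

theorem4p3 : ∀ {ℓ} → ExcludedMiddle ℓ → (𝒮 : Setting ℓ) → let open Over 𝒮 in
    ∀ {m : ℕ} (f : Fin m → Poly K) →
    (∀ i → Monic K (f i)) →
    (∀ i → Separable (f i)) →
    (reg : ∀ i → All Regular (f i)) →
    LinearlyDisjoint f →
    (∀ i → DistinctRoots𝔽̄q (specialize (reg i))) →
    Σ[ res ∈ (Gal (⋃L f) → ∀ i → Gal (RootOf (f i))) ]
    (∀ σ i z → proj₁ (Gal.to (res σ i) z) Ω.≈ proj₁ (Gal.to σ (Lᵢ⊆L f i z))) ×
    IsGroupIsomorphism (galoisGroup (⋃L f)) (Πᵍ (λ i → galoisGroup (RootOf (f i)))) res ×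
    (∀ (M : Pred Ω.Carrier ℓ) → IsMaximalIdeal (𝒪 (⋃L f)) M → LiesOver-x₀ M →
    ∀ (Frob : Gal (⋃L f)) → IsFrobenius M Frob →
    (Σ[ Φ ∈ Bijection (Πₛ (λ i → RootsΩ (f i))) (Πₛ (λ i → Roots𝔽̄q (specialize (reg i)))) ]
    (∀ r i → proj₁ (Bijection.to Φ (λ j → act Frob (f j) (λ z∈R → gen (j , gen z∈R)) (r j)) i)
    𝔽̄q.≈ (proj₁ (Bijection.to Φ r i) ^𝔽̄q q))) ×
    (∀ i → IsFrobenius (M ∩ K⟮ RootOf (f i) ⟯) (res Frob i)) ×
    (∀ (Frobᵢ : ∀ i → Gal (RootOf (f i))) →
    (∀ i → IsFrobenius (M ∩ K⟮ RootOf (f i) ⟯) (Frobᵢ i)) →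
    RawGroup._≈_ (Πᵍ (λ i → galoisGroup (RootOf (f i)))) (res Frob) Frobᵢ) ×
    (∀ i (ds : List ℕ) →
    HasSplittingType 𝔽q.ring (specialize (reg i)) ds ⇔
    HasCycleType (RootsΩ (f i)) (act (res Frob i) (f i) gen) ds))
theorem4p3 em 𝒮 f monic separable reg disjoint distinct =
  restrict , (λ σ i z → Over.Ω.refl 𝒮) , restrict-isomorphism ,
  λ M isMaximal over Frob isFrobenius →
    let open SimultaneousSplitting em 𝒮
        open FrobeniusSplitting f monic separable reg distinct M isMaximal over Frob isFrobenius
    in
    (Φ , Φ-equivariant) ,
    restrict-frobenius , frobenius-unique , splittingType⇔cycleType
  where
  open GaloisGroups 𝒮
  open Restriction f
  open Extend disjoint
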